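{- Let $f\in\mathbb{L}[X]$ be a polynomial of degree $d\ge2$ with $\gcd(d,p)=1$, and let $\mathcal{A},\mathcal{B}\subseteq\mathbb{L}$ be affine subspaces over $\mathbb{K}$ of dimensions $s$ and $m$, respectively. Then $$\mathcal{I}_f(\mathcal{A},\mathcal{B})=q^{s+m-r}+O\left(dq^{r/2}\right),$$ where the implied constant is absolute.
   Context: $q$ is a prime power with characteristic $p$, $r>1$, $\mathbb{K}=\mathbb{F}_q$, $\mathbb{L}=\mathbb{F}_{q^r}$ regarded as a $\mathbb{K}$-vector space; an affine subspace of dimension $s$ is a translate of a $\mathbb{K}$-linear subspace of dimension $s$. $\mathcal{I}_f(\mathcal{A},\mathcal{B})=\#\{u\in\mathcal{A}: f(u)\in\mathcal{B}\}$. -}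

module Defs where

open import Level using (0ℓ)
open import Data.Nat as ℕ using (ℕ; zero; suc)
open import Data.Fin using (Fin; fromℕ)
import Data.Fin
open import Data.List using (List; length)
open import Data.List.Membership.Propositional using (_∈_)
open import Data.List.Relation.Unary.Unique.Propositional using (Unique)
open import Data.Product using (Σ; _×_)
open import Relation.Binary.PropositionalEquality using (_≡_; _≢_)
open import Relation.Binary.Definitions using (DecidableEquality)
open import Relation.Nullary using (¬_)
open import Algebra.Structures using (IsCommutativeRing)
open import Function.Bundles using (_⇔_)

record FiniteField : Set₁ where
  infixl 6 _+_
  infixl 7 _*_
  field
    Carrier  : Set
    _≟_      : DecidableEquality Carrier
    _+_ _*_  : Carrier → Carrier → Carrier
    -_       : Carrier → Carrier
    0# 1#    : Carrier
    _⁻¹      : Carrier → Carrier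
    isCommutativeRing : IsCommutativeRing _≡_ _+_ _*_ -_ 0# 1#
    0≢1      : 0# ≢ 1#
    inverseʳ : ∀ x → x ≢ 0# → x * (x ⁻¹) ≡ 1#
    elements : List Carrier
    elements-unique   : Unique elements
    elements-complete : ∀ x → x ∈ elements

module _ (F : FiniteField) where
  open FiniteField F

  natMul : ℕ → Carrier
  natMul zero    = 0#
  natMul (suc n) = 1# + natMul n

  ∑ : ∀ {n} → (Fin n → Carrier) → Carrier
  ∑ {zero}  g = 0#
  ∑ {suc n} g = g Data.Fin.zero + ∑ (λ i → g (Data.Fin.suc i))

  pow : Carrier → ℕ → Carrier
  pow x zero    = 1#
  pow x (suc n) = x * pow x n

  record Subfield (q : ℕ) : Set₁ where
    field
      In       : Carrier → Set
      In-0     : In 0#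
      In-1     : In 1#
      In-+     : ∀ {x y} → In x → In y → In (x + y)
      In-*     : ∀ {x y} → In x → In y → In (x * y)
      In--     : ∀ {x} → In x → In (- x)
      In-⁻¹    : ∀ {x} → In x → In (x ⁻¹)
      elems    : List Carrier
      elems-unique : Unique elems
      elems-spec   : ∀ x → (x ∈ elems) ⇔ In x
      elems-card   : length elems ≡ q

  module _ {q : ℕ} (K : Subfield q) where
    open Subfield K

    lincomb : ∀ {s} → (Fin s → Carrier) → (Fin s → Carrier) → Carrier
    lincomb c v = ∑ (λ i → c i * v i)

    KLinIndep : ∀ {s} → (Fin s → Carrier) → Set
    KLinIndep v = ∀ c → (∀ i → In (c i)) → lincomb c v ≡ 0# → ∀ i → c i ≡ 0#

    record AffineSubspace (s : ℕ) : Set where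
      field
        base  : Carrier
        dirs  : Fin s → Carrier
        indep : KLinIndep dirs

      _∈A : Carrier → Set
      u ∈A = Σ (Fin s → Carrier) λ c → (∀ i → In (c i)) × (u ≡ base + lincomb c dirs)

  record Poly (d : ℕ) : Set where
    field
      coeff   : Fin (suc d) → Carrier
      leading : coeff (fromℕ d) ≢ 0#

    eval : Carrier → Carrier
    eval x = ∑ (λ i → coeff i * pow x (Data.Fin.toℕ i))

  HasCard : (Carrier → Set) → ℕ → Set
  HasCard P N = Σ (List Carrier) λ xs → Unique xs × (∀ x → (x ∈ xs) ⇔ P x) × length xs ≡ N

  IsIncidence : ∀ {q d s m} (K : Subfield q) → Poly d → AffineSubspace K s → AffineSubspace K m → ℕ → Set
  IsIncidence K f A B N =
    HasCard (λ u → AffineSubspace._∈A A u × AffineSubspace._∈A B (Poly.eval f u)) N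

{-# OPTIONS --safe #-}

-- Write Q = q ^ r = |L|, Tr for the trace from L to K, and A⊥, B⊥ for the annihilators, under (α, w) ↦ Tr (α w), of
-- the directions of A = a + W and B = b + W'.  A pair (α, β) ∈ A⊥ × B⊥ acts on u by Tr (α (u - a) + β (f u - b));
-- this form in (α, β) is zero when u is incident, and equidistributed over K otherwise.  Double counting therefore
-- reduces the theorem to level sets of Tr (α u + β f u), with an error averaged over the pairs: those with β = 0
-- are linear, and for β ≠ 0 one needs |q N - Q| ≤ 6 q d √Q for the number N of x with Tr (h x) = c, deg h = d.
--
-- This bound is obtained by Stepanov's method, applied to the value set {c} for the upper bound on N and to K ∖ {c}
-- for the lower one.  A nonzero combination R of x^b (x^Q - x)^l g^i with g = Tr h, l < J, i < q, b < a_l ≤ Q / q is made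
-- to vanish to order M ≈ √Q at all x₀ with g x₀ in the value set.  The degrees of the monomials are distinct because
-- gcd (d, q) = 1, so R ≠ 0 and counting zeros bounds their number.  At x₀, with t = x - x₀, one has x^Q - x = t^Q - t
-- and g = g x₀ + Tr (h (x₀ + t) - h x₀), whose coefficient of t^m has degree at most (d - 1) m in x₀; the conditions
-- are thus linear, and fewer than the unknowns.

module Submission where

open import Defs
open import Level using (0ℓ)
open import Algebra.Bundles using (CommutativeRing)
import Algebra.Properties.Semiring.Exp as Exp
import Algebra.Properties.CommutativeSemiring.Exp as CExp
import Algebra.Properties.CommutativeSemiring.Binomial as Binomial
import Algebra.Properties.Monoid.Mult as Mult
import Algebra.Properties.Semiring.Mult as SMult
import Algebra.Properties.Ring as RingProperties
import Algebra.Properties.CommutativeSemigroup as CommSemigroupProperties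
import Algebra.Properties.CommutativeMonoid.Sum as CMSum
import Algebra.Properties.Semiring.Sum as SRSum
import Relation.Binary.Reasoning.Setoid as SetoidReasoning
import Algebra.Solver.Ring.NaturalCoefficients.Default as NatSolver
open import Data.Nat.Solver using (module +-*-Solver)
open import Data.List using (List; []; _∷_; map; length; filter; foldr; _++_; upTo; lookup; cartesianProduct; cartesianProductWith; tabulate)
import Data.List.Properties as Listₚ
import Data.List.Relation.Unary.Any as Anyₗ
import Data.List.Relation.Unary.Any.Properties as Anyₚ
import Data.List.Relation.Unary.All.Properties as Allₚ
open import Data.List.Membership.Propositional using (_∈_; find)
import Data.List.Membership.Propositional.Properties as ∈ₚ
open import Data.List.Membership.Propositional.Properties.WithK using (unique∧set⇒bag)
open import Data.List.Relation.Binary.BagAndSetEquality using (∼bag⇒↭)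
open import Data.List.Relation.Binary.Permutation.Propositional as ↭ using (_↭_)
import Data.List.Relation.Binary.Permutation.Propositional.Properties as ↭ₚ
open import Data.List.Relation.Unary.Any using (here; there)
open import Data.List.Relation.Unary.All as All using (All; []; _∷_)
open import Data.List.Relation.Unary.AllPairs using ([]; _∷_)
open import Data.List.Relation.Unary.Unique.Propositional using (Unique)
import Data.List.Relation.Unary.Unique.Propositional.Properties as Uniqueₚ
open import Data.Nat as ℕ using (ℕ; zero; suc; _!)
import Data.Nat.Properties as ℕₚ
open import Data.Nat.Combinatorics using (_C_; nCk≡n!/k![n-k]!; k![n∸k]!∣n!; nCn≡1; nCk≡nC[n∸k])
open import Data.Nat.Divisibility as ∣ using (_∣_; divides)
import Data.Nat.DivMod as DM
open import Data.Nat.Primality using (Prime; euclidsLemma; prime⇒nonZero; prime⇒nonTrivial; ¬prime[0])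
open import Data.Nat.Coprimality as Coprimality using (Coprime; prime⇒coprime; coprime-Bézout; coprime-divisor)
open import Data.Nat.GCD using (module Bézout)
open import Data.Nat.ListAction using (sum)
open import Data.Nat.ListAction.Properties using (sum-↭)
open import Data.Nat.Induction using (<-rec)
import Data.Product.Properties as Productₚ
open import Data.Integer as ℤ using (ℤ)
import Data.Integer.Properties as ℤₚ
open import Data.Product using (Σ; ∃; _×_; _,_; proj₁; proj₂)
open import Data.Sum as Sum⊎ using (_⊎_; inj₁; inj₂)
open import Data.Unit using (⊤; tt)
open import Function.Bundles using (mk⇔; Equivalence)
open import Relation.Binary using (tri<; tri≈; tri>)
open import Relation.Nullary.Decidable using (toSum)
open import Relation.Nullary using (¬_; Dec; yes; no; contradiction; ¬?)
open import Relation.Binary.PropositionalEquality as ≡ using (_≡_; _≢_; cong; cong₂; subst; subst₂)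
open import Data.Empty using (⊥)
open import Data.Fin as Fin using (Fin)
import Data.Fin.Properties as Finₚ

-- Polynomials over a commutative ring

-- Counting solutions of Tr (h x) = c takes the place of exponential sums, so no complex characters
-- occur and every estimate is an inequality between natural numbers. The obstacle in Stepanov's
-- method is the characteristic: iterated derivatives of order at least p vanish, so multiplicities
-- are read off from an expansion in powers of a second variable T.
--
-- The order M is dictated by the following balance. With D = Q / q and a single value, vanishing to
-- order M costs about M D + d M² / 2 conditions, against J Q unknowns. As long as M² ≤ Q, a J of
-- about M / q + d suffices, and the power of g adds another d Q to the degree; dividing (M / q + 2
-- d) Q by M leaves Q / q + 2 d Q / M, which is best for M near √Q.
--
-- The constants: Q / M ≤ 3 M turns 2 d Q / M into 6 d M, so q N is off by at most 6 q d M;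
-- averaging over the pairs divides by q - 1, and q ≤ 2 (q - 1) yields the final 12.
--
-- The hypotheses do not say that q is a power of p. This is derived from the subfield alone, since
-- both gcd (d, q) = 1 and the additivity of x ↦ x^q depend on it.

CRing : Set₁
CRing = CommutativeRing 0ℓ 0ℓ

∣_∣ᴿ : CRing → Set
∣ R ∣ᴿ = CommutativeRing.Carrier R

module Conv (R : CRing) where
  open CommutativeRing R
  open SetoidReasoning setoid
  open CommSemigroupProperties +-commutativeSemigroup using (interchange; x∙yz≈y∙xz)

  -- The Cauchy product is taken on coefficient functions, where trailing zeros of lists do not
  -- matter; `coef-⊗` then carries the ring laws over to lists.
  conv : (ℕ → Carrier) → (ℕ → Carrier) → ℕ → Carrier
  conv f g zero    = f 0 * g 0
  conv f g (suc n) = f 0 * g (suc n) + conv (λ i → f (suc i)) g n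

  conv-cong : ∀ {f f' g g'} → (∀ i → f i ≈ f' i) → (∀ i → g i ≈ g' i) → ∀ n → conv f g n ≈ conv f' g' n
  conv-cong p q zero    = *-cong (p 0) (q 0)
  conv-cong p q (suc n) = +-cong (*-cong (p 0) (q (suc n))) (conv-cong (λ i → p (suc i)) q n)

  conv-+ˡ : ∀ f f' g n → conv (λ i → f i + f' i) g n ≈ conv f g n + conv f' g n
  conv-+ˡ f f' g zero    = distribʳ _ _ _
  conv-+ˡ f f' g (suc n) = trans (+-cong (distribʳ _ _ _) (conv-+ˡ _ _ g n)) (interchange _ _ _ _)

  conv-*ˡ : ∀ a f g n → conv (λ i → a * f i) g n ≈ a * conv f g n
  conv-*ˡ a f g zero    = *-assoc _ _ _
  conv-*ˡ a f g (suc n) = trans (+-cong (*-assoc _ _ _) (conv-*ˡ a _ g n)) (sym (distribˡ _ _ _))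

  -- The recursion of `conv` removes the first value of `f`; this mirror image removes that of `g`,
  -- and the two together give commutativity.
  conv-shift : ∀ f g n → conv f g (suc n) ≈ f (suc n) * g 0 + conv f (λ i → g (suc i)) n
  conv-shift f g zero    = +-comm _ _
  conv-shift f g (suc n) = trans (+-congˡ (conv-shift (λ i → f (suc i)) g n)) (x∙yz≈y∙xz _ _ _)

  conv-comm : ∀ f g n → conv f g n ≈ conv g f n
  conv-comm f g zero    = *-comm _ _
  conv-comm f g (suc n) = trans (+-cong (*-comm _ _) (conv-comm (λ i → f (suc i)) g n)) (sym (conv-shift g f n))

  conv-assoc : ∀ f g h n → conv (conv f g) h n ≈ conv f (conv g h) n
  conv-assoc f g h zero    = *-assoc _ _ _
  conv-assoc f g h (suc n) = begin
    f 0 * g 0 * h (suc n) + conv (λ i → f 0 * g (suc i) + conv (λ i → f (suc i)) g i) h n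
      ≈⟨ +-cong (*-assoc _ _ _) (conv-+ˡ (λ i → f 0 * g (suc i)) (conv (λ i → f (suc i)) g) h n) ⟩
    f 0 * (g 0 * h (suc n)) + (conv (λ i → f 0 * g (suc i)) h n + conv (conv (λ i → f (suc i)) g) h n)
      ≈⟨ +-congˡ (+-cong (conv-*ˡ (f 0) _ h n) (conv-assoc (λ i → f (suc i)) g h n)) ⟩
    f 0 * (g 0 * h (suc n)) + (f 0 * conv (λ i → g (suc i)) h n + conv (λ i → f (suc i)) (conv g h) n)
      ≈⟨ +-assoc _ _ _ ⟨
    f 0 * (g 0 * h (suc n)) + f 0 * conv (λ i → g (suc i)) h n + conv (λ i → f (suc i)) (conv g h) n
      ≈⟨ +-congʳ (distribˡ _ _ _) ⟨
    f 0 * (g 0 * h (suc n) + conv (λ i → g (suc i)) h n) + conv (λ i → f (suc i)) (conv g h) n ∎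

  -- This stands in for reasoning about sums over i + j = n. It is used with "is zero" for degrees
  -- and with "is zero or lies in the support" for two variables.
  conv-closed : (X : Carrier → Set) → (∀ {x y} → X x → X y → X (x + y)) →
                ∀ n f g → (∀ i j → i ℕ.+ j ≡ n → X (f i * g j)) → X (conv f g n)
  conv-closed X X+ zero    f g h = h 0 0 ≡.refl
  conv-closed X X+ (suc n) f g h =
    X+ (h 0 (suc n) ≡.refl) (conv-closed X X+ n _ g (λ i j e → h (suc i) j (≡.cong suc e)))

  conv-zeroˡ : ∀ f g → (∀ i → f i ≈ 0#) → ∀ n → conv f g n ≈ 0#
  conv-zeroˡ f g z n = conv-closed (_≈ 0#) (λ p q → trans (+-cong p q) (+-identityˡ 0#)) n f g
    (λ i j _ → trans (*-congʳ (z i)) (zeroˡ _))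

  conv-top : ∀ m n f g → (∀ i → m ℕ.< i → f i ≈ 0#) → (∀ j → n ℕ.< j → g j ≈ 0#) →
             conv f g (m ℕ.+ n) ≈ f m * g n
  conv-top zero zero    f g p q = refl
  conv-top zero (suc n) f g p q =
    trans (+-congˡ (conv-zeroˡ _ g (λ i → p (suc i) (ℕ.s≤s ℕ.z≤n)) n)) (+-identityʳ _)
  conv-top (suc m) n    f g p q = trans
    (+-cong (trans (*-congˡ (q (suc (m ℕ.+ n)) (ℕ.s≤s (ℕₚ.m≤n+m n m)))) (zeroʳ _))
            (conv-top m n _ g (λ i m<i → p (suc i) (ℕ.s≤s m<i)) q))
    (+-identityˡ _)

-- The coefficient ring is arbitrary so that the construction can be iterated: polynomials in T over
-- 𝕃[x] arise by applying it twice.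
module Polynomial (R : CRing) where
  open CommutativeRing R
  open Conv R
  open RingProperties ring using (-0#≈0#)

  𝒫 : Set
  𝒫 = List Carrier

  coef : 𝒫 → ℕ → Carrier
  coef []      _       = 0#
  coef (a ∷ p) zero    = a
  coef (a ∷ p) (suc n) = coef p n

  infix 4 _≋_
  -- Lists are not kept in normal form, so the same polynomial may be written with different numbers
  -- of trailing zeros.
  record _≋_ (p q : 𝒫) : Set where
    constructor mk
    field at : ∀ n → coef p n ≈ coef q n
  open _≋_ public

  infixl 6 _⊕_
  infixl 7 _⊗_ _·_

  -- Opacity keeps sums and products rigid for unification.
  opaque
    _⊕_ : 𝒫 → 𝒫 → 𝒫
    []      ⊕ q       = q
    (a ∷ p) ⊕ []      = a ∷ p
    (a ∷ p) ⊕ (b ∷ q) = a + b ∷ p ⊕ q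

    _·_ : Carrier → 𝒫 → 𝒫
    a · []      = []
    a · (b ∷ p) = a * b ∷ a · p

    ⊖_ : 𝒫 → 𝒫
    ⊖ []      = []
    ⊖ (a ∷ p) = - a ∷ ⊖ p

    _⊗_ : 𝒫 → 𝒫 → 𝒫
    []      ⊗ q = []
    (a ∷ p) ⊗ q = a · q ⊕ (0# ∷ p ⊗ q)

    con : Carrier → 𝒫
    con a = a ∷ []

    coef-⊕ : ∀ p q n → coef (p ⊕ q) n ≈ coef p n + coef q n
    coef-⊕ []      q       n       = sym (+-identityˡ _)
    coef-⊕ (a ∷ p) []      n       = sym (+-identityʳ _)
    coef-⊕ (a ∷ p) (b ∷ q) zero    = refl
    coef-⊕ (a ∷ p) (b ∷ q) (suc n) = coef-⊕ p q n

    coef-· : ∀ a p n → coef (a · p) n ≈ a * coef p n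
    coef-· a []      n       = sym (zeroʳ _)
    coef-· a (b ∷ p) zero    = refl
    coef-· a (b ∷ p) (suc n) = coef-· a p n

    coef-⊖ : ∀ p n → coef (⊖ p) n ≈ - coef p n
    coef-⊖ []      n       = sym -0#≈0#
    coef-⊖ (b ∷ p) zero    = refl
    coef-⊖ (b ∷ p) (suc n) = coef-⊖ p n

    coef-⊗ : ∀ p q n → coef (p ⊗ q) n ≈ conv (coef p) (coef q) n
    coef-⊗ []      q n       = sym (conv-zeroˡ _ (coef q) (λ _ → refl) n)
    coef-⊗ (a ∷ p) q zero    = trans (coef-⊕ (a · q) _ 0) (trans (+-identityʳ _) (coef-· a q 0))
    coef-⊗ (a ∷ p) q (suc n) = trans (coef-⊕ (a · q) _ (suc n)) (+-cong (coef-· a q (suc n)) (coef-⊗ p q n))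

    var : 𝒫
    var = 0# ∷ 1# ∷ []

    coef-con-0 : ∀ a → coef (con a) 0 ≈ a
    coef-con-0 a = refl

    coef-con-suc : ∀ a n → coef (con a) (suc n) ≈ 0#
    coef-con-suc a n = refl

    coef-var-1 : coef var 1 ≈ 1#
    coef-var-1 = refl

    coef-var-0 : coef var 0 ≈ 0#
    coef-var-0 = refl

    coef-var-≥2 : ∀ n → coef var (2 ℕ.+ n) ≈ 0#
    coef-var-≥2 n = refl

  coef-con-⊗ : ∀ a p n → coef (con a ⊗ p) n ≈ a * coef p n
  coef-con-⊗ a p n = trans (coef-⊗ (con a) p n) (top n)
    where
    top : ∀ n → conv (coef (con a)) (coef p) n ≈ a * coef p n
    top zero    = *-congʳ (coef-con-0 a)
    top (suc n) = trans (+-cong (*-congʳ (coef-con-0 a)) (conv-zeroˡ _ (coef p) (coef-con-suc a) n)) (+-identityʳ _)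

  private
    ≋-refl : ∀ {p} → p ≋ p
    ≋-refl = mk λ _ → refl

    ≋-trans : ∀ {p q s} → p ≋ q → q ≋ s → p ≋ s
    ≋-trans u v = mk λ n → trans (at u n) (at v n)

    ⊕-cong : ∀ {p p' q q'} → p ≋ p' → q ≋ q' → p ⊕ q ≋ p' ⊕ q'
    ⊕-cong {p} {p'} {q} {q'} u v = mk λ n →
      trans (coef-⊕ p q n) (trans (+-cong (at u n) (at v n)) (sym (coef-⊕ p' q' n)))

    ⊗-cong : ∀ {p p' q q'} → p ≋ p' → q ≋ q' → p ⊗ q ≋ p' ⊗ q'
    ⊗-cong {p} {p'} {q} {q'} u v = mk λ n →
      trans (coef-⊗ p q n) (trans (conv-cong (at u) (at v) n) (sym (coef-⊗ p' q' n)))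

    ⊗-comm : ∀ p q → p ⊗ q ≋ q ⊗ p
    ⊗-comm p q = mk λ n → trans (coef-⊗ p q n) (trans (conv-comm (coef p) (coef q) n) (sym (coef-⊗ q p n)))

    ⊗-assoc : ∀ p q s → (p ⊗ q) ⊗ s ≋ p ⊗ (q ⊗ s)
    ⊗-assoc p q s = mk λ n → trans (coef-⊗ (p ⊗ q) s n) (trans
      (conv-cong (coef-⊗ p q) (λ _ → refl) n) (trans (conv-assoc (coef p) (coef q) (coef s) n) (trans
      (conv-cong (λ _ → refl) (λ i → sym (coef-⊗ q s i)) n) (sym (coef-⊗ p (q ⊗ s) n)))))

    ⊗-identityˡ : ∀ p → con 1# ⊗ p ≋ p
    ⊗-identityˡ p = mk λ n → trans (coef-con-⊗ 1# p n) (*-identityˡ _)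

    ⊗-distribʳ : ∀ s p q → (p ⊕ q) ⊗ s ≋ p ⊗ s ⊕ q ⊗ s
    ⊗-distribʳ s p q = mk λ n → trans (coef-⊗ (p ⊕ q) s n) (trans
      (conv-cong (coef-⊕ p q) (λ _ → refl) n) (trans (conv-+ˡ (coef p) (coef q) (coef s) n) (trans
      (+-cong (sym (coef-⊗ p s n)) (sym (coef-⊗ q s n))) (sym (coef-⊕ (p ⊗ s) (q ⊗ s) n)))))

    ⊕-comm : ∀ p q → p ⊕ q ≋ q ⊕ p
    ⊕-comm p q = mk λ n → trans (coef-⊕ p q n) (trans (+-comm _ _) (sym (coef-⊕ q p n)))

    ⊕-identityˡ : ∀ p → [] ⊕ p ≋ p
    ⊕-identityˡ p = mk λ n → trans (coef-⊕ [] p n) (+-identityˡ _)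

    ⊕-assoc : ∀ p q s → (p ⊕ q) ⊕ s ≋ p ⊕ (q ⊕ s)
    ⊕-assoc p q s = mk λ n → trans (coef-⊕ (p ⊕ q) s n) (trans (+-congʳ (coef-⊕ p q n)) (trans (+-assoc _ _ _)
      (trans (+-congˡ (sym (coef-⊕ q s n))) (sym (coef-⊕ p (q ⊕ s) n)))))

    ⊖-inverseˡ : ∀ p → ⊖ p ⊕ p ≋ []
    ⊖-inverseˡ p = mk λ n → trans (coef-⊕ (⊖ p) p n) (trans (+-congʳ (coef-⊖ p n)) (-‿inverseˡ _))

    ⊖-cong : ∀ {p q} → p ≋ q → ⊖ p ≋ ⊖ q
    ⊖-cong {p} {q} u = mk λ n → trans (coef-⊖ p n) (trans (-‿cong (at u n)) (sym (coef-⊖ q n)))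

  polynomialRing : CRing
  polynomialRing = record
    { Carrier = 𝒫 ; _≈_ = _≋_ ; _+_ = _⊕_ ; _*_ = _⊗_ ; -_ = ⊖_ ; 0# = [] ; 1# = con 1#
    ; isCommutativeRing = record
      { isRing = record
        { +-isAbelianGroup = record
          { isGroup = record
            { isMonoid = record
              { isSemigroup = record
                { isMagma = record
                  { isEquivalence = record { refl = ≋-refl ; sym = λ u → mk λ n → sym (at u n) ; trans = ≋-trans }
                  ; ∙-cong = ⊕-cong }
                ; assoc = ⊕-assoc }
              ; identity = ⊕-identityˡ , λ p → ≋-trans (⊕-comm p []) (⊕-identityˡ p) }
            ; inverse = ⊖-inverseˡ , λ p → ≋-trans (⊕-comm p (⊖ p)) (⊖-inverseˡ p)
            ; ⁻¹-cong = ⊖-cong }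
          ; comm = ⊕-comm }
        ; *-cong = ⊗-cong
        ; *-assoc = ⊗-assoc
        ; *-identity = ⊗-identityˡ , λ p → ≋-trans (⊗-comm p _) (⊗-identityˡ p)
        ; distrib = (λ s p q → ≋-trans (⊗-comm s (p ⊕ q)) (≋-trans (⊗-distribʳ s p q)
                      (⊕-cong (⊗-comm p s) (⊗-comm q s)))) , ⊗-distribʳ
        }
      ; *-comm = ⊗-comm } }

-- Ring homomorphisms and evaluation

record Hom (R S : CRing) : Set where
  private
    module R = CommutativeRing R
    module S = CommutativeRing S
  field
    ⟦_⟧    : R.Carrier → S.Carrier
    ⟦⟧-cong : ∀ {x y} → x R.≈ y → ⟦ x ⟧ S.≈ ⟦ y ⟧
    +-homo : ∀ x y → ⟦ x R.+ y ⟧ S.≈ ⟦ x ⟧ S.+ ⟦ y ⟧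
    *-homo : ∀ x y → ⟦ x R.* y ⟧ S.≈ ⟦ x ⟧ S.* ⟦ y ⟧
    0-homo : ⟦ R.0# ⟧ S.≈ S.0#
    1-homo : ⟦ R.1# ⟧ S.≈ S.1#

  -‿homo : ∀ x → ⟦ R.- x ⟧ S.≈ S.- ⟦ x ⟧
  -‿homo x = S.trans (S.sym (S.+-identityʳ _)) (S.trans (S.+-congˡ (S.sym (S.-‿inverseʳ ⟦ x ⟧)))
    (S.trans (S.sym (S.+-assoc _ _ _)) (S.trans (S.+-congʳ (S.trans (S.sym (+-homo _ _))
    (S.trans (⟦⟧-cong (R.-‿inverseˡ x)) 0-homo))) (S.+-identityˡ _))))

Pow : (R : CRing) → ∣ R ∣ᴿ → ℕ → ∣ R ∣ᴿ
Pow R = Exp._^_ (CommutativeRing.semiring R)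

Sum : (R : CRing) → ∀ {n} → (Fin n → ∣ R ∣ᴿ) → ∣ R ∣ᴿ
Sum R = SRSum.sum (CommutativeRing.semiring R)

module HomProperties {R S : CRing} (φ : Hom R S) where
  private
    module R = CommutativeRing R
    module S = CommutativeRing S
  open Hom φ

  ^-homo : ∀ x n → ⟦ Pow R x n ⟧ S.≈ Pow S ⟦ x ⟧ n
  ^-homo x zero    = 1-homo
  ^-homo x (suc n) = S.trans (*-homo _ _) (S.*-congˡ (^-homo x n))

  sum-homo : ∀ {n} (h : Fin n → R.Carrier) → ⟦ Sum R h ⟧ S.≈ Sum S (λ i → ⟦ h i ⟧)
  sum-homo {zero}  h = 0-homo
  sum-homo {suc n} h = S.trans (+-homo _ _) (S.+-congˡ (sum-homo (λ i → h (Fin.suc i))))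

module _ (R : CRing) where
  open CommutativeRing R
  open Polynomial R
  private opaque
    unfolding _⊕_

    con-cong : ∀ {a b} → a ≈ b → con a ≋ con b
    con-cong u = mk λ { zero → u ; (suc n) → refl }

    con-+ : ∀ a b → con (a + b) ≋ con a ⊕ con b
    con-+ a b = mk λ _ → refl

    con-* : ∀ a b → con (a * b) ≋ con a ⊗ con b
    con-* a b = mk λ { zero → sym (+-identityʳ _) ; (suc n) → refl }

    con-0 : con 0# ≋ []
    con-0 = mk λ { zero → refl ; (suc n) → refl }

  conHom : Hom R polynomialRing
  conHom = record
    { ⟦_⟧ = con ; ⟦⟧-cong = con-cong ; +-homo = con-+ ; *-homo = con-* ; 0-homo = con-0 ; 1-homo = mk λ _ → refl }

-- Coefficients travel along a homomorphism, so one construction covers the value at a point, the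
-- substitution of X + T for X, and the simultaneous specialisation of X and T.
module Eval {R S : CRing} (φ : Hom R S) (s : ∣ S ∣ᴿ) where
  private
    module R = CommutativeRing R
    module S = CommutativeRing S
  open S
  open Hom φ
  open Polynomial R using (𝒫; coef; at; _⊕_; _⊗_; _·_; con; var; polynomialRing)
  open CommSemigroupProperties S.+-commutativeSemigroup using (interchange)
  open CommSemigroupProperties S.*-commutativeSemigroup using (x∙yz≈y∙xz)

  ev : 𝒫 → Carrier
  ev []      = 0#
  ev (a ∷ p) = ⟦ a ⟧ + s * ev p

  private
    ev-zero : ∀ p → (∀ n → coef p n R.≈ R.0#) → ev p ≈ 0#
    ev-zero []      z = refl
    ev-zero (a ∷ p) z = trans
      (+-cong (trans (⟦⟧-cong (z 0)) 0-homo) (trans (*-congˡ (ev-zero p (λ n → z (suc n)))) (zeroʳ s)))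
      (+-identityˡ 0#)

    ev-cong : ∀ p q → (∀ n → coef p n R.≈ coef q n) → ev p ≈ ev q
    ev-cong []      q       u = sym (ev-zero q (λ n → R.sym (u n)))
    ev-cong (a ∷ p) []      u = ev-zero (a ∷ p) u
    ev-cong (a ∷ p) (b ∷ q) u = +-cong (⟦⟧-cong (u 0)) (*-congˡ (ev-cong p q (λ n → u (suc n))))

  private opaque
    unfolding _⊕_

    ev-⊕ : ∀ p q → ev (p ⊕ q) ≈ ev p + ev q
    ev-⊕ []      q       = sym (+-identityˡ _)
    ev-⊕ (a ∷ p) []      = sym (+-identityʳ _)
    ev-⊕ (a ∷ p) (b ∷ q) = trans
      (+-cong (+-homo a b) (trans (*-congˡ (ev-⊕ p q)) (distribˡ s _ _))) (interchange _ _ _ _)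

    ev-· : ∀ a p → ev (a · p) ≈ ⟦ a ⟧ * ev p
    ev-· a []      = sym (zeroʳ _)
    ev-· a (b ∷ p) = trans (+-cong (*-homo a b) (trans (*-congˡ (ev-· a p)) (x∙yz≈y∙xz _ _ _)))
      (sym (distribˡ _ _ _))

    ev-⊗ : ∀ p q → ev (p ⊗ q) ≈ ev p * ev q
    ev-⊗ []      q = sym (zeroˡ _)
    ev-⊗ (a ∷ p) q = trans (ev-⊕ (a · q) _) (trans
      (+-cong (ev-· a q) (trans (+-cong 0-homo (trans (*-congˡ (ev-⊗ p q)) (sym (*-assoc _ _ _)))) (+-identityˡ _)))
      (sym (distribʳ _ _ _)))

  opaque
    unfolding _⊕_

    ev-con : ∀ a → ev (con a) ≈ ⟦ a ⟧
    ev-con a = trans (+-congˡ (zeroʳ s)) (+-identityʳ _)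

    ev-var : ev var ≈ s
    ev-var = trans (+-cong 0-homo (trans (*-congˡ (trans (ev-con R.1#) 1-homo)) (*-identityʳ s))) (+-identityˡ s)

  evHom : Hom polynomialRing S
  evHom = record
    { ⟦_⟧ = ev ; ⟦⟧-cong = λ {p} {q} u → ev-cong p q (at u) ; +-homo = ev-⊕ ; *-homo = ev-⊗
    ; 0-homo = refl ; 1-homo = trans (ev-con R.1#) 1-homo }

  -- With s = x - x₀ this turns the vanishing of the first M coefficients in T into a zero of
  -- multiplicity M at x₀.
  ev-drop : ∀ M p → (∀ m → m ℕ.< M → coef p m R.≈ R.0#) → ∃ λ y → ev p ≈ Pow S s M * y
  ev-drop zero    p       z = ev p , sym (*-identityˡ _)
  ev-drop (suc M) []      z = 0# , sym (zeroʳ _)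
  ev-drop (suc M) (a ∷ p) z with ev-drop M p (λ m m<M → z (suc m) (ℕ.s≤s m<M))
  ... | y , e = y , trans
    (+-cong (trans (⟦⟧-cong (z 0 (ℕ.s≤s ℕ.z≤n))) 0-homo) (trans (*-congˡ e) (sym (*-assoc _ _ _)))) (+-identityˡ _)

idHom : (R : CRing) → Hom R R
idHom R = record { ⟦_⟧ = λ x → x ; ⟦⟧-cong = λ u → u ; +-homo = λ _ _ → refl ; *-homo = λ _ _ → refl
                 ; 0-homo = refl ; 1-homo = refl }
  where open CommutativeRing R

infixr 9 _∘ᴴ_
_∘ᴴ_ : ∀ {R S T} → Hom S T → Hom R S → Hom R T
_∘ᴴ_ {T = T} ψ φ = record
  { ⟦_⟧ = λ x → ψ.⟦ φ.⟦ x ⟧ ⟧ ; ⟦⟧-cong = λ u → ψ.⟦⟧-cong (φ.⟦⟧-cong u)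
  ; +-homo = λ x y → trans (ψ.⟦⟧-cong (φ.+-homo x y)) (ψ.+-homo _ _)
  ; *-homo = λ x y → trans (ψ.⟦⟧-cong (φ.*-homo x y)) (ψ.*-homo _ _)
  ; 0-homo = trans (ψ.⟦⟧-cong φ.0-homo) ψ.0-homo
  ; 1-homo = trans (ψ.⟦⟧-cong φ.1-homo) ψ.1-homo }
  where
  module ψ = Hom ψ
  module φ = Hom φ
  open CommutativeRing T

open ≡ using (refl; sym; trans)

-- Polynomials over a finite field

fieldRing : FiniteField → CRing
fieldRing F = record { isCommutativeRing = FiniteField.isCommutativeRing F }

module FieldPolynomials (F : FiniteField) where
  open FiniteField F using (_≟_; _⁻¹; 0≢1; inverseʳ)
  𝕃 : CRing
  𝕃 = fieldRing F
  open CommutativeRing 𝕃 using (Carrier; _+_; _*_; -_; 0#; 1#; +-identityˡ; +-identityʳ; *-identityˡ;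
    *-identityʳ; zeroˡ; zeroʳ; *-assoc; +-assoc; -‿inverseˡ; -‿inverseʳ; ring)
  open Polynomial 𝕃
  open Conv 𝕃
  𝕃[x] : CRing
  𝕃[x] = polynomialRing
  module Px = CommutativeRing 𝕃[x]

  *-cancelʳ-nonzero : ∀ {a x y} → a ≢ 0# → x * a ≡ y * a → x ≡ y
  *-cancelʳ-nonzero {a} {x} {y} a≢0 e = trans (sym (undo x)) (trans (cong (_* (a ⁻¹)) e) (undo y))
    where
    undo : ∀ z → z * a * (a ⁻¹) ≡ z
    undo z = trans (*-assoc _ _ _) (trans (cong (z *_) (inverseʳ a a≢0)) (*-identityʳ z))

  *-nonzero : ∀ {x y} → x ≢ 0# → y ≢ 0# → x * y ≢ 0#
  *-nonzero {x} {y} x≢0 y≢0 e = x≢0 (*-cancelʳ-nonzero y≢0 (trans e (sym (zeroˡ y))))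

  -- The degree is a relation: the length of a list only bounds it, and the zero polynomial has
  -- none.
  record Exact (p : 𝒫) (n : ℕ) : Set where
    constructor exact
    field
      above : ∀ i → n ℕ.< i → coef p i ≡ 0#
      lead  : coef p n ≢ 0#
  open Exact public

  exact-unique : ∀ {p m n} → Exact p m → Exact p n → m ≡ n
  exact-unique {p} {m} {n} u v with ℕₚ.<-cmp m n
  ... | tri< m<n _ _ = contradiction (above u n m<n) (lead v)
  ... | tri≈ _ e _   = e
  ... | tri> _ _ n<m = contradiction (above v m n<m) (lead u)

  exact-cong : ∀ {p q n} → p ≋ q → Exact p n → Exact q n
  exact-cong e u = exact (λ i n<i → trans (sym (at e i)) (above u i n<i)) (λ z → lead u (trans (at e _) z))

  exact-⊗ : ∀ {p q m n} → Exact p m → Exact q n → Exact (p ⊗ q) (m ℕ.+ n)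
  exact-⊗ {p} {q} {m} {n} u v = exact
    (λ i m+n<i → trans (coef-⊗ p q i) (conv-closed (_≡ 0#) (λ a b → trans (cong₂ _+_ a b) (+-identityˡ 0#)) i _ _
      (λ j k e → vanish j k (ℕₚ.<-≤-trans m+n<i (ℕₚ.≤-reflexive (sym e))))))
    (λ z → *-nonzero (lead u) (lead v) (trans (sym (conv-top m n _ _ (above u) (above v))) (trans (sym (coef-⊗ p q _)) z)))
    where
    vanish : ∀ j k → m ℕ.+ n ℕ.< j ℕ.+ k → coef p j * coef q k ≡ 0#
    vanish j k lt with j ℕ.≤? m
    ... | no j≰m = trans (cong (_* coef q k) (above u j (ℕₚ.≰⇒> j≰m))) (zeroˡ _)
    ... | yes j≤m with k ℕ.≤? n
    ...   | no k≰n = trans (cong (coef p j *_) (above v k (ℕₚ.≰⇒> k≰n))) (zeroʳ _)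
    ...   | yes k≤n = contradiction lt (ℕₚ.≤⇒≯ (ℕₚ.+-mono-≤ j≤m k≤n))

  exact-con : ∀ {a} → a ≢ 0# → Exact (con a) 0
  exact-con {a} a≢0 = exact (λ { zero () ; (suc i) _ → coef-con-suc a i }) (λ e → a≢0 (trans (sym (coef-con-0 a)) e))

  exact-1 : Exact (con 1#) 0
  exact-1 = exact-con (λ e → 0≢1 (sym e))

  exact-var : Exact var 1
  exact-var = exact (λ { zero () ; (suc zero) (ℕ.s≤s ()) ; (suc (suc i)) _ → coef-var-≥2 i })
    (λ e → 0≢1 (trans (sym e) coef-var-1))

  exact-^ : ∀ {p m} n → Exact p m → Exact (Pow 𝕃[x] p n) (n ℕ.* m)
  exact-^ zero    u = exact-1
  exact-^ (suc n) u = exact-⊗ u (exact-^ n u)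

  exact-⊕ : ∀ {p q n} → Exact p n → (∀ i → n ℕ.≤ i → coef q i ≡ 0#) → Exact (p ⊕ q) n
  exact-⊕ {p} {q} {n} u z = exact
    (λ i n<i → trans (coef-⊕ p q i) (trans (cong₂ _+_ (above u i n<i) (z i (ℕₚ.<⇒≤ n<i))) (+-identityˡ 0#)))
    (λ e → lead u (trans (sym (+-identityʳ _)) (trans (sym (cong (coef p n +_) (z n ℕₚ.≤-refl)))
      (trans (sym (coef-⊕ p q n)) e))))

  exact-⊕-< : ∀ {p q m n} → Exact p n → Exact q m → m ℕ.< n → Exact (p ⊕ q) n
  exact-⊕-< u v m<n = exact-⊕ u (λ i n≤i → above v i (ℕₚ.<-≤-trans m<n n≤i))

  zero? : ∀ p → p ≋ [] ⊎ ∃ (Exact p)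
  zero? [] = inj₁ Px.refl
  zero? (a ∷ p) with zero? p
  ... | inj₂ (n , u) = inj₂ (suc n , exact (λ { (suc i) (ℕ.s≤s l) → above u i l }) (lead u))
  ... | inj₁ z with a ≟ 0#
  ...   | yes a≡0 = inj₁ (mk λ { zero → a≡0 ; (suc n) → at z n })
  ...   | no  a≢0 = inj₂ (0 , exact (λ { (suc i) _ → at z i }) a≢0)

  exact≢0 : ∀ {p n} → Exact p n → ¬ (p ≋ [])
  exact≢0 u z = lead u (at z _)

  -- Degrees add over a field, so if q - q' had a degree, p (q - q') would have one too and could
  -- not be zero.
  ⊗-cancelˡ : ∀ {p q q' n} → Exact p n → p ⊗ q ≋ p ⊗ q' → q ≋ q'
  ⊗-cancelˡ {p} {q} {q'} u e with zero? (q ⊕ ⊖ q')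
  ... | inj₂ (m , v) = contradiction
    (Px.trans (Px.distribˡ p q (⊖ q')) (Px.trans (Px.+-congʳ e) (Px.trans (Px.sym (Px.distribˡ p q' (⊖ q')))
      (Px.trans (Px.*-congˡ (Px.-‿inverseʳ q')) (Px.zeroʳ p)))))
    (exact≢0 (exact-⊗ u v))
  ... | inj₁ z = Px.trans (Px.sym (Px.trans (Px.+-assoc q (⊖ q') q') (Px.trans (Px.+-congˡ (Px.-‿inverseˡ q')) (Px.+-identityʳ q))))
                   (Px.trans (Px.+-congʳ z) (Px.+-identityˡ q'))

  -- Terms of different degrees cannot cancel: the largest degree with a nonzero coefficient
  -- survives. This makes the auxiliary polynomial nonzero and locates its degree among those of the
  -- monomials.
  exact-combination : ∀ {n} (c : Fin n → Carrier) (e : Fin n → 𝒫) (δ : Fin n → ℕ) → (∀ j → Exact (e j) (δ j)) →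
    (∀ {j k} → δ j ≡ δ k → j ≡ k) →
    ((∀ j → c j ≡ 0#) × Sum 𝕃[x] (λ j → con (c j) ⊗ e j) ≋ []) ⊎
    ∃ λ j → Exact (Sum 𝕃[x] (λ j → con (c j) ⊗ e j)) (δ j)
  exact-combination {zero} c e δ ex inj = inj₁ ((λ ()) , Px.refl)
  exact-combination {suc n} c e δ ex inj
    with c Fin.zero ≟ 0# | exact-combination (λ j → c (Fin.suc j)) (λ j → e (Fin.suc j)) (λ j → δ (Fin.suc j))
                             (λ j → ex (Fin.suc j)) (λ eq → Finₚ.suc-injective (inj eq))
  ... | yes z | inj₁ (zs , s) = inj₁ ((λ { Fin.zero → z ; (Fin.suc j) → zs j }) ,
      Px.trans (Px.+-cong (Px.trans (Px.*-congʳ (Hom.⟦⟧-cong (conHom 𝕃) z)) (Px.trans (Px.*-congʳ (Hom.0-homo (conHom 𝕃))) (Px.zeroˡ _))) s) (Px.+-identityˡ _))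
  ... | yes z | inj₂ (j , u) = inj₂ (Fin.suc j , exact-cong (Px.sym (Px.trans
      (Px.+-congʳ (Px.trans (Px.*-congʳ (Hom.⟦⟧-cong (conHom 𝕃) z)) (Px.trans (Px.*-congʳ (Hom.0-homo (conHom 𝕃))) (Px.zeroˡ _)))) (Px.+-identityˡ _))) u)
  ... | no nz | inj₁ (zs , s) = inj₂ (Fin.zero , exact-cong (Px.sym (Px.trans (Px.+-congˡ s) (Px.+-identityʳ _)))
      (exact-⊗ (exact-con nz) (ex Fin.zero)))
  ... | no nz | inj₂ (j , u) with ℕₚ.<-cmp (δ Fin.zero) (δ (Fin.suc j))
  ...   | tri< l _ _ = inj₂ (Fin.suc j , exact-cong (Px.+-comm _ _) (exact-⊕-< u (exact-⊗ (exact-con nz) (ex Fin.zero)) l))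
  ...   | tri> _ _ l = inj₂ (Fin.zero , exact-⊕-< (exact-⊗ (exact-con nz) (ex Fin.zero)) u l)
  ...   | tri≈ _ eq _ with inj eq
  ...     | ()

  lin : Carrier → 𝒫
  lin a = var ⊕ con (- a)

  exact-lin : ∀ a → Exact (lin a) 1
  exact-lin a = exact-⊕ exact-var (λ { (suc i) _ → coef-con-suc (- a) i })

  evalHom : Carrier → Hom 𝕃[x] 𝕃
  evalHom = Eval.evHom (idHom 𝕃)

  eval₁ : 𝒫 → Carrier → Carrier
  eval₁ p a = Hom.⟦_⟧ (evalHom a) p

  eval-lin : ∀ a b → eval₁ (lin a) b ≡ b + - a
  eval-lin a b = trans (Hom.+-homo (evalHom b) var (con (- a)))
    (cong₂ _+_ (Eval.ev-var (idHom 𝕃) b) (Eval.ev-con (idHom 𝕃) b (- a)))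

  ∷-split : ∀ a p → a ∷ p ≋ con a ⊕ var ⊗ p
  ∷-split a p = mk λ
    { zero → sym (trans (coef-⊕ (con a) (var ⊗ p) 0) (trans (cong₂ _+_ (coef-con-0 a)
        (trans (coef-⊗ var p 0) (trans (cong (_* coef p 0) coef-var-0) (zeroˡ _)))) (+-identityʳ a)))
    ; (suc n) → sym (trans (coef-⊕ (con a) (var ⊗ p) (suc n)) (trans (cong (_+ _) (coef-con-suc a n)) (trans (+-identityˡ _)
        (trans (coef-⊗ var p (suc n)) (trans (cong₂ _+_ (trans (cong (_* coef p (suc n)) coef-var-0) (zeroˡ _))
        (trans (conv-cong shifted (λ _ → refl) n) (trans (sym (coef-⊗ (con 1#) p n)) (at (Px.*-identityˡ p) n)))) (+-identityˡ _)))))) }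
    where
    shifted : ∀ i → coef var (suc i) ≡ coef (con 1#) i
    shifted zero    = trans coef-var-1 (sym (coef-con-0 1#))
    shifted (suc i) = trans (coef-var-≥2 i) (sym (coef-con-suc 1# i))

  var≋lin : ∀ a → var ≋ lin a ⊕ con a
  var≋lin a = Px.sym (Px.trans (Px.+-assoc var (con (- a)) (con a)) (Px.trans
    (Px.+-congˡ (Px.trans (Px.sym (Hom.+-homo (conHom 𝕃) (- a) a)) (Px.trans (Hom.⟦⟧-cong (conHom 𝕃) (-‿inverseˡ a)) (Hom.0-homo (conHom 𝕃)))))
    (Px.+-identityʳ var)))

  -- If p = (X - a) h + v, then writing X = (X - a) + a in front of v turns b + X p into a quotient
  -- X h + v and a remainder b + a v.
  synthetic-division : ∀ p a → ∃ λ h → p ≋ lin a ⊗ h ⊕ con (eval₁ p a)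
  synthetic-division [] a = [] , Px.sym (Px.trans (Px.+-congʳ (Px.zeroʳ (lin a))) (Px.trans (Px.+-identityˡ _) (Hom.0-homo (conHom 𝕃))))
  synthetic-division (b ∷ p) a with synthetic-division p a
  ... | h , e = var ⊗ h ⊕ con v , Px.trans (∷-split b p) (Px.trans (Px.+-congˡ (Px.*-congˡ e))
      (Px.trans (step₁ 𝕃[x] (con b) var (lin a) h (con v)) (Px.trans (Px.+-congˡ (Px.+-congˡ (Px.*-congʳ (var≋lin a))))
      (Px.trans (step₂ 𝕃[x] (con b) (lin a) (var ⊗ h) (con v) (con a))
      (Px.+-congˡ (Px.trans (Px.+-congˡ (Px.sym (Hom.*-homo (conHom 𝕃) a v))) (Px.sym (Hom.+-homo (conHom 𝕃) b (a * v)))))))))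
    where
    v = eval₁ p a
    module _ (R : CRing) where
      open CommutativeRing R using (_≈_) renaming (_+_ to _+ᴿ_; _*_ to _*ᴿ_; refl to reflᴿ)
      open NatSolver (CommutativeRing.commutativeSemiring R) using (solve; _:+_; _:*_; _:=_)
      step₁ : ∀ b X l h v → (b +ᴿ X *ᴿ (l *ᴿ h +ᴿ v)) ≈ (l *ᴿ (X *ᴿ h) +ᴿ (b +ᴿ X *ᴿ v))
      step₁ = solve 5 (λ b X l h v → (b :+ X :* (l :* h :+ v)) := (l :* (X :* h) :+ (b :+ X :* v))) reflᴿ
      step₂ : ∀ b l k v c → (l *ᴿ k +ᴿ (b +ᴿ (l +ᴿ c) *ᴿ v)) ≈ (l *ᴿ (k +ᴿ v) +ᴿ (b +ᴿ c *ᴿ v))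
      step₂ = solve 5 (λ b l k v c → (l :* k :+ (b :+ (l :+ c) :* v)) := (l :* (k :+ v) :+ (b :+ c :* v))) reflᴿ

  factor : ∀ {p a} → eval₁ p a ≡ 0# → ∃ λ h → p ≋ lin a ⊗ h
  factor {p} {a} e with synthetic-division p a
  ... | h , s = h , Px.trans s (Px.trans (Px.+-congˡ (Px.trans (Hom.⟦⟧-cong (conHom 𝕃) e) (Hom.0-homo (conHom 𝕃)))) (Px.+-identityʳ _))

  _Divides_ : 𝒫 → 𝒫 → Set
  p Divides q = ∃ λ h → q ≋ p ⊗ h

  x-a≢0 : ∀ {a b} → a ≢ b → a + - b ≢ 0#
  x-a≢0 {a} {b} a≢b e = a≢b (trans (sym (+-identityʳ a)) (trans (cong (a +_) (sym (-‿inverseˡ b)))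
    (trans (sym (+-assoc a _ b)) (trans (cong (_+ b) e) (+-identityˡ b)))))

  -- As b is a zero of (x - a) h but not of x - a, it is a zero of h; one factor x - b is cancelled
  -- and the induction continues.
  lin-coprime : ∀ {a b} → a ≢ b → ∀ M h → Pow 𝕃[x] (lin b) M Divides (lin a ⊗ h) → Pow 𝕃[x] (lin b) M Divides h
  lin-coprime a≢b zero h _ = h , Px.sym (Px.*-identityˡ h)
  lin-coprime {a} {b} a≢b (suc M) h (g , e) with factor {h} {b} root
    where
    B = evalHom b
    vanish : eval₁ (lin a ⊗ h) b ≡ 0#
    vanish = trans (Hom.⟦⟧-cong B e) (trans (Hom.⟦⟧-cong B (Px.*-assoc (lin b) _ g)) (trans (Hom.*-homo B (lin b) _)
      (trans (cong (_* Hom.⟦_⟧ B (Pow 𝕃[x] (lin b) M ⊗ g)) (trans (eval-lin b b) (-‿inverseʳ b))) (zeroˡ _))))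
    root : eval₁ h b ≡ 0#
    root with eval₁ h b ≟ 0#
    ... | yes z = z
    ... | no nz = contradiction (trans (sym (Hom.*-homo B (lin a) h)) vanish)
        (*-nonzero (λ z → x-a≢0 (λ b≡a → a≢b (sym b≡a)) (trans (sym (eval-lin a b)) z)) nz)
  ... | h' , e' with lin-coprime a≢b M h' (g , ⊗-cancelˡ (exact-lin b)
        (Px.trans (x∙yz≈y∙xz (lin b) (lin a) h')
        (Px.trans (Px.*-congˡ (Px.sym e')) (Px.trans e (Px.*-assoc (lin b) _ g)))))
    where open CommSemigroupProperties Px.*-commutativeSemigroup using (x∙yz≈y∙xz)
  ...   | k , e'' = k , Px.trans e' (Px.trans (Px.*-congˡ e'') (Px.sym (Px.*-assoc (lin b) _ k)))

  lin^-coprime : ∀ {a b} → a ≢ b → ∀ N M h → Pow 𝕃[x] (lin b) M Divides (Pow 𝕃[x] (lin a) N ⊗ h) → Pow 𝕃[x] (lin b) M Divides h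
  lin^-coprime a≢b zero M h (g , e) = g , Px.trans (Px.sym (Px.*-identityˡ h)) e
  lin^-coprime {a} a≢b (suc N) M h (g , e) =
    lin^-coprime a≢b N M h (lin-coprime a≢b M _ (g , Px.trans (Px.sym (Px.*-assoc (lin a) _ h)) e))

  -- Dividing out (x - a)^M lowers the degree by M, and by coprimality the powers belonging to the
  -- other zeros still divide the quotient.
  count-zeros : ∀ M {p n} → Exact p n → ∀ xs → Unique xs → All (λ a → Pow 𝕃[x] (lin a) M Divides p) xs →
                M ℕ.* length xs ℕ.≤ n
  count-zeros M {n = n} u [] _ _ = ℕₚ.≤-trans (ℕₚ.≤-reflexive (ℕₚ.*-zeroʳ M)) ℕ.z≤n
  count-zeros M {p} {n} u (a ∷ xs) (d ∷ ds) ((h , e) ∷ hs) with zero? h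
  ... | inj₁ z = contradiction (Px.trans e (Px.trans (Px.*-congˡ z) (Px.zeroʳ _))) (exact≢0 u)
  ... | inj₂ (m , v) = ℕₚ.≤-trans (ℕₚ.≤-reflexive (ℕₚ.*-suc M (length xs)))
      (ℕₚ.≤-trans (ℕₚ.+-monoʳ-≤ M (count-zeros M v xs ds (All.zipWith (λ { (a≢b , (g , e')) →
          lin^-coprime a≢b M M h (g , Px.trans (Px.sym e) e') }) (d , hs))))
        (ℕₚ.≤-reflexive (trans (cong (ℕ._+ m) (sym (ℕₚ.*-identityʳ M)))
          (exact-unique (exact-⊗ (exact-^ M (exact-lin a)) v) (exact-cong e u)))))

  -- Gaussian elimination, one column at a time.
  nontrivial-solution : ∀ {m n} → m ℕ.< n → (A : Fin m → Fin n → Carrier) →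
    ∃ λ (c : Fin n → Carrier) → (∃ λ j → c j ≢ 0#) × (∀ i → Sum 𝕃 (λ j → c j * A i j) ≡ 0#)
  nontrivial-solution {m} {suc n} m<n A with Finₚ.any? (λ i → Relation.Nullary.¬? (A i Fin.zero ≟ 0#))
  ... | no none = (λ { Fin.zero → 1# ; (Fin.suc j) → 0# }) , (Fin.zero , λ e → 0≢1 (sym e)) , λ i →
      trans (cong₂ _+_ (trans (*-identityˡ _) (dec-zero i)) (trans (SRSum.sum-cong-≋ (CommutativeRing.semiring 𝕃) (λ j → zeroˡ (A i (Fin.suc j)))) (SRSum.sum-replicate-zero (CommutativeRing.semiring 𝕃) n))) (+-identityˡ 0#)
    where
    dec-zero : ∀ i → A i Fin.zero ≡ 0#
    dec-zero i with A i Fin.zero ≟ 0#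
    ... | yes z = z
    ... | no nz = contradiction (i , nz) none
  nontrivial-solution {suc m} {suc n} (ℕ.s≤s m<n) A | yes (k , nz) =
    c , (Fin.suc (proj₁ (proj₁ (proj₂ sol))) , proj₂ (proj₁ (proj₂ sol))) , solves
    where
    w = - (A k Fin.zero ⁻¹)
    A' : Fin m → Fin n → Carrier
    A' i j = A (Fin.punchIn k i) (Fin.suc j) + (A (Fin.punchIn k i) Fin.zero * w) * A k (Fin.suc j)
    sol = nontrivial-solution m<n A'
    c' = proj₁ sol
    t = Sum 𝕃 (λ j → c' j * A k (Fin.suc j))
    c : Fin (suc n) → Carrier
    c Fin.zero    = w * t
    c (Fin.suc j) = c' j
    open NatSolver (CommutativeRing.commutativeSemiring 𝕃) using (solve; _:+_; _:*_; _:=_)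
    pivot : w * t * A k Fin.zero + t ≡ 0#
    pivot = trans (solve 3 (λ w t a → (w :* t :* a :+ t) := ((a :* w) :* t :+ t)) refl w t (A k Fin.zero))
      (trans (cong (λ z → z * t + t) (trans (sym (RingProperties.-‿distribʳ-* ring _ _)) (cong -_ (inverseʳ _ nz))))
      (trans (cong (_+ t) (trans (sym (RingProperties.-‿distribˡ-* ring 1# t)) (cong -_ (*-identityˡ t)))) (-‿inverseˡ t)))
    solves : ∀ i → Sum 𝕃 (λ j → c j * A i j) ≡ 0#
    solves i with k Finₚ.≟ i
    ... | yes refl = pivot
    ... | no k≢i = subst (λ z → Sum 𝕃 (λ j → c j * A z j) ≡ 0#) (Finₚ.punchIn-punchOut k≢i) (row (Fin.punchOut k≢i))
      where
      row : ∀ i → Sum 𝕃 (λ j → c j * A (Fin.punchIn k i) j) ≡ 0#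
      row i = trans (trans (solve 4 (λ w t a s → (w :* t :* a :+ s) := (s :+ (a :* w) :* t)) refl w t a s)
          (trans (cong (s +_) (SRSum.*-distribˡ-sum (CommutativeRing.semiring 𝕃) (a * w) (λ j → c' j * A k (Fin.suc j))))
          (trans (sym (CMSum.∑-distrib-+ (CommutativeRing.+-commutativeMonoid 𝕃) {n} _ _))
          (SRSum.sum-cong-≋ (CommutativeRing.semiring 𝕃) (λ j →
            solve 4 (λ c x y z → (c :* x :+ y :* (c :* z)) := (c :* (x :+ y :* z))) refl (c' j) _ _ _)))))
        (proj₂ (proj₂ sol) i)
        where
        a = A (Fin.punchIn k i) Fin.zero
        s = Sum 𝕃 (λ j → c' j * A (Fin.punchIn k i) (Fin.suc j))

-- Frobenius and subfields

unique-↭ : {A : Set} {xs ys : List A} → Unique xs → Unique ys →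
           (∀ {x} → x ∈ xs → x ∈ ys) → (∀ {x} → x ∈ ys → x ∈ xs) → xs ↭ ys
unique-↭ u v f g = ∼bag⇒↭ (unique∧set⇒bag u v (mk⇔ f g))

remove-↭ : {A : Set} (_≟_ : ∀ (x y : A) → Dec (x ≡ y)) {xs : List A} {c : A} → Unique xs → c ∈ xs →
  xs ↭ c ∷ filter (λ x → ¬? (x ≟ c)) xs
remove-↭ _≟_ {xs} {c} u c∈ = unique-↭ u
  (All.tabulate (λ m e → proj₂ (∈ₚ.∈-filter⁻ (λ x → ¬? (x ≟ c)) {xs = xs} m) (sym e)) ∷ Uniqueₚ.filter⁺ _ u) to from
  where
  to : ∀ {x} → x ∈ xs → x ∈ c ∷ filter (λ x → ¬? (x ≟ c)) xs
  to {x} m with x ≟ c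
  ... | yes e = here e
  ... | no ne = there (∈ₚ.∈-filter⁺ (λ x → ¬? (x ≟ c)) m ne)
  from : ∀ {x} → x ∈ c ∷ filter (λ x → ¬? (x ≟ c)) xs → x ∈ xs
  from (here refl) = c∈
  from (there m)   = proj₁ (∈ₚ.∈-filter⁻ (λ x → ¬? (x ≟ c)) m)

prime∤! : ∀ {p} → Prime p → ∀ n → n ℕ.< p → ¬ (p ∣ n !)
prime∤! {p} pp zero    n<p d = ℕₚ.<⇒≢ (ℕ.nonTrivial⇒n>1 p {{prime⇒nonTrivial pp}}) (sym (∣.∣1⇒≡1 d))
prime∤! {p} pp (suc n) n<p d with euclidsLemma (suc n) (n !) pp d
... | inj₁ e = ℕₚ.≤⇒≯ (∣.∣⇒≤ e) n<p
... | inj₂ e = prime∤! pp n (ℕₚ.<-trans (ℕₚ.n<1+n n) n<p) e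

prime∣binomial : ∀ {p} → Prime p → ∀ k → 0 ℕ.< k → k ℕ.< p → p ∣ (p C k)
prime∣binomial {p} pp k 0<k k<p with euclidsLemma (p C k) (k ! ℕ.* (p ℕ.∸ k) !) pp
  (subst (p ∣_) (sym C*d≡p!) (p∣p! p (ℕₚ.<-trans 0<k k<p)))
  where
  C*d≡p! : (p C k) ℕ.* (k ! ℕ.* (p ℕ.∸ k) !) ≡ p !
  C*d≡p! = trans (cong (ℕ._* (k ! ℕ.* (p ℕ.∸ k) !)) (nCk≡n!/k![n-k]! (ℕₚ.<⇒≤ k<p)))
    (DM.m/n*n≡m {{k ℕₚ.!* (p ℕ.∸ k) !≢0}} (k![n∸k]!∣n! (ℕₚ.<⇒≤ k<p)))
  p∣p! : ∀ p → 0 ℕ.< p → p ∣ p !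
  p∣p! (suc p) _ = ∣.m∣m*n (p !)
... | inj₁ d = d
... | inj₂ d with euclidsLemma (k !) ((p ℕ.∸ k) !) pp d
... | inj₁ d' = contradiction d' (prime∤! pp k k<p)
... | inj₂ d' = contradiction d' (prime∤! pp (p ℕ.∸ k) (ℕₚ.∸-monoʳ-< 0<k (ℕₚ.<⇒≤ k<p)))

module Frobenius (R : CRing) where
  open CommutativeRing R renaming (refl to ≈-refl; sym to ≈-sym; trans to ≈-trans)
  open Mult +-monoid using (×-cong; ×-congʳ; ×-assocˡ; ×-homo-1) renaming (_×_ to _×ᴿ_)
  open SMult semiring using (×-assoc-*)
  open Exp semiring using (_^_; ^-congˡ; ^-assocʳ)

  char-* : ∀ {p n} → p ×ᴿ 1# ≈ 0# → p ∣ n → ∀ x → n ×ᴿ x ≈ 0#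
  char-* {p} char (divides k refl) x = ≈-trans (≈-sym (×-assocˡ x k p)) (≈-trans (×-congʳ k
    (≈-trans (×-congʳ p (≈-sym (*-identityˡ x))) (≈-trans (≈-sym (×-assoc-* p 1# x)) (≈-trans (*-congʳ char) (zeroˡ x))))) (zeros k))
    where
    zeros : ∀ k → k ×ᴿ 0# ≈ 0#
    zeros zero    = ≈-refl
    zeros (suc k) = ≈-trans (+-identityˡ _) (zeros k)

  frobenius : ∀ {p} → Prime p → p ×ᴿ 1# ≈ 0# → ∀ x y → (x + y) ^ p ≈ x ^ p + y ^ p
  frobenius {zero}  pp char x y = contradiction pp ¬prime[0]
  frobenius {suc m} pp char x y = ≈-trans (Binomial.theorem commutativeSemiring (suc m) x y)
    (≈-trans (+-cong first (≈-trans (SR.sum-init-last {m} (λ k → term (Fin.suc k))) (+-cong middle last))) (≈-trans (+-congˡ (+-identityˡ _)) (+-comm _ _)))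
    where
    module SR = SRSum semiring
    term : Fin (suc (suc m)) → Carrier
    term = Binomial.binomialTerm commutativeSemiring x y (suc m)
    first : term Fin.zero ≈ y ^ suc m
    first = ≈-trans (×-cong (trans (nCk≡nC[n∸k] {0} {suc m} ℕ.z≤n) (nCn≡1 (suc m))) ≈-refl) (≈-trans (×-homo-1 _) (*-identityˡ _))
    last : term (Fin.suc (Fin.fromℕ m)) ≈ x ^ suc m
    last = ≈-trans (×-cong (trans (cong (λ k → suc m C suc k) (Finₚ.toℕ-fromℕ m)) (nCn≡1 (suc m))) ≈-refl) (≈-trans (×-homo-1 _)
      (≈-trans (*-cong (reflexive (cong (λ k → x ^ suc k) (Finₚ.toℕ-fromℕ m)))
        (reflexive (cong (y ^_) (trans (cong (m ℕ.∸_) (Finₚ.toℕ-fromℕ m)) (ℕₚ.n∸n≡0 m))))) (*-identityʳ _)))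
    middle : SR.sum (λ k → term (Fin.suc (Fin.inject₁ k))) ≈ 0#
    middle = ≈-trans (SR.sum-cong-≋ {m} (λ k → char-* char (prime∣binomial pp _ (ℕ.s≤s ℕ.z≤n)
      (ℕ.s≤s (subst (ℕ._< m) (sym (Finₚ.toℕ-inject₁ k)) (Finₚ.toℕ<n k)))) _)) (SR.sum-replicate-zero m)

  frobenius^ : ∀ {p} → Prime p → p ×ᴿ 1# ≈ 0# → ∀ e x y → (x + y) ^ (p ℕ.^ e) ≈ x ^ (p ℕ.^ e) + y ^ (p ℕ.^ e)
  frobenius^ pp char zero    x y = ≈-trans (*-identityʳ _) (≈-sym (+-cong (*-identityʳ _) (*-identityʳ _)))
  frobenius^ {p} pp char (suc e) x y = ≈-trans (≈-sym (^-assocʳ _ p (p ℕ.^ e))) (≈-trans (^-congˡ (p ℕ.^ e) (frobenius pp char x y))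
    (≈-trans (frobenius^ pp char e _ _) (+-cong (^-assocʳ x p (p ℕ.^ e)) (^-assocʳ y p (p ℕ.^ e)))))

module SubfieldProperties (F : FiniteField) where
  open FiniteField F using (_≟_; _⁻¹; 0≢1; inverseʳ; elements; elements-unique; elements-complete)
  open FieldPolynomials F
  open CommutativeRing 𝕃 using (Carrier; _+_; _*_; -_; 0#; 1#; +-identityˡ; +-identityʳ; *-identityˡ;
    *-identityʳ; zeroˡ; zeroʳ; *-comm; *-assoc; +-comm; +-assoc; -‿inverseˡ; -‿inverseʳ; ring; semiring; commutativeSemiring; +-monoid)
  open Exp semiring using (_^_; ^-assocʳ)
  open Mult +-monoid using () renaming (_×_ to _×ᴸ_; ×-homo-+ to ×ᴸ-homo-+; ×-assocˡ to ×ᴸ-assocˡ)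

  open Polynomial 𝕃
  open Conv 𝕃 using (conv-top)

  zero-divides : ∀ {p a} → eval₁ p a ≡ 0# → Pow 𝕃[x] (lin a) 1 Divides p
  zero-divides {p} {a} e with factor {p} {a} e
  ... | h , e' = h , Px.trans e' (Px.*-congʳ (Px.sym (Px.*-identityʳ _)))

  count-simple-zeros : ∀ {p n} → Exact p n → ∀ xs → Unique xs → All (λ a → eval₁ p a ≡ 0#) xs → length xs ℕ.≤ n
  count-simple-zeros {p} u xs d zs = subst (ℕ._≤ _) (ℕₚ.*-identityˡ _)
    (count-zeros 1 u xs d (All.map (λ {a} → zero-divides {p} {a}) zs))

  natMul≡× : ∀ n → natMul F n ≡ n ×ᴸ 1#
  natMul≡× zero    = refl
  natMul≡× (suc n) = cong (1# +_) (natMul≡× n)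

  product : List Carrier → Carrier
  product = foldr _*_ 1#

  product-↭ : ∀ {xs ys} → xs ↭ ys → product xs ≡ product ys
  product-↭ ↭.refl         = refl
  product-↭ (↭.prep x p)   = cong (x *_) (product-↭ p)
  product-↭ (↭.swap x y p) = trans (x∙yz≈y∙xz x y _) (cong (λ z → y * (x * z)) (product-↭ p))
    where open CommSemigroupProperties (CommutativeRing.*-commutativeSemigroup 𝕃) using (x∙yz≈y∙xz)
  product-↭ (↭.trans p r)  = trans (product-↭ p) (product-↭ r)

  product-map : ∀ a xs → product (map (a *_) xs) ≡ a ^ length xs * product xs
  product-map a []       = sym (*-identityʳ 1#)
  product-map a (x ∷ xs) = trans (cong (a * x *_) (product-map a xs)) (interchange a x _ _)
    where open CommSemigroupProperties (CommutativeRing.*-commutativeSemigroup 𝕃) using (interchange)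

  product-nonzero : ∀ {xs} → All (_≢ 0#) xs → product xs ≢ 0#
  product-nonzero []       e = 0≢1 (sym e)
  product-nonzero (z ∷ zs) e = *-nonzero z (product-nonzero zs) e

  *-cancelˡ-nonzero : ∀ {a x y} → a ≢ 0# → a * x ≡ a * y → x ≡ y
  *-cancelˡ-nonzero {a} {x} {y} nz e = *-cancelʳ-nonzero nz (trans (*-comm x a) (trans e (*-comm a y)))

  ^-nonzero : ∀ {a} n → a ≢ 0# → a ^ n ≢ 0#
  ^-nonzero zero    nz e = 0≢1 (sym e)
  ^-nonzero (suc n) nz   = *-nonzero nz (^-nonzero n nz)

  x-y≡0⇒x≡y : ∀ {x y} → x + - y ≡ 0# → x ≡ y
  x-y≡0⇒x≡y {x} {y} e with x ≟ y
  ... | yes x≡y = x≡y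
  ... | no  x≢y = contradiction e (x-a≢0 x≢y)

  -- L as a subfield of itself, so that `fermat` also yields x^Q = x on L.
  whole : Subfield F (length elements)
  whole = record
    { In = λ _ → ⊤ ; In-0 = tt ; In-1 = tt ; In-+ = λ _ _ → tt ; In-* = λ _ _ → tt ; In-- = λ _ → tt ; In-⁻¹ = λ _ → tt
    ; elems = elements ; elems-unique = elements-unique
    ; elems-spec = λ x → mk⇔ (λ _ → tt) (λ _ → elements-complete x) ; elems-card = refl }

  module _ {q} (K : Subfield F q) where
    open Subfield K

    In⇒∈ : ∀ {x} → In x → x ∈ elems
    In⇒∈ = Equivalence.from (elems-spec _)

    ∈⇒In : ∀ {x} → x ∈ elems → In x
    ∈⇒In = Equivalence.to (elems-spec _)

    private
      nonzero : List Carrier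
      nonzero = filter (λ x → ¬? (x ≟ 0#)) elems

      nonzero-unique : Unique nonzero
      nonzero-unique = Uniqueₚ.filter⁺ _ elems-unique

      ∈-nonzero : ∀ {x} → x ∈ nonzero → In x × x ≢ 0#
      ∈-nonzero m with ∈ₚ.∈-filter⁻ (λ x → ¬? (x ≟ 0#)) m
      ... | i , nz = ∈⇒In i , nz

      nonzero-∈ : ∀ {x} → In x → x ≢ 0# → x ∈ nonzero
      nonzero-∈ i nz = ∈ₚ.∈-filter⁺ (λ x → ¬? (x ≟ 0#)) (In⇒∈ i) nz

      all-nonzero : All (_≢ 0#) nonzero
      all-nonzero = All.tabulate (λ m → proj₂ (∈-nonzero m))

      q≡1+ : q ≡ suc (length nonzero)
      q≡1+ = trans (sym elems-card) (↭ₚ.↭-length (remove-↭ _≟_ elems-unique (In⇒∈ In-0)))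

    2≤q : 2 ℕ.≤ q
    2≤q with nonzero | q≡1+ | nonzero-∈ In-1 (λ e → 0≢1 (sym e))
    ... | x ∷ xs | refl | _ = ℕ.s≤s (ℕ.s≤s ℕ.z≤n)

    -- Multiplication by a nonzero element of K permutes the nonzero elements of K; comparing their
    -- product before and after gives a^(q-1) = 1.
    fermat : ∀ {a} → In a → a ^ q ≡ a
    fermat {a} i with a ≟ 0#
    ... | yes refl = subst (λ n → 0# ^ n ≡ 0#) (sym q≡1+) (zeroˡ _)
    ... | no nz = subst (λ n → a ^ n ≡ a) (sym q≡1+) (trans (cong (a *_) unit) (*-identityʳ a))
      where
      perm : map (a *_) nonzero ↭ nonzero
      perm = unique-↭ (Uniqueₚ.map⁺ (*-cancelˡ-nonzero nz) nonzero-unique) nonzero-unique to from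
        where
        to : ∀ {x} → x ∈ map (a *_) nonzero → x ∈ nonzero
        to m with ∈ₚ.∈-map⁻ (a *_) m
        ... | y , y∈ , refl = nonzero-∈ (In-* i (proj₁ (∈-nonzero y∈))) (*-nonzero nz (proj₂ (∈-nonzero y∈)))
        from : ∀ {x} → x ∈ nonzero → x ∈ map (a *_) nonzero
        from {x} m = subst (_∈ map (a *_) nonzero) undo (∈ₚ.∈-map⁺ (a *_)
          (nonzero-∈ (In-* (In-⁻¹ i) (proj₁ (∈-nonzero m))) (λ e → proj₂ (∈-nonzero m)
            (trans (sym undo) (trans (cong (a *_) e) (zeroʳ a))))))
          where
          undo : a * ((a ⁻¹) * x) ≡ x
          undo = trans (sym (*-assoc _ _ _)) (trans (cong (_* x) (inverseʳ a nz)) (*-identityˡ x))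
      unit : a ^ length nonzero ≡ 1#
      unit = *-cancelʳ-nonzero (product-nonzero all-nonzero)
        (trans (sym (product-map a nonzero)) (trans (product-↭ perm) (sym (*-identityˡ _))))

    private
      eval-^ : ∀ n p a → eval₁ (Pow 𝕃[x] p n) a ≡ eval₁ p a ^ n
      eval-^ n p a = HomProperties.^-homo (evalHom a) p n

    -- The q elements of K are already zeros of X^q - X, which has degree q; a fixed y outside K
    -- would be one zero too many.
    fixed⇒In : ∀ {y} → y ^ q ≡ y → In y
    fixed⇒In {y} e with Anyₗ.any? (y ≟_) elems
    ... | yes m = ∈⇒In m
    ... | no ¬m = contradiction
        (count-simple-zeros {X^q-X} ex (y ∷ elems) (Allₚ.¬Any⇒All¬ elems ¬m ∷ elems-unique)
          (root e ∷ All.tabulate (λ m → root (fermat (∈⇒In m)))))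
        (ℕₚ.<⇒≱ (ℕₚ.≤-reflexive (cong suc (sym elems-card))))
      where
      X^q-X : 𝒫
      X^q-X = Pow 𝕃[x] var q ⊕ ⊖ var
      ex : Exact X^q-X q
      ex = exact-⊕ (subst (Exact _) (ℕₚ.*-identityʳ q) (exact-^ q exact-var))
        (λ i q≤i → trans (coef-⊖ var i) (trans (cong -_ (above exact-var i (ℕₚ.≤-trans 2≤q q≤i))) (RingProperties.-0#≈0# ring)))
      root : ∀ {a} → a ^ q ≡ a → eval₁ X^q-X a ≡ 0#
      root {a} e = trans (Hom.+-homo (evalHom a) (Pow 𝕃[x] var q) (⊖ var)) (trans
        (cong₂ _+_ (trans (eval-^ q var a) (trans (cong (_^ q) (Eval.ev-var (idHom 𝕃) a)) e))
          (trans (Hom.-‿homo (evalHom a) var) (cong -_ (Eval.ev-var (idHom 𝕃) a)))) (-‿inverseʳ a))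

    private
      X+1 : 𝒫
      X+1 = var ⊕ con 1#

      exact-X+1 : Exact X+1 1
      exact-X+1 = exact-⊕ exact-var (λ { (suc i) _ → coef-con-suc 1# i })

      X+1^-lead : ∀ n → coef (Pow 𝕃[x] X+1 n) n ≡ 1#
      X+1^-lead zero    = coef-con-0 1#
      X+1^-lead (suc n) = trans (coef-⊗ X+1 _ (suc n)) (trans
        (conv-top 1 n _ _ (above exact-X+1) (above (subst (Exact _) (ℕₚ.*-identityʳ n) (exact-^ n exact-X+1))))
        (trans (cong₂ _*_ (trans (coef-⊕ var (con 1#) 1) (trans (cong₂ _+_ coef-var-1 (coef-con-suc 1# 0)) (+-identityʳ _)))
          (X+1^-lead n)) (*-identityˡ 1#)))

      -- (X + 1) ^ n - X ^ n
      Δ : ℕ → 𝒫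
      Δ zero    = []
      Δ (suc n) = Pow 𝕃[x] X+1 n ⊕ (0# ∷ Δ n)

      Δ-above : ∀ n i → n ℕ.≤ i → coef (Δ n) i ≡ 0#
      Δ-above zero    i       _         = refl
      Δ-above (suc n) (suc i) (ℕ.s≤s l) = trans (coef-⊕ _ (0# ∷ Δ n) (suc i)) (trans
        (cong₂ _+_ (above (subst (Exact _) (ℕₚ.*-identityʳ n) (exact-^ n exact-X+1)) (suc i) (ℕ.s≤s l)) (Δ-above n i l))
        (+-identityˡ 0#))

      Δ-lead : ∀ n → coef (Δ (suc n)) n ≡ suc n ×ᴸ 1#
      Δ-lead n = trans (coef-⊕ _ (0# ∷ Δ n) n) (cong₂ _+_ (X+1^-lead n) (lower n))
        where
        lower : ∀ n → coef (0# ∷ Δ n) n ≡ n ×ᴸ 1#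
        lower zero    = refl
        lower (suc n) = Δ-lead n

      eval-Δ : ∀ n a → eval₁ (Δ n) a + a ^ n ≡ (a + 1#) ^ n
      eval-Δ zero    a = +-identityˡ 1#
      eval-Δ (suc n) a = trans (cong (_+ a * a ^ n) (trans (Hom.+-homo (evalHom a) _ (0# ∷ Δ n))
          (cong₂ _+_ (trans (eval-^ n X+1 a) (cong (_^ n) eval-X+1)) (+-identityˡ _))))
        (trans (solve 4 (λ s a e t → s :+ a :* e :+ a :* t := s :+ a :* (e :+ t)) refl ((a + 1#) ^ n) a _ (a ^ n))
        (trans (cong (λ z → (a + 1#) ^ n + a * z) (eval-Δ n a))
        (solve 2 (λ s a → s :+ a :* s := (a :+ con' 1) :* s) refl ((a + 1#) ^ n) a)))
        where
        open NatSolver commutativeSemiring using (solve; _:+_; _:*_; _:=_) renaming (con to con')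
        eval-X+1 : eval₁ X+1 a ≡ a + 1#
        eval-X+1 = trans (Hom.+-homo (evalHom a) var (con 1#)) (cong₂ _+_ (Eval.ev-var (idHom 𝕃) a) (Eval.ev-con (idHom 𝕃) a 1#))

      ×-zero : ∀ m n → n ×ᴸ 1# ≡ 0# → (m ℕ.* n) ×ᴸ 1# ≡ 0#
      ×-zero m n e = trans (sym (×ᴸ-assocˡ 1# m n)) (trans (cong (m ×ᴸ_) e) (zeros m))
        where
        zeros : ∀ m → m ×ᴸ 0# ≡ 0#
        zeros zero    = refl
        zeros (suc m) = trans (+-identityˡ _) (zeros m)

    module _ {p} (pp : Prime p) (char : natMul F p ≡ 0#) where
      private
        p×1≡0 : p ×ᴸ 1# ≡ 0#
        p×1≡0 = trans (sym (natMul≡× p)) char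

        1+≢ : ∀ m n → m ×ᴸ 1# ≡ 0# → n ×ᴸ 1# ≡ 0# → suc m ≢ n
        1+≢ m n e f eq = 0≢1 (sym (trans (sym (trans (cong (1# +_) e) (+-identityʳ 1#))) (trans (cong (_×ᴸ 1#) eq) f)))

        instance
          p≢0 : ℕ.NonZero p
          p≢0 = prime⇒nonZero pp

      -- A nonzero remainder of n modulo p is coprime to p and also kills 1; a Bézout identity
      -- between the two would give 1 = 0.
      ×1≡0⇒∣ : ∀ n → n ×ᴸ 1# ≡ 0# → p ∣ n
      ×1≡0⇒∣ n e with n DM.% p in eq
      ... | zero  = ∣.m%n≡0⇒n∣m n p eq
      ... | suc k = contradiction (coprime-Bézout (prime⇒coprime pp (subst (ℕ._< p) eq (DM.m%n<n n p)))) λ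
        { (Bézout.+- x y b) → 1+≢ (y ℕ.* suc k) (x ℕ.* p) (×-zero y (suc k) k×1≡0) (×-zero x p p×1≡0) b
        ; (Bézout.-+ x y b) → 1+≢ (x ℕ.* p) (y ℕ.* suc k) (×-zero x p p×1≡0) (×-zero y (suc k) k×1≡0) b }
        where
        k×1≡0 : suc k ×ᴸ 1# ≡ 0#
        k×1≡0 = trans (sym (+-identityʳ _)) (trans (cong (suc k ×ᴸ 1# +_) (sym (×-zero (n DM./ p) p p×1≡0)))
          (trans (sym (×ᴸ-homo-+ 1# (suc k) (n DM./ p ℕ.* p)))
          (trans (cong (_×ᴸ 1#) (trans (cong (ℕ._+ n DM./ p ℕ.* p) (sym eq)) (sym (DM.m≡m%n+[m/n]*n n p)))) e)))

      -- Additivity gives (x - y)^p + y^p = x^p, so equal p-th powers force (x - y)^p = 0.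
      frobenius-injective : ∀ {x y} → x ^ p ≡ y ^ p → x ≡ y
      frobenius-injective {x} {y} e with x ≟ y
      ... | yes x≡y = x≡y
      ... | no x≢y = contradiction (cancel (trans (sym (Frobenius.frobenius 𝕃 pp p×1≡0 (x + - y) y))
              (trans (cong (_^ p) (trans (+-assoc x _ y) (trans (cong (x +_) (-‿inverseˡ y)) (+-identityʳ x)))) e)))
            (^-nonzero p (x-a≢0 x≢y))
        where
        cancel : ∀ {a b} → a + b ≡ b → a ≡ 0#
        cancel {a} {b} e = trans (sym (+-identityʳ a)) (trans (cong (a +_) (sym (-‿inverseʳ b)))
          (trans (sym (+-assoc a b _)) (trans (cong (_+ - b) e) (-‿inverseʳ b))))

      -- If n ≥ 2 and x ↦ xⁿ is additive on K, then (X + 1)ⁿ - Xⁿ - 1 has more zeros than its degree allows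
      -- unless its coefficient n at Xⁿ⁻¹ vanishes; and then x ↦ xⁿ⸍ᵖ is additive too.
      additive-power⇒prime-power : ∀ n → 0 ℕ.< n → n ℕ.≤ q → (∀ {x y} → In x → In y → (x + y) ^ n ≡ x ^ n + y ^ n) →
                           ∃ λ e → n ≡ p ℕ.^ e
      additive-power⇒prime-power = <-rec _ step
        where
        step : ∀ n → (∀ {k} → k ℕ.< n → 0 ℕ.< k → k ℕ.≤ q → (∀ {x y} → In x → In y → (x + y) ^ k ≡ x ^ k + y ^ k) →
                 ∃ λ e → k ≡ p ℕ.^ e) → 0 ℕ.< n → n ℕ.≤ q → (∀ {x y} → In x → In y → (x + y) ^ n ≡ x ^ n + y ^ n) →
                 ∃ λ e → n ≡ p ℕ.^ e
        step (suc zero) rec _ _ _ = 0 , refl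
        step n@(suc (suc m)) rec _ n≤q add with (suc (suc m) ×ᴸ 1#) ≟ 0#
        ... | no nz = contradiction (count-simple-zeros {P} (exact P-above P-lead) elems elems-unique
                  (All.tabulate (λ {a} a∈ → root a (∈⇒In a∈))))
                (ℕₚ.<⇒≱ (subst (suc m ℕ.<_) (sym elems-card) n≤q))
          where
          P : 𝒫
          P = Δ n ⊕ con (- 1#)
          P-above : ∀ i → suc m ℕ.< i → coef P i ≡ 0#
          P-above (suc i) l = trans (coef-⊕ (Δ n) (con (- 1#)) (suc i)) (trans (cong₂ _+_ (Δ-above n (suc i) l) (coef-con-suc (- 1#) i)) (+-identityˡ 0#))
          P-lead : coef P (suc m) ≢ 0#
          P-lead z = nz (trans (sym (trans (coef-⊕ (Δ n) (con (- 1#)) (suc m)) (trans (cong₂ _+_ (Δ-lead (suc m)) (coef-con-suc (- 1#) m)) (+-identityʳ _)))) z)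
          1^ : ∀ n → 1# ^ n ≡ 1#
          1^ zero    = refl
          1^ (suc n) = trans (*-identityˡ _) (1^ n)
          root : ∀ a → In a → eval₁ P a ≡ 0#
          root a i = trans (Hom.+-homo (evalHom a) (Δ n) (con (- 1#))) (trans (cong₂ _+_ value (Eval.ev-con (idHom 𝕃) a (- 1#))) (-‿inverseʳ 1#))
            where
            value : eval₁ (Δ n) a ≡ 1#
            value = RingProperties.+-cancelʳ ring (a ^ n) _ _ (trans (eval-Δ n a) (trans (add i In-1) (trans (cong (a ^ n +_) (1^ n)) (+-comm _ _))))
        ... | yes z with ×1≡0⇒∣ n z
        ...   | divides (suc k) eq with rec {suc k} k<n (ℕ.s≤s ℕ.z≤n) (ℕₚ.≤-trans (ℕₚ.<⇒≤ k<n) n≤q) add'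
          where
          k<n : suc k ℕ.< n
          k<n = subst (suc k ℕ.<_) (sym eq) (ℕₚ.m<m*n (suc k) p (ℕ.nonTrivial⇒n>1 p {{prime⇒nonTrivial pp}}))
          split : ∀ x → x ^ n ≡ (x ^ suc k) ^ p
          split x = trans (cong (x ^_) eq) (sym (^-assocʳ x (suc k) p))
          add' : ∀ {x y} → In x → In y → (x + y) ^ suc k ≡ x ^ suc k + y ^ suc k
          add' {x} {y} i j = frobenius-injective (trans (sym (split (x + y))) (trans (add i j)
            (trans (cong₂ _+_ (split x) (split y)) (sym (Frobenius.frobenius 𝕃 pp p×1≡0 _ _)))))
        ...     | e , eq' = suc e , trans eq (trans (cong (ℕ._* p) eq') (ℕₚ.*-comm _ p))

      -- On K the q-th power is the identity, hence additive, and this is the case n = q of the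
      -- preceding lemma. It links the order of K to the characteristic of L.
      order-prime-power : ∃ λ e → q ≡ p ℕ.^ e
      order-prime-power = additive-power⇒prime-power q (ℕₚ.≤-trans (ℕ.s≤s ℕ.z≤n) 2≤q) ℕₚ.≤-refl
        (λ i j → trans (fermat (In-+ i j)) (sym (cong₂ _+_ (fermat i) (fermat j))))

-- Stepanov's method

eval-natural : ∀ {R S T : CRing} (ψ : Hom S T) (φ : Hom R S) (s : ∣ S ∣ᴿ) (χ : Hom R T) (t : ∣ T ∣ᴿ) →
  (∀ a → CommutativeRing._≈_ T (Hom.⟦_⟧ ψ (Hom.⟦_⟧ φ a)) (Hom.⟦_⟧ χ a)) → CommutativeRing._≈_ T (Hom.⟦_⟧ ψ s) t →
  ∀ p → CommutativeRing._≈_ T (Hom.⟦_⟧ ψ (Eval.ev φ s p)) (Eval.ev χ t p)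
eval-natural         ψ φ s χ t u v []      = Hom.0-homo ψ
eval-natural {T = T} ψ φ s χ t u v (a ∷ p) = T.trans (Hom.+-homo ψ _ _) (T.+-cong (u a)
  (T.trans (Hom.*-homo ψ _ _) (T.*-cong v (eval-natural ψ φ s χ t u v p))))
  where module T = CommutativeRing T

-- The trace is the formula y + y^q + y^(q²) + ..., which makes sense in any ring. It is applied to
-- field elements, to polynomials and to polynomials in X and T, and `tr-homo` compares the results.
module Trace (q : ℕ) (R : CRing) where
  open CommutativeRing R using (Carrier; _≈_; _+_; 0#)

  tr : ℕ → Carrier → Carrier
  tr zero    y = 0#
  tr (suc k) y = tr k y + Pow R y (q ℕ.^ k)

  tr-cong : ∀ k {x y} → x ≈ y → tr k x ≈ tr k y
  tr-cong zero    u = CommutativeRing.refl R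
  tr-cong (suc k) u = CommutativeRing.+-cong R (tr-cong k u) (Exp.^-congˡ (CommutativeRing.semiring R) (q ℕ.^ k) u)

tr-homo : ∀ q {R S : CRing} (φ : Hom R S) k y →
  CommutativeRing._≈_ S (Hom.⟦_⟧ φ (Trace.tr q R k y)) (Trace.tr q S k (Hom.⟦_⟧ φ y))
tr-homo q         φ zero    y = Hom.0-homo φ
tr-homo q {S = S} φ (suc k) y = CommutativeRing.trans S (Hom.+-homo φ _ _)
  (CommutativeRing.+-cong S (tr-homo q φ k y) (HomProperties.^-homo φ y (q ℕ.^ k)))

-- Polynomials in T over 𝕃[x]: coef₂ P k e is the coefficient of Tᵏ Xᵉ.
module Bivariate (F : FiniteField) where
  open FieldPolynomials F
  open CommutativeRing 𝕃 using (Carrier; _+_; _*_; -_; 0#; 1#; +-identityˡ; +-identityʳ; zeroˡ; zeroʳ; ring)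
  open Polynomial 𝕃
  module B = Polynomial 𝕃[x]
  𝕃[x,T] : CRing
  𝕃[x,T] = B.polynomialRing
  module Bx = CommutativeRing 𝕃[x,T]

  coef₂ : B.𝒫 → ℕ → ℕ → Carrier
  coef₂ P k e = coef (B.coef P k) e

  -- The disjunctive form passes through sums and products without deciding `φ`.
  record Supported (φ : ℕ → ℕ → Set) (P : B.𝒫) : Set where
    constructor support
    field at₂ : ∀ k e → coef₂ P k e ≡ 0# ⊎ φ k e
  open Supported public

  private
    ⊎-+ : ∀ {X : Set} {a b} → a ≡ 0# ⊎ X → b ≡ 0# ⊎ X → a + b ≡ 0# ⊎ X
    ⊎-+ (inj₂ x) _        = inj₂ x
    ⊎-+ (inj₁ _) (inj₂ x) = inj₂ x
    ⊎-+ (inj₁ a) (inj₁ b) = inj₁ (trans (cong₂ _+_ a b) (+-identityˡ 0#))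

    ⊎-≡ : ∀ {X : Set} {a b} → a ≡ b → b ≡ 0# ⊎ X → a ≡ 0# ⊎ X
    ⊎-≡ refl x = x

  supported-weaken : ∀ {φ ψ P} → (∀ k e → φ k e → ψ k e) → Supported φ P → Supported ψ P
  supported-weaken w s = support λ k e → Sum⊎.map₂ (w k e) (at₂ s k e)

  supported-≋ : ∀ {φ P Q} → P B.≋ Q → Supported φ P → Supported φ Q
  supported-≋ u s = support λ k e → ⊎-≡ (sym (at (B.at u k) e)) (at₂ s k e)

  supported-⊕ : ∀ {φ P Q} → Supported φ P → Supported φ Q → Supported φ (P B.⊕ Q)
  supported-⊕ {P = P} {Q} s t = support λ k e → ⊎-≡ (trans (at (B.coef-⊕ P Q k) e) (coef-⊕ (B.coef P k) (B.coef Q k) e)) (⊎-+ (at₂ s k e) (at₂ t k e))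

  supported-⊖ : ∀ {φ P} → Supported φ P → Supported φ (B.⊖ P)
  supported-⊖ {P = P} s = support λ k e → Sum⊎.map₁ (λ z → trans (at (B.coef-⊖ P k) e) (trans (coef-⊖ (B.coef P k) e) (trans (cong -_ z) (RingProperties.-0#≈0# ring)))) (at₂ s k e)

  supported-⊗ : ∀ {φ ψ χ P Q} → (∀ {k e k' e'} → φ k e → ψ k' e' → χ (k ℕ.+ k') (e ℕ.+ e')) →
    Supported φ P → Supported ψ Q → Supported χ (P B.⊗ Q)
  supported-⊗ {φ} {ψ} {χ} {P} {Q} w s t = support λ k e → ⊎-≡ (at (B.coef-⊗ P Q k) e)
    (Conv.conv-closed 𝕃[x] (λ x → coef x e ≡ 0# ⊎ χ k e) (λ {x} {y} u v → ⊎-≡ (coef-⊕ x y e) (⊎-+ u v)) k _ _ (outer k e))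
    where
    module _ (k e : ℕ) where
      inner : ∀ i j i' j' → i ℕ.+ j ≡ k → i' ℕ.+ j' ≡ e → coef₂ P i i' * coef₂ Q j j' ≡ 0# ⊎ χ k e
      inner i j i' j' refl refl with at₂ s i i' | at₂ t j j'
      ... | inj₁ z | _      = inj₁ (trans (cong (_* _) z) (zeroˡ _))
      ... | inj₂ _ | inj₁ z = inj₁ (trans (cong (_ *_) z) (zeroʳ _))
      ... | inj₂ x | inj₂ y = inj₂ (w x y)
      outer : ∀ i j → i ℕ.+ j ≡ k → coef (B.coef P i ⊗ B.coef Q j) e ≡ 0# ⊎ χ k e
      outer i j eq = ⊎-≡ (coef-⊗ (B.coef P i) (B.coef Q j) e)
        (Conv.conv-closed 𝕃 (λ x → x ≡ 0# ⊎ χ k e) ⊎-+ e _ _ (λ i' j' → inner i j i' j' eq))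

  supported-con : ∀ {φ p} → (∀ e → coef p e ≡ 0# ⊎ φ 0 e) → Supported φ (B.con p)
  supported-con {p = p} s = support λ
    { zero    e → ⊎-≡ (at (B.coef-con-0 p) e) (s e)
    ; (suc k) e → inj₁ (at (B.coef-con-suc p k) e) }

  supported-var : ∀ {φ} → φ 1 0 → Supported φ B.var
  supported-var x = support λ
    { zero          e       → inj₁ (at B.coef-var-0 e)
    ; (suc zero)    zero    → inj₂ x
    ; (suc zero)    (suc e) → inj₁ (trans (at B.coef-var-1 (suc e)) (coef-con-suc 1# e))
    ; (suc (suc k)) e       → inj₁ (at (B.coef-var-≥2 k) e) }

  coef₂-sum : ∀ {n} (c : Fin n → Carrier) (P : Fin n → B.𝒫) k e →
    coef₂ (Sum 𝕃[x,T] (λ j → B.con (con (c j)) B.⊗ P j)) k e ≡ Sum 𝕃 (λ j → c j * coef₂ (P j) k e)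
  coef₂-sum {zero}  c P k e = refl
  coef₂-sum {suc n} c P k e = trans (at (B.coef-⊕ (B.con (con (c Fin.zero)) B.⊗ P Fin.zero) _ k) e)
    (trans (coef-⊕ _ (B.coef (Sum 𝕃[x,T] (λ j → B.con (con (c (Fin.suc j))) B.⊗ P (Fin.suc j))) k) e)
    (cong₂ _+_ (trans (at (B.coef-con-⊗ (con (c Fin.zero)) (P Fin.zero) k) e) (coef-con-⊗ (c Fin.zero) _ e))
      (coef₂-sum (λ j → c (Fin.suc j)) (λ j → P (Fin.suc j)) k e)))

  -- In P(X, T) the exponent of X is at most B - A + d k in the coefficient of Tᵏ.
  record Weight (d A B : ℕ) (P : B.𝒫) : Set where
    constructor weight
    field supported : Supported (λ k e → e ℕ.+ A ℕ.≤ B ℕ.+ d ℕ.* k) P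
  open Weight public

  weight-⊗ : ∀ {d A B A' B' P Q} → Weight d A B P → Weight d A' B' Q → Weight d (A ℕ.+ A') (B ℕ.+ B') (P B.⊗ Q)
  weight-⊗ {d} {A} {B} {A'} {B'} (weight s) (weight t) = weight (supported-⊗ (λ {k} {e} {k'} {e'} u v → ℕₚ.≤-trans
    (ℕₚ.≤-reflexive (solve 4 (λ e e' A A' → (e :+ e') :+ (A :+ A') := (e :+ A) :+ (e' :+ A')) refl e e' A A'))
    (ℕₚ.≤-trans (ℕₚ.+-mono-≤ u v)
    (ℕₚ.≤-reflexive (solve 5 (λ B B' d k k' → (B :+ d :* k) :+ (B' :+ d :* k') := (B :+ B') :+ d :* (k :+ k')) refl B B' d k k')))) s t)
    where open +-*-Solver

  weight-^ : ∀ {d A B P} n → Weight d A B P → Weight d (n ℕ.* A) (n ℕ.* B) (Pow 𝕃[x,T] P n)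
  weight-^ zero    w = weight (supported-con λ { zero → inj₂ ℕ.z≤n ; (suc e) → inj₁ (coef-con-suc 1# e) })
  weight-^ (suc n) w = weight-⊗ w (weight-^ n w)

  weight-^-0 : ∀ {d P} n → Weight d 0 0 P → Weight d 0 0 (Pow 𝕃[x,T] P n)
  weight-^-0 {d} {P} n w = subst (λ z → Weight d z z (Pow 𝕃[x,T] P n)) (ℕₚ.*-zeroʳ n) (weight-^ n w)

  weight-⊕ : ∀ {d A B P Q} → Weight d A B P → Weight d A B Q → Weight d A B (P B.⊕ Q)
  weight-⊕ (weight s) (weight t) = weight (supported-⊕ s t)

  weight-tr : ∀ {d P} q k → Weight d 0 0 P → Weight d 0 0 (Trace.tr q 𝕃[x,T] k P)
  weight-tr q zero    w = weight (support λ _ _ → inj₁ refl)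
  weight-tr q (suc k) w = weight-⊕ (weight-tr q k w) (weight-^-0 (q ℕ.^ k) w)

  X+T : B.𝒫
  X+T = B.con var B.⊕ B.var

  constants : Hom 𝕃 𝕃[x,T]
  constants = conHom 𝕃[x] ∘ᴴ conHom 𝕃

  -- This is f(X + T). Its coefficients in T are the Hasse derivatives of f, obtained without
  -- dividing by factorials, which may vanish in characteristic p.
  shift : 𝒫 → B.𝒫
  shift = Eval.ev constants X+T

  increment : 𝒫 → B.𝒫
  increment f = shift f B.⊕ B.⊖ B.con f

  supported-X+T : Supported (λ k e → e ℕ.+ k ℕ.≤ 1) X+T
  supported-X+T = supported-⊕
    (supported-con λ { zero → inj₁ coef-var-0 ; (suc zero) → inj₂ (ℕ.s≤s ℕ.z≤n) ; (suc (suc e)) → inj₁ (coef-var-≥2 e) })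
    (supported-var (ℕ.s≤s ℕ.z≤n))

  coef-above : ∀ p e → length p ℕ.≤ e → coef p e ≡ 0#
  coef-above []      e       _         = refl
  coef-above (a ∷ p) (suc e) (ℕ.s≤s l) = coef-above p e l

  -- f = a + X f' gives f(X + T) - f(X) = (X + T)(f'(X + T) - f'(X)) + T f'(X).
  increment-∷ : ∀ a f → (X+T B.⊗ increment f) B.⊕ (B.var B.⊗ B.con f) B.≋ increment (a ∷ f)
  increment-∷ a f = Bx.trans (rearrange 𝕃[x,T] (B.con var) B.var (shift f) (B.con f) (B.con (con a)))
      (Bx.+-congˡ (Bx.-‿cong (Bx.sym (Bx.trans (Hom.⟦⟧-cong (conHom 𝕃[x]) (∷-split a f))
        (Bx.trans (Hom.+-homo (conHom 𝕃[x]) (con a) (var ⊗ f)) (Bx.+-congˡ (Hom.*-homo (conHom 𝕃[x]) var f)))))))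
    where
    rearrange : (R : CRing) → let open CommutativeRing R renaming (_+_ to _+ᴿ_; _*_ to _*ᴿ_; -_ to -ᴿ_) in
      ∀ x t s f a → (((x +ᴿ t) *ᴿ (s +ᴿ -ᴿ f)) +ᴿ (t *ᴿ f)) ≈ ((a +ᴿ (x +ᴿ t) *ᴿ s) +ᴿ -ᴿ (a +ᴿ x *ᴿ f))
    rearrange R x t s f a = RP.x≈z-y _ _ _ (R.trans (R.sym (R.+-identityʳ _)) (R.trans
        (solve 6 (λ x t s f a n → (((x :+ t) :* (s :+ n) :+ t :* f) :+ (a :+ x :* f)) :+ con' 0 :=
           (a :+ (x :+ t) :* s) :+ ((x :+ t) :* (n :+ f))) R.refl x t s f a (R.- f))
        (R.trans (R.+-congˡ (R.trans (R.*-congˡ (R.-‿inverseˡ f)) (R.zeroʳ _))) (R.+-identityʳ _))))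
      where
      module R = CommutativeRing R
      open NatSolver R.commutativeSemiring using (solve; _:+_; _:*_; _:=_) renaming (con to con')
      module RP where
        x≈z-y : ∀ x y z → (x R.+ y) R.≈ z → x R.≈ (z R.+ R.- y)
        x≈z-y x y z u = R.trans (R.sym (R.+-identityʳ x)) (R.trans (R.+-congˡ (R.sym (R.-‿inverseʳ y)))
          (R.trans (R.sym (R.+-assoc x y _)) (R.+-congʳ u)))

  -- The increment is divisible by T and its total degree is at most that of f. So each power of T
  -- comes with at most d - 1 powers of X, which is the rate d' at which the number of conditions
  -- grows.
  supported-increment : ∀ f → Supported (λ k e → 1 ℕ.≤ k × e ℕ.+ k ℕ.< length f) (increment f)
  supported-increment [] = support λ k e → inj₁ (at (B.at (Bx.trans (Bx.+-identityˡ _) (Bx.trans (Bx.-‿cong (Hom.0-homo (conHom 𝕃[x])))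
    (RingProperties.-0#≈0# Bx.ring))) k) e)
  supported-increment (a ∷ f) = supported-≋ (increment-∷ a f) (supported-⊕
    (supported-⊗ (λ {k} {e} {k'} {e'} u v → ℕₚ.≤-trans (proj₁ v) (ℕₚ.m≤n+m k' k) , ℕ.s≤s (ℕₚ.≤-trans
        (ℕₚ.≤-reflexive (interchange e e' k k'))
        (ℕₚ.≤-trans (ℕₚ.+-monoˡ-≤ (e' ℕ.+ k') u) (proj₂ v)))) supported-X+T (supported-increment f))
    (supported-⊗ {φ = λ k e → k ≡ 1 × e ≡ 0} {ψ = λ k e → k ≡ 0 × e ℕ.< length f} (λ { (refl , refl) (refl , l) →
        ℕ.s≤s ℕ.z≤n , ℕ.s≤s (subst (ℕ._≤ length f) (ℕₚ.+-comm 1 _) l) })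
      (supported-var (refl , refl))
      (supported-con λ e → case-len e)))
    where
    open CommSemigroupProperties ℕₚ.+-commutativeSemigroup using (interchange)
    case-len : ∀ e → coef f e ≡ 0# ⊎ (0 ≡ 0 × e ℕ.< length f)
    case-len e with e ℕ.<? length f
    ... | yes l = inj₂ (refl , l)
    ... | no ¬l = inj₁ (coef-above f e (ℕₚ.≮⇒≥ ¬l))

module FrobeniusPower (F : FiniteField) {p} (pp : Prime p) (char : natMul F p ≡ FiniteField.0# F)
                      {q} (K : Subfield F q) where
  open FieldPolynomials F
  open SubfieldProperties F

  module _ {S : CRing} (φ : Hom 𝕃 S) where
    open CommutativeRing S renaming (sym to ≈-sym; trans to ≈-trans)
    open Mult +-monoid using () renaming (_×_ to _×ᴿ_)
    open Exp semiring using (_^_)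

    char-transfer : p ×ᴿ 1# ≈ 0#
    char-transfer = ≈-trans (≈-sym (natMul-homo p)) (≈-trans (Hom.⟦⟧-cong φ char) (Hom.0-homo φ))
      where
      natMul-homo : ∀ n → Hom.⟦_⟧ φ (natMul F n) ≈ n ×ᴿ 1#
      natMul-homo zero    = Hom.0-homo φ
      natMul-homo (suc n) = ≈-trans (Hom.+-homo φ _ _) (+-cong (Hom.1-homo φ) (natMul-homo n))

    frobenius-q^ : ∀ k x y → (x + y) ^ (q ℕ.^ k) ≈ x ^ (q ℕ.^ k) + y ^ (q ℕ.^ k)
    frobenius-q^ k x y with order-prime-power K pp char
    ... | e , refl rewrite ℕₚ.^-*-assoc p e k = Frobenius.frobenius^ S pp char-transfer (e ℕ.* k) x y

    tr-+ : ∀ k x y → Trace.tr q S k (x + y) ≈ Trace.tr q S k x + Trace.tr q S k y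
    tr-+ zero    x y = ≈-sym (+-identityˡ 0#)
    tr-+ (suc k) x y = ≈-trans (+-cong (tr-+ k x y) (frobenius-q^ k x y)) (interchange _ _ _ _)
      where open CommSemigroupProperties +-commutativeSemigroup using (interchange)

-- Enumeration of the unknowns and of the conditions

sum< : ℕ → (ℕ → ℕ) → ℕ
sum< zero    h = 0
sum< (suc n) h = sum< n h ℕ.+ h n

length-cartesianProductWith : {A B C : Set} (g : A → B → C) (xs : List A) (ys : List B) →
  length (cartesianProductWith g xs ys) ≡ length xs ℕ.* length ys
length-cartesianProductWith g []       ys = refl
length-cartesianProductWith g (x ∷ xs) ys = trans (Listₚ.length-++ (map (g x) ys))
  (cong₂ ℕ._+_ (Listₚ.length-map (g x) ys) (length-cartesianProductWith g xs ys))

-- The same enumeration serves the unknowns (i , l , b) with b < a l and the conditions (τ , m , e)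
-- with e < B₀ + d' m.
module _ {A : Set} (xs : List A) (h : ℕ → ℕ) where
  slice : ℕ → List (A × ℕ × ℕ)
  slice n = cartesianProductWith (λ x b → x , n , b) xs (upTo (h n))

  triples : ℕ → List (A × ℕ × ℕ)
  triples zero    = []
  triples (suc n) = triples n ++ slice n

  length-triples : ∀ n → length (triples n) ≡ length xs ℕ.* sum< n h
  length-triples zero    = sym (ℕₚ.*-zeroʳ (length xs))
  length-triples (suc n) = trans (Listₚ.length-++ (triples n)) (trans (cong₂ ℕ._+_ (length-triples n)
    (trans (length-cartesianProductWith _ xs (upTo (h n))) (cong (length xs ℕ.*_) (Listₚ.length-upTo (h n)))))
    (sym (ℕₚ.*-distribˡ-+ (length xs) _ _)))

  ∈-triples⁻ : ∀ n {x l b} → (x , l , b) ∈ triples n → x ∈ xs × l ℕ.< n × b ℕ.< h l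
  ∈-triples⁻ (suc n) m with ∈ₚ.∈-++⁻ (triples n) m
  ... | inj₁ m' with ∈-triples⁻ n m'
  ...   | x∈ , l< , b< = x∈ , ℕₚ.m<n⇒m<1+n l< , b<
  ∈-triples⁻ (suc n) m | inj₂ m' with ∈ₚ.∈-cartesianProductWith⁻ _ xs (upTo (h n)) m'
  ... | _ , _ , x∈ , b∈ , refl = x∈ , ℕₚ.n<1+n n , ∈ₚ.∈-upTo⁻ b∈

  ∈-triples⁺ : ∀ n {x l b} → x ∈ xs → l ℕ.< n → b ℕ.< h l → (x , l , b) ∈ triples n
  ∈-triples⁺ (suc n) {x} {l} x∈ l<1+n b< with l ℕₚ.≟ n
  ... | yes refl = ∈ₚ.∈-++⁺ʳ (triples n) (∈ₚ.∈-cartesianProductWith⁺ _ x∈ (∈ₚ.∈-upTo⁺ b<))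
  ... | no l≢n   = ∈ₚ.∈-++⁺ˡ (∈-triples⁺ n x∈ (ℕₚ.≤∧≢⇒< (ℕₚ.≤-pred l<1+n) l≢n) b<)

  triples-unique : Unique xs → ∀ n → Unique (triples n)
  triples-unique u zero    = []
  triples-unique u (suc n) = Uniqueₚ.++⁺ (triples-unique u n)
    (Uniqueₚ.cartesianProductWith⁺ _ (λ { refl → refl , refl }) u (Uniqueₚ.upTo⁺ (h n)))
    λ { (m , m') → disjoint m m' }
    where
    disjoint : ∀ {v} → v ∈ triples n → v ∈ slice n → ⊥
    disjoint m m' with ∈ₚ.∈-cartesianProductWith⁻ _ xs (upTo (h n)) m'
    ... | _ , _ , _ , _ , refl = ℕₚ.<-irrefl refl (proj₁ (proj₂ (∈-triples⁻ n m)))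

lookup-injective : {A : Set} {xs : List A} → Unique xs → ∀ {i j} → lookup xs i ≡ lookup xs j → i ≡ j
lookup-injective {xs = x ∷ xs} (a ∷ u) {Fin.zero}  {Fin.zero}  e = refl
lookup-injective {xs = x ∷ xs} (a ∷ u) {Fin.zero}  {Fin.suc j} e = contradiction e (All.lookup a (∈ₚ.∈-lookup j))
lookup-injective {xs = x ∷ xs} (a ∷ u) {Fin.suc i} {Fin.zero}  e = contradiction (sym e) (All.lookup a (∈ₚ.∈-lookup i))
lookup-injective {xs = x ∷ xs} (a ∷ u) {Fin.suc i} {Fin.suc j} e = cong Fin.suc (lookup-injective u e)

module Stepanov (F : FiniteField) {p} (pp : Prime p) (char : natMul F p ≡ FiniteField.0# F)
                {q r'} (K : Subfield F q) (card : length (FiniteField.elements F) ≡ q ℕ.^ suc r') where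
  open FieldPolynomials F
  open SubfieldProperties F
  open FrobeniusPower F pp char K
  open Bivariate F
  open Polynomial 𝕃
  open CommutativeRing 𝕃 using (Carrier; -_; 1#; ring)

  Q : ℕ
  Q = q ℕ.^ suc r'

  1<q : 1 ℕ.< q
  1<q = 2≤q K

  fermat-Q : ∀ a → Pow 𝕃 a Q ≡ a
  fermat-Q a = subst (λ n → Pow 𝕃 a n ≡ a) card (fermat whole tt)

  Tr : Carrier → Carrier
  Tr = Trace.tr q 𝕃 (suc r')

  trₓ : 𝒫 → 𝒫
  trₓ = Trace.tr q 𝕃[x] (suc r')

  -- The terms f^(q^j) have strictly increasing degrees q^j d because d > 0, so the last one
  -- dominates.
  exact-tr : ∀ {f d} k → 0 ℕ.< d → Exact f d → Exact (Trace.tr q 𝕃[x] (suc k) f) (q ℕ.^ k ℕ.* d)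
  exact-tr zero    0<d u = exact-cong (Px.sym (Px.+-identityˡ _)) (exact-^ 1 u)
  exact-tr {f} {d} (suc k) 0<d u = exact-cong (Px.+-comm _ _) (exact-⊕-< (exact-^ (q ℕ.^ suc k) u) (exact-tr k 0<d u)
    (ℕₚ.*-monoˡ-< d {{ℕ.>-nonZero 0<d}} (ℕₚ.^-monoʳ-< q 1<q (ℕₚ.n<1+n k))))

  x^Q-x : 𝒫
  x^Q-x = Pow 𝕃[x] var Q ⊕ ⊖ var

  1<Q : 1 ℕ.< Q
  1<Q = ℕₚ.<-≤-trans 1<q (ℕₚ.m≤m*n q (q ℕ.^ r') {{ℕₚ.m^n≢0 q r' {{ℕ.>-nonZero (ℕₚ.<-trans (ℕ.s≤s ℕ.z≤n) 1<q)}}}})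

  exact-x^Q-x : Exact x^Q-x Q
  exact-x^Q-x = exact-⊕ (subst (Exact _) (ℕₚ.*-identityʳ Q) (exact-^ Q exact-var))
    (λ i Q≤i → trans (coef-⊖ var i) (trans (cong -_ (above exact-var i (ℕₚ.<-≤-trans 1<Q Q≤i))) (RingProperties.-0#≈0# ring)))

  module Monomials (f : 𝒫) where
    Index : Set
    Index = ℕ × ℕ × ℕ

    monomial : Index → 𝒫
    monomial (i , l , b) = (Pow 𝕃[x] var b ⊗ Pow 𝕃[x] x^Q-x l) ⊗ Pow 𝕃[x] (trₓ f) i

    T^Q-T : B.𝒫
    T^Q-T = Pow 𝕃[x,T] B.var Q B.⊕ B.⊖ B.var

    w : B.𝒫
    w = Trace.tr q 𝕃[x,T] (suc r') (increment f)

    -- With X = x₀ and T = x - x₀ this is the monomial at every x₀ with Tr (f x₀) = τ (see ev₂-monomial₂);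
    -- x₀ itself enters only through X, so vanishing of T-coefficients is one linear system per τ.
    monomial₂ : Carrier → Index → B.𝒫
    monomial₂ τ (i , l , b) = (Pow 𝕃[x,T] X+T b B.⊗ Pow 𝕃[x,T] T^Q-T l) B.⊗ Pow 𝕃[x,T] (B.con (con τ) B.⊕ w) i

    -- Each of the l factors T^Q - T uses up at least one power of T without contributing an X. The
    -- coefficient of T^m thus has X-degree at most b + d' (m - l), and larger l leave room for
    -- larger b.
    weight-monomial₂ : ∀ {d'} → length f ≡ suc (suc d') → ∀ τ i l b → Weight d' (l ℕ.* d') b (monomial₂ τ (i , l , b))
    weight-monomial₂ {d'} len τ i l b = subst₂ (λ A B → Weight d' A B (monomial₂ τ (i , l , b)))
      (trans (ℕₚ.+-identityʳ _) (cong (ℕ._+ l ℕ.* d') (ℕₚ.*-zeroʳ b)))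
      (trans (ℕₚ.+-identityʳ _) (trans (cong₂ ℕ._+_ (ℕₚ.*-identityʳ b) (ℕₚ.*-zeroʳ l)) (ℕₚ.+-identityʳ b)))
      (weight-⊗ (weight-⊗ (weight-^ b weight-X+T) (weight-^ l weight-T^Q-T)) (weight-^-0 i weight-w))
      where
      weight-X+T : Weight d' 0 1 X+T
      weight-X+T = weight (supported-weaken (λ k e h → ℕₚ.≤-trans (ℕₚ.≤-reflexive (ℕₚ.+-identityʳ e))
        (ℕₚ.≤-trans (ℕₚ.m≤m+n e k) (ℕₚ.≤-trans h (ℕₚ.m≤m+n 1 _)))) supported-X+T)
      1≤k⇒ : ∀ {k} → 1 ℕ.≤ k → d' ℕ.≤ d' ℕ.* k
      1≤k⇒ {k} h = ℕₚ.≤-trans (ℕₚ.≤-reflexive (sym (ℕₚ.*-identityʳ d'))) (ℕₚ.*-monoʳ-≤ d' h)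
      φ : ℕ → ℕ → ℕ → Set
      φ n k e = n ℕ.≤ k × e ≡ 0
      T^ : ∀ n → Supported (φ n) (Pow 𝕃[x,T] B.var n)
      T^ zero    = supported-con λ { zero → inj₂ (ℕ.z≤n , refl) ; (suc e) → inj₁ (coef-con-suc 1# e) }
      T^ (suc n) = supported-⊗ (λ { (u , refl) (v , refl) → ℕₚ.+-mono-≤ u v , refl }) (supported-var {φ 1} (ℕₚ.≤-refl , refl)) (T^ n)
      -- Both terms are powers T^k with k ≥ 1 and free of X, hence the saving of d'.
      weight-T^Q-T : Weight d' d' 0 T^Q-T
      weight-T^Q-T = weight (supported-weaken (λ { k e (h , refl) → 1≤k⇒ h })
        (supported-⊕ {φ 1} (supported-weaken (λ k e → λ { (h , z) → ℕₚ.≤-trans (ℕₚ.<⇒≤ 1<Q) h , z }) (T^ Q))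
          (supported-⊖ (supported-var {φ 1} (ℕₚ.≤-refl , refl)))))
      -- In the increment, k ≥ 1 and e + k ≤ d' + 1 give e ≤ d' ≤ d' k; powers and sums keep the
      -- weight, so the trace has it as well.
      weight-w : Weight d' 0 0 (B.con (con τ) B.⊕ w)
      weight-w = weight-⊕ (weight (supported-con λ { zero → inj₂ ℕ.z≤n ; (suc e) → inj₁ (coef-con-suc τ e) }))
        (weight-tr q (suc r') (weight (supported-weaken (λ k e → λ { (1≤k , h) → ℕₚ.≤-trans (ℕₚ.≤-reflexive (ℕₚ.+-identityʳ e))
          (ℕₚ.≤-trans (ℕₚ.+-cancelʳ-≤ 1 e d' (ℕₚ.≤-trans (ℕₚ.+-monoʳ-≤ e 1≤k)
            (ℕₚ.≤-trans (ℕₚ.≤-pred (subst (e ℕ.+ k ℕ.<_) len h)) (ℕₚ.≤-reflexive (ℕₚ.+-comm 1 d'))))) (1≤k⇒ 1≤k)) })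
          (supported-increment f))))

    module Expansion (x₀ : Carrier) where
      at-x₀ : Hom 𝕃[x] 𝕃[x]
      at-x₀ = conHom 𝕃 ∘ᴴ evalHom x₀

      ev₂ : Hom 𝕃[x,T] 𝕃[x]
      ev₂ = Eval.evHom at-x₀ (lin x₀)

      module ev₂ = Hom ev₂

      ev₂-con : ∀ p → ev₂.⟦ B.con p ⟧ ≋ con (eval₁ p x₀)
      ev₂-con p = Eval.ev-con at-x₀ (lin x₀) p

      ev₂-T : ev₂.⟦ B.var ⟧ ≋ lin x₀
      ev₂-T = Eval.ev-var at-x₀ (lin x₀)

      ev₂-constant : ∀ a → ev₂.⟦ B.con (con a) ⟧ ≋ con a
      ev₂-constant a = Px.trans (ev₂-con (con a)) (Hom.⟦⟧-cong (conHom 𝕃) (Eval.ev-con (idHom 𝕃) x₀ a))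

      ev₂-X+T : ev₂.⟦ X+T ⟧ ≋ var
      ev₂-X+T = Px.trans (ev₂.+-homo (B.con var) B.var) (Px.trans (Px.+-cong
        (Px.trans (ev₂-con var) (Hom.⟦⟧-cong (conHom 𝕃) (Eval.ev-var (idHom 𝕃) x₀))) ev₂-T)
        (Px.trans (Px.+-comm _ _) (Px.sym (var≋lin x₀))))

      ev-con-var : ∀ p → Eval.ev (conHom 𝕃) var p ≋ p
      ev-con-var []      = Px.refl
      ev-con-var (a ∷ p) = Px.trans (Px.+-congˡ (Px.*-congˡ (ev-con-var p))) (Px.sym (∷-split a p))

      ev₂-shift : ∀ p → ev₂.⟦ shift p ⟧ ≋ p
      ev₂-shift p = Px.trans (eval-natural ev₂ constants X+T (conHom 𝕃) var ev₂-constant ev₂-X+T p) (ev-con-var p)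

      ev₂-increment : ev₂.⟦ increment f ⟧ ⊕ con (eval₁ f x₀) ≋ f
      ev₂-increment = Px.trans (Px.+-congʳ (Px.trans (ev₂.+-homo (shift f) (B.⊖ B.con f)) (Px.+-cong (ev₂-shift f)
          (Px.trans (ev₂.-‿homo (B.con f)) (Px.-‿cong (ev₂-con f))))))
        (Px.trans (Px.+-assoc f _ _) (Px.trans (Px.+-congˡ (Px.-‿inverseˡ _)) (Px.+-identityʳ f)))

      ev₂-τ+w : ev₂.⟦ B.con (con (Tr (eval₁ f x₀))) B.⊕ w ⟧ ≋ trₓ f
      ev₂-τ+w = Px.trans (ev₂.+-homo (B.con (con (Tr (eval₁ f x₀)))) w) (Px.trans (Px.+-comm _ _)
        (Px.trans (Px.+-cong (tr-homo q ev₂ (suc r') (increment f))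
          (Px.trans (ev₂-constant _) (tr-homo q (conHom 𝕃) (suc r') (eval₁ f x₀))))
        (Px.trans (Px.sym (tr-+ (conHom 𝕃) (suc r') ev₂.⟦ increment f ⟧ (con (eval₁ f x₀))))
          (Trace.tr-cong q 𝕃[x] (suc r') ev₂-increment))))

      -- The Q-th power is additive and fixes the constant - x₀, which therefore cancels between (x
      -- - x₀)^Q and x - x₀.
      ev₂-T^Q-T : ev₂.⟦ T^Q-T ⟧ ≋ x^Q-x
      ev₂-T^Q-T = Px.trans (ev₂.+-homo (Pow 𝕃[x,T] B.var Q) (B.⊖ B.var)) (Px.trans (Px.+-cong
          (Px.trans (HomProperties.^-homo ev₂ B.var Q) (Px.trans (Exp.^-congˡ Px.semiring Q ev₂-T)
            (Px.trans (frobenius-q^ (conHom 𝕃) (suc r') var (con (- x₀))) (Px.+-congˡ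
              (Px.trans (Px.sym (HomProperties.^-homo (conHom 𝕃) (- x₀) Q)) (Hom.⟦⟧-cong (conHom 𝕃) (fermat-Q (- x₀))))))))
          (Px.trans (ev₂.-‿homo B.var) (Px.trans (Px.-‿cong ev₂-T) (Px.sym (-‿+-comm var (con (- x₀)))))))
        (Px.trans (interchange _ _ _ _) (Px.trans (Px.+-congˡ (Px.-‿inverseʳ _)) (Px.+-identityʳ _))))
        where
        open RingProperties Px.ring using (-‿+-comm)
        open CommSemigroupProperties Px.+-commutativeSemigroup using (interchange)

      ev₂-monomial₂ : ∀ c → ev₂.⟦ monomial₂ (Tr (eval₁ f x₀)) c ⟧ ≋ monomial c
      ev₂-monomial₂ (i , l , b) = Px.trans (ev₂.*-homo _ _) (Px.*-cong (Px.trans (ev₂.*-homo _ _)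
        (Px.*-cong (power b ev₂-X+T) (power l ev₂-T^Q-T))) (power i ev₂-τ+w))
        where
        power : ∀ n {P y} → ev₂.⟦ P ⟧ ≋ y → ev₂.⟦ Pow 𝕃[x,T] P n ⟧ ≋ Pow 𝕃[x] y n
        power n {P} u = Px.trans (HomProperties.^-homo ev₂ P n) (Exp.^-congˡ Px.semiring n u)

quotient-remainder-unique : ∀ {D b b' x x'} → b ℕ.< D → b' ℕ.< D → b ℕ.+ x ℕ.* D ≡ b' ℕ.+ x' ℕ.* D → b ≡ b' × x ≡ x'
quotient-remainder-unique {D} {b} {b'} {x} {x'} b<D b'<D e = b≡b' , ℕₚ.*-cancelʳ-≡ x x' D (ℕₚ.+-cancelˡ-≡ b _ _ (trans e (cong (ℕ._+ x' ℕ.* D) (sym b≡b'))))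
  where
  instance
    D≢0 : ℕ.NonZero D
    D≢0 = ℕ.>-nonZero (ℕₚ.≤-<-trans ℕ.z≤n b<D)
  b≡b' : b ≡ b'
  b≡b' = trans (sym (DM.m<n⇒m%n≡m b<D)) (trans (sym (DM.[m+kn]%n≡m%n b x D)) (trans (cong (DM._% D) e)
    (trans (DM.[m+kn]%n≡m%n b' x' D) (DM.m<n⇒m%n≡m b'<D))))

-- The equation makes q divide d (i' - i), hence i' - i by coprimality, and i' - i is smaller than
-- q. The assumed order of i and i' makes the difference a natural number.
ordered-residue : ∀ {q d} → Coprime d q → ∀ {i i'} → i ℕ.≤ i' → i' ℕ.< q → ∀ l l' →
  l ℕ.* q ℕ.+ i ℕ.* d ≡ l' ℕ.* q ℕ.+ i' ℕ.* d → i ≡ i'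
ordered-residue {q} {d} cop {i} {i'} i≤i' i'<q l l' e = ℕₚ.≤-antisym i≤i' (ℕₚ.m∸n≡0⇒m≤n
    (small (i' ℕ.∸ i) (ℕₚ.≤-<-trans (ℕₚ.m∸n≤m i' i) i'<q) (coprime-divisor (Coprimality.sym cop) q∣)))
  where
  small : ∀ k → k ℕ.< q → q ∣ k → k ≡ 0
  small zero    _   _ = refl
  small (suc k) k<q c = contradiction (∣.∣⇒≤ c) (ℕₚ.<⇒≱ k<q)
  open +-*-Solver
  q∣ : q ∣ d ℕ.* (i' ℕ.∸ i)
  q∣ = ∣.∣m+n∣m⇒∣n {q} {l' ℕ.* q} (subst (q ∣_) (ℕₚ.+-cancelʳ-≡ (i ℕ.* d) _ _ (trans e
      (trans (cong (λ z → l' ℕ.* q ℕ.+ z ℕ.* d) (sym (ℕₚ.m∸n+n≡m i≤i')))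
        (solve 4 (λ a s t d → a :+ (s :+ t) :* d := (a :+ d :* s) :+ t :* d) refl (l' ℕ.* q) (i' ℕ.∸ i) i d))))
    (∣.n∣m*n l)) (∣.n∣m*n l')

coprime-residue : ∀ {q d} → Coprime d q → ∀ {i i'} → i ℕ.< q → i' ℕ.< q → ∀ l l' →
  l ℕ.* q ℕ.+ i ℕ.* d ≡ l' ℕ.* q ℕ.+ i' ℕ.* d → i ≡ i'
coprime-residue cop {i} {i'} i<q i'<q l l' e with ℕₚ.≤-total i i'
... | inj₁ i≤i' = ordered-residue cop i≤i' i'<q l l' e
... | inj₂ i'≤i = sym (ordered-residue cop i'≤i i<q l' l (sym e))

-- The saving d l from the weight cancels the growth d l allowed in the range of b, so the exponents
-- of X at T^m obey a bound that is the same for all l.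
weight-excludes : ∀ {B d l m a b e} → e ℕ.+ l ℕ.* d ℕ.≤ b ℕ.+ d ℕ.* m → b ℕ.< a → a ℕ.≤ B ℕ.+ d ℕ.* l → e ℕ.< B ℕ.+ d ℕ.* m
weight-excludes {B} {d} {l} {m} {e = e} h b<a a≤B = ℕₚ.+-cancelʳ-< (l ℕ.* d) e _ (ℕₚ.≤-<-trans h (ℕₚ.<-≤-trans
  (ℕₚ.+-monoˡ-< (d ℕ.* m) (ℕₚ.<-≤-trans b<a a≤B))
  (ℕₚ.≤-reflexive (solve 4 (λ B d l m → (B :+ d :* l) :+ d :* m := (B :+ d :* m) :+ l :* d) refl B d l m))))
  where open +-*-Solver

module StepanovBound (F : FiniteField) {p} (pp : Prime p) (char : natMul F p ≡ FiniteField.0# F)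
                     {q r'} (K : Subfield F q) (card : length (FiniteField.elements F) ≡ q ℕ.^ suc r')
                     {d'} (coprime : Coprime (suc d') q) where
  open FieldPolynomials F
  open Bivariate F
  open Polynomial 𝕃
  open Stepanov F pp char {q} {r'} K card
  open CommutativeRing 𝕃 using (Carrier; _+_; _*_; 0#; zeroʳ; semiring)

  D : ℕ
  D = q ℕ.^ r'

  degree : ℕ × ℕ × ℕ → ℕ
  degree (i , l , b) = (b ℕ.* 1 ℕ.+ l ℕ.* Q) ℕ.+ i ℕ.* (D ℕ.* suc d')

  -- The degree is b + (l q + i d) D with b < D. Division by D recovers b, the residue of l q + i d
  -- modulo q recovers i by coprimality, and then l is determined.
  degree-injective : ∀ {i l b i' l' b'} → i ℕ.< q → b ℕ.< D → i' ℕ.< q → b' ℕ.< D →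
    degree (i , l , b) ≡ degree (i' , l' , b') → (i , l , b) ≡ (i' , l' , b')
  degree-injective {i} {l} {b} {i'} {l'} {b'} i< b< i'< b'< e
    with quotient-remainder-unique b< b'< (trans (sym (regroup i l b)) (trans e (regroup i' l' b')))
    where
    open +-*-Solver renaming (con to :con)
    regroup : ∀ i l b → degree (i , l , b) ≡ b ℕ.+ (l ℕ.* q ℕ.+ i ℕ.* suc d') ℕ.* D
    regroup i l b = solve 6 (λ i l b q D d → (b :* :con 1 :+ l :* (q :* D)) :+ i :* (D :* d) := b :+ (l :* q :+ i :* d) :* D)
      refl i l b q D (suc d')
  ... | refl , e' with coprime-residue coprime i< i'< l l' e'
  ...   | refl with ℕₚ.*-cancelʳ-≡ l l' q {{ℕ.>-nonZero (ℕₚ.<-trans (ℕ.s≤s ℕ.z≤n) 1<q)}} (ℕₚ.+-cancelʳ-≡ (i ℕ.* suc d') _ _ e')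
  ...     | refl = refl

  -- The spare Q comes from l ≤ J - 1. It is kept because it pays for the successor in the later
  -- choices of J.
  degree-bound : ∀ {i l b J} → i ℕ.< q → l ℕ.< J → b ℕ.< D → degree (i , l , b) ℕ.+ Q ℕ.≤ (J ℕ.+ suc d') ℕ.* Q
  degree-bound {i} {l} {b} {J} i<q l<J b<D = begin
    degree (i , l , b) ℕ.+ Q
      ≡⟨ solve 6 (λ i l b q D d → ((b :* :con 1 :+ l :* (q :* D)) :+ i :* (D :* d)) :+ q :* D := (:con 1 :+ l) :* (q :* D) :+ (b :+ i :* (D :* d)))
           refl i l b q D (suc d') ⟩
    suc l ℕ.* Q ℕ.+ (b ℕ.+ i ℕ.* (D ℕ.* suc d'))
      ≤⟨ ℕₚ.+-mono-≤ (ℕₚ.*-monoˡ-≤ Q l<J) (ℕₚ.+-monoˡ-≤ _ (ℕₚ.≤-trans (ℕₚ.<⇒≤ b<D) (ℕₚ.m≤m*n D (suc d')))) ⟩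
    J ℕ.* Q ℕ.+ suc i ℕ.* (D ℕ.* suc d')
      ≤⟨ ℕₚ.+-monoʳ-≤ (J ℕ.* Q) (ℕₚ.*-monoˡ-≤ (D ℕ.* suc d') i<q) ⟩
    J ℕ.* Q ℕ.+ q ℕ.* (D ℕ.* suc d')
      ≡⟨ solve 4 (λ J q D d → J :* (q :* D) :+ q :* (D :* d) := (J :+ d) :* (q :* D)) refl J q D (suc d') ⟩
    (J ℕ.+ suc d') ℕ.* Q ∎
    where
    open +-*-Solver renaming (con to :con)
    open ℕₚ.≤-Reasoning

  module _ {f : 𝒫} (len : length f ≡ suc (suc d')) (exf : Exact f (suc d')) where
    open Monomials f

    exact-monomial : ∀ c → Exact (monomial c) (degree c)
    exact-monomial (i , l , b) = exact-⊗ (exact-⊗ (exact-^ b exact-var) (exact-^ l exact-x^Q-x))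
      (exact-^ i (exact-tr r' (ℕ.s≤s ℕ.z≤n) exf))

    -- J and `a` bound the exponents l and b of the unknowns, M is the multiplicity sought, and B₀ +
    -- d' m is the number of exponents of X to be killed at T^m for each value in S. The bound of
    -- `a` by D keeps the degrees of the monomials distinct; the bound by B₀ + d' l keeps higher
    -- exponents of X from occurring at T^m.
    module _ (J M B₀ : ℕ) (a : ℕ → ℕ) (a≤D : ∀ l → l ℕ.< J → a l ℕ.≤ D) (a≤B : ∀ l → l ℕ.< J → a l ℕ.≤ B₀ ℕ.+ d' ℕ.* l)
             (S : List Carrier) where
      columns : List (ℕ × ℕ × ℕ)
      columns = triples (upTo q) a J

      column : Fin (length columns) → ℕ × ℕ × ℕ
      column = lookup columns

      column-bounds : ∀ j → let (i , l , b) = column j in i ℕ.< q × l ℕ.< J × b ℕ.< a l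
      column-bounds j with ∈-triples⁻ (upTo q) a J (∈ₚ.∈-lookup {xs = columns} j)
      ... | i∈ , l< , b< = ∈ₚ.∈-upTo⁻ i∈ , l< , b<

      column-b<D : ∀ j → proj₂ (proj₂ (column j)) ℕ.< D
      column-b<D j with column-bounds j
      ... | _ , l< , b< = ℕₚ.<-≤-trans b< (a≤D _ l<)

      column-degree-injective : ∀ {j k} → degree (column j) ≡ degree (column k) → j ≡ k
      column-degree-injective {j} {k} e = lookup-injective (triples-unique (upTo q) a (Uniqueₚ.upTo⁺ q) J)
        (degree-injective (proj₁ (column-bounds j)) (column-b<D j) (proj₁ (column-bounds k)) (column-b<D k) e)

      rows : List (Carrier × ℕ × ℕ)
      rows = triples S (λ m → B₀ ℕ.+ d' ℕ.* m) M

      entry : Carrier × ℕ × ℕ → Fin (length columns) → Carrier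
      entry (τ , m , e) j = coef₂ (monomial₂ τ (column j)) m e

      module _ (c : Fin (length columns) → Carrier)
               (solves : ∀ i → Sum 𝕃 (λ j → c j * entry (lookup rows i) j) ≡ 0#) where
        R : 𝒫
        R = Sum 𝕃[x] (λ j → con (c j) ⊗ monomial (column j))

        R₂ : Carrier → B.𝒫
        R₂ τ = Sum 𝕃[x,T] (λ j → B.con (con (c j)) B.⊗ monomial₂ τ (column j))

        -- Exponents of X below B₀ + d' m are killed by the linear system; from there on the weights
        -- make every entry zero.
        R₂-vanishes : ∀ {τ} → τ ∈ S → ∀ m → m ℕ.< M → B.coef (R₂ τ) m ≋ []
        R₂-vanishes {τ} τ∈S m m<M = mk λ e → trans (coef₂-sum c (λ j → monomial₂ τ (column j)) m e) (coefficient e)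
          where
          few-rows : ∀ e → e ℕ.< B₀ ℕ.+ d' ℕ.* m → Sum 𝕃 (λ j → c j * entry (τ , m , e) j) ≡ 0#
          few-rows e e< = subst (λ z → Sum 𝕃 (λ j → c j * entry z j) ≡ 0#) (sym (Anyₚ.lookup-index row)) (solves (Anyₗ.index row))
            where row = ∈-triples⁺ S (λ m → B₀ ℕ.+ d' ℕ.* m) M τ∈S m<M e<
          beyond : ∀ e → ¬ (e ℕ.< B₀ ℕ.+ d' ℕ.* m) → Sum 𝕃 (λ j → c j * entry (τ , m , e) j) ≡ 0#
          beyond e e≮ = trans (SRSum.sum-cong-≋ semiring (λ j → trans (cong (c j *_) (vanish j)) (zeroʳ (c j))))
              (SRSum.sum-replicate-zero semiring (length columns))
            where
            vanish : ∀ j → entry (τ , m , e) j ≡ 0#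
            vanish j = Sum⊎.[ (λ z → z) , (λ h → contradiction (weight-excludes {B₀} {d'} {proj₁ (proj₂ (column j))} {m} h (proj₂ (proj₂ (column-bounds j)))
                (a≤B _ (proj₁ (proj₂ (column-bounds j))))) e≮) ]′
              (at₂ (Weight.supported (weight-monomial₂ {d'} len τ (proj₁ (column j)) (proj₁ (proj₂ (column j))) (proj₂ (proj₂ (column j))))) m e)
          coefficient : ∀ e → Sum 𝕃 (λ j → c j * entry (τ , m , e) j) ≡ 0#
          coefficient e = Sum⊎.[ few-rows e , beyond e ]′ (toSum (e ℕ.<? B₀ ℕ.+ d' ℕ.* m))

        -- Specialising X to the point and T to the distance from it sends `R₂` at the trace value
        -- of that point to R itself, for the same coefficients c; the lost T-coefficients become
        -- the factor of order M.
        R-multiplicity : ∀ x → Tr (eval₁ f x) ∈ S → Pow 𝕃[x] (lin x) M Divides R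
        R-multiplicity x τ∈S = proj₁ dropped , Px.trans (Px.sym ev₂-R) (proj₂ dropped)
          where
          open Expansion x
          dropped = Eval.ev-drop at-x₀ (lin x) M (R₂ (Tr (eval₁ f x))) (R₂-vanishes τ∈S)
          ev₂-R : ev₂.⟦ R₂ (Tr (eval₁ f x)) ⟧ ≋ R
          ev₂-R = Px.trans (HomProperties.sum-homo ev₂ (λ j → B.con (con (c j)) B.⊗ monomial₂ (Tr (eval₁ f x)) (column j)))
            (SRSum.sum-cong-≋ Px.semiring (λ j → Px.trans (ev₂.*-homo _ _) (Px.*-cong (ev₂-constant (c j)) (ev₂-monomial₂ (column j)))))

      stepanov : length S ℕ.* sum< M (λ m → B₀ ℕ.+ d' ℕ.* m) ℕ.< q ℕ.* sum< J a →
        ∀ xs → Unique xs → All (λ x → Tr (eval₁ f x) ∈ S) xs → M ℕ.* length xs ℕ.+ Q ℕ.≤ (J ℕ.+ suc d') ℕ.* Q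
      stepanov few xs u zs = conclude (nontrivial-solution fewer (λ i j → entry (lookup rows i) j))
        where
        fewer : length rows ℕ.< length columns
        fewer = subst₂ ℕ._<_ (sym (length-triples S _ M)) (sym (trans (length-triples (upTo q) a J) (cong (ℕ._* sum< J a) (Listₚ.length-upTo q)))) few
        conclude : (∃ λ (c : Fin (length columns) → Carrier) → (∃ λ j → c j ≢ 0#) × (∀ i → Sum 𝕃 (λ j → c j * entry (lookup rows i) j) ≡ 0#)) →
          M ℕ.* length xs ℕ.+ Q ℕ.≤ (J ℕ.+ suc d') ℕ.* Q
        conclude (c , (j₀ , nz) , solves) = Sum⊎.[ (λ (z , _) → contradiction (z j₀) nz) , (λ (j , ex) →
            ℕₚ.≤-trans (ℕₚ.+-monoˡ-≤ Q (count-zeros M ex xs u (All.map (λ {x} → R-multiplicity c solves x) zs)))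
              (degree-bound (proj₁ (column-bounds j)) (proj₁ (proj₂ (column-bounds j))) (column-b<D j))) ]′
          (exact-combination c (λ j → monomial (column j)) (λ j → degree (column j)) (λ j → exact-monomial (column j)) column-degree-injective)

-- Choice of the parameters

module StepanovArithmetic where
  open import Data.Nat using (_+_; _*_; _∸_; _≤_; _<_; z≤n; s≤s; _≤?_)
  open ℕₚ
  open ≤-Reasoning
  open +-*-Solver

  double-sum : ∀ B d n → 2 * sum< (suc n) (λ m → B + d * m) ≡ suc n * (2 * B + d * n)
  double-sum B d zero    = solve 2 (λ B d → con 2 :* (con 0 :+ (B :+ d :* con 0)) := con 1 :* (con 2 :* B :+ d :* con 0)) refl B d
  double-sum B d (suc n) = trans (*-distribˡ-+ 2 (sum< (suc n) (λ m → B + d * m)) _) (trans (cong (_+ 2 * (B + d * suc n)) (double-sum B d n))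
    (solve 3 (λ B d n → (con 1 :+ n) :* (con 2 :* B :+ d :* n) :+ con 2 :* (B :+ d :* (con 1 :+ n)) :=
      (con 2 :+ n) :* (con 2 :* B :+ d :* (con 1 :+ n))) refl B d n))

  double-sum-≤ : ∀ B d n → 2 * sum< n (λ m → B + d * m) ≤ n * (2 * B + d * n)
  double-sum-≤ B d zero    = z≤n
  double-sum-≤ B d (suc n) = ≤-trans (≤-reflexive (double-sum B d n)) (*-monoʳ-≤ (suc n) (+-monoʳ-≤ (2 * B) (*-monoʳ-≤ d (n≤1+n n))))

  sum-const : ∀ n B → sum< n (λ _ → B) ≡ n * B
  sum-const zero    B = refl
  sum-const (suc n) B = trans (cong (_+ B) (sum-const n B)) (+-comm (n * B) B)

  integer-sqrt : ∀ n → ∃ λ M → M * M ≤ n × n < suc M * suc M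
  integer-sqrt zero = 0 , z≤n , s≤s z≤n
  integer-sqrt (suc n) with integer-sqrt n
  ... | M , l , u with suc M * suc M ≤? suc n
  ...   | yes h = suc M , h , ≤-trans (s≤s u) (s≤s (≤-trans (m≤m+n _ (suc M)) (≤-trans (m≤m+n _ (suc M)) (≤-reflexive
            (solve 1 (λ M → ((con 1 :+ M) :* (con 1 :+ M) :+ (con 1 :+ M)) :+ (con 1 :+ M) := (con 1 :+ M) :+ (con 1 :+ M) :* (con 2 :+ M)) refl M)))))
  ...   | no ¬h = M , m≤n⇒m≤1+n l , ≰⇒> ¬h

  -- Q is at most M² + 2 M, and M ≤ M². This is the origin of the factor 3 in the error, where Q / M
  -- is replaced by 3 M.
  <-sqrt⇒≤3 : ∀ {Q M} → 0 < M → Q < suc M * suc M → Q ≤ 3 * (M * M)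
  <-sqrt⇒≤3 {Q} {M@(suc m)} _ (s≤s h) = begin
    Q                           ≤⟨ h ⟩
    M + M * suc M               ≡⟨ solve 1 (λ M → M :+ M :* (con 1 :+ M) := con 2 :* M :+ M :* M) refl M ⟩
    2 * M + M * M               ≤⟨ +-monoˡ-≤ (M * M) (*-monoʳ-≤ 2 (m≤m*n M M)) ⟩
    2 * (M * M) + M * M         ≡⟨ solve 1 (λ M → con 2 :* (M :* M) :+ M :* M := con 3 :* (M :* M)) refl M ⟩
    3 * (M * M)                 ∎

  module _ {q D M : ℕ} .{{_ : ℕ.NonZero q}} (0<D : 0 < D) (0<M : 0 < M) (M²≤Q : M * M ≤ q * D) (Q< : q * D < suc M * suc M) (d' : ℕ) where
    private
      instance
        M≢0 : ℕ.NonZero M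
        M≢0 = ℕ.>-nonZero 0<M
        D≢0 : ℕ.NonZero D
        D≢0 = ℕ.>-nonZero 0<D

      d μ ρ : ℕ
      d = suc d'
      μ = M DM./ q
      ρ = M DM.% q

      M≡ : M ≡ ρ + μ * q
      M≡ = DM.m≡m%n+[m/n]*n M q

      absorb : ∀ {x y c} → M * x ≤ M * y + c * (q * D) → x ≤ y + c * (3 * M)
      absorb {x} {y} {c} h = *-cancelˡ-≤ M (begin
        M * x                       ≤⟨ h ⟩
        M * y + c * (q * D)         ≤⟨ +-monoʳ-≤ (M * y) (*-monoʳ-≤ c (<-sqrt⇒≤3 0<M Q<)) ⟩
        M * y + c * (3 * (M * M))   ≡⟨ solve 3 (λ M y c → M :* y :+ c :* (con 3 :* (M :* M)) := M :* (y :+ c :* (con 3 :* M))) refl M y c ⟩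
        M * (y + c * (3 * M))       ∎)

    -- There are about M D + d' M² / 2 conditions and (μ + 1 + d) Q unknowns. Since M < (μ + 1) q,
    -- the part (μ + 1) Q covers M D; since M² ≤ Q, the part d Q covers the quadratic term.
    upper-parameters : 1 * sum< M (λ m → D + d' * m) < q * sum< (suc (μ + d)) (λ _ → D)
    upper-parameters = *-cancelˡ-< 2 _ _ (begin-strict
      2 * (1 * sum< M (λ m → D + d' * m)) ≡⟨ cong (2 *_) (*-identityˡ (sum< M (λ m → D + d' * m))) ⟩
      2 * sum< M (λ m → D + d' * m)       ≤⟨ double-sum-≤ D d' M ⟩
      M * (2 * D + d' * M)                ≡⟨ solve 3 (λ M D d → M :* (con 2 :* D :+ d :* M) := con 2 :* (M :* D) :+ d :* (M :* M)) refl M D d' ⟩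
      2 * (M * D) + d' * (M * M)          ≤⟨ +-monoʳ-≤ (2 * (M * D)) (*-monoʳ-≤ d' M²≤Q) ⟩
      2 * (M * D) + d' * (q * D)          <⟨ +-monoˡ-< (d' * (q * D)) (*-monoʳ-< 2 (*-monoˡ-< D M<)) ⟩
      2 * (suc μ * q * D) + d' * (q * D)  ≤⟨ +-monoʳ-≤ (2 * (suc μ * q * D)) (*-monoˡ-≤ (q * D) (≤-trans (n≤1+n d') (m≤m+n d (1 * d)))) ⟩
      2 * (suc μ * q * D) + 2 * d * (q * D) ≡⟨ solve 4 (λ μ q D d → con 2 :* ((con 1 :+ μ) :* q :* D) :+ con 2 :* d :* (q :* D) := con 2 :* (q :* ((con 1 :+ (μ :+ d)) :* D))) refl μ q D d ⟩
      2 * (q * (suc (μ + d) * D))         ≡⟨ cong (λ z → 2 * (q * z)) (sum-const (suc (μ + d)) D) ⟨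
      2 * (q * sum< (suc (μ + d)) (λ _ → D)) ∎)
      where
      M< : M < suc μ * q
      M< = ≤-trans (≤-reflexive (cong suc M≡)) (+-monoˡ-≤ (μ * q) (DM.m%n<n M q))

    -- After the spare Q is removed, M N ≤ (μ + 2 d) Q. Multiplying by q and using μ q ≤ M leaves
    -- the main term M Q and an error 2 q d Q to be divided by M.
    upper-conclusion : ∀ N → M * N + q * D ≤ (suc (μ + d) + d) * (q * D) → q * N ≤ q * D + (q * (2 * d)) * (3 * M)
    upper-conclusion N h = absorb {c = q * (2 * d)} (begin
      M * (q * N)                        ≡⟨ solve 3 (λ M q N → M :* (q :* N) := q :* (M :* N)) refl M q N ⟩
      q * (M * N)                        ≤⟨ *-monoʳ-≤ q (+-cancelʳ-≤ (q * D) _ _ (≤-trans h (≤-reflexive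
        (solve 3 (λ μ d Q → ((con 1 :+ (μ :+ d)) :+ d) :* Q := (μ :+ con 2 :* d) :* Q :+ Q) refl μ d (q * D))))) ⟩
      q * ((μ + 2 * d) * (q * D))        ≡⟨ solve 4 (λ μ d Q q → q :* ((μ :+ con 2 :* d) :* Q) := (μ :* q) :* Q :+ (q :* (con 2 :* d)) :* Q) refl μ d (q * D) q ⟩
      μ * q * (q * D) + q * (2 * d) * (q * D) ≤⟨ +-monoˡ-≤ _ (*-monoˡ-≤ (q * D) (≤-trans (m≤n+m (μ * q) ρ) (≤-reflexive (sym M≡)))) ⟩
      M * (q * D) + q * (2 * d) * (q * D) ∎)

    -- With σ = q - 1 values allowed, the degree bound B₀ + d' l has to grow with l at the rate d' at which the
    -- x-degrees of the Taylor coefficients grow: a bound constant in l would lose a factor √q.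
    module _ (large : q * (4 * d * M) < q * D) {σ} (q≡1+σ : q ≡ suc σ) (2≤q : 2 ≤ q) where
      -- M ∸ μ is σ M / q rounded up, so that J, which equals (M ∸ μ) + d, has a surplus of d for
      -- the quadratic terms. B₀ is chosen so that the growing bound would reach D exactly at l = J.
      J₁ J B₀ : ℕ
      J₁ = (M ∸ μ) + d'
      J  = suc J₁
      B₀ = D ∸ d' * J

      private
        4dM<D : 4 * d * M < D
        4dM<D = *-cancelˡ-< q _ _ large

        μ≤M : μ ≤ M
        μ≤M = ≤-trans (m≤m*n μ q) (≤-trans (m≤n+m (μ * q) ρ) (≤-reflexive (sym M≡)))

        -- Keeping the remainder ρ gives an identity from which both estimates follow: q J₁ ≥ σ M
        -- for the count of unknowns, and q J₁ ≤ σ M + q d for the final bound.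
        qJ₁ : q * J₁ + q ≡ σ * M + (ρ + q * d)
        qJ₁ = +-cancelʳ-≡ (q * μ) _ _ (begin-equality
          (q * ((M ∸ μ) + d') + q) + q * μ ≡⟨ solve 4 (λ q s μ d → (q :* (s :+ d) :+ q) :+ q :* μ := q :* (s :+ μ) :+ q :* (con 1 :+ d)) refl q (M ∸ μ) μ d' ⟩
          q * ((M ∸ μ) + μ) + q * d        ≡⟨ cong (λ z → q * z + q * d) (m∸n+n≡m μ≤M) ⟩
          q * M + q * d                    ≡⟨ cong (λ z → z * M + q * d) q≡1+σ ⟩
          suc σ * M + q * d                ≡⟨ solve 3 (λ σ M x → (con 1 :+ σ) :* M :+ x := σ :* M :+ (M :+ x)) refl σ M (q * d) ⟩
          σ * M + (M + q * d)              ≡⟨ cong (λ z → σ * M + (z + q * d)) M≡ ⟩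
          σ * M + ((ρ + μ * q) + q * d)    ≡⟨ solve 5 (λ s ρ μ q d → s :+ ((ρ :+ μ :* q) :+ q :* d) := (s :+ (ρ :+ q :* d)) :+ q :* μ) refl (σ * M) ρ μ q d ⟩
          (σ * M + (ρ + q * d)) + q * μ    ∎)

        d≤M : d ≤ M
        d≤M = *-cancelˡ-≤ 3 (*-cancelʳ-≤ (3 * d) (3 * M) M (begin
          3 * d * M                 ≤⟨ *-monoˡ-≤ M (*-monoˡ-≤ d {3} {8} (s≤s (s≤s (s≤s z≤n)))) ⟩
          8 * d * M                 ≡⟨ solve 2 (λ d M → con 8 :* d :* M := con 2 :* (con 4 :* d :* M)) refl d M ⟩
          2 * (4 * d * M)           ≤⟨ *-mono-≤ 2≤q (<⇒≤ 4dM<D) ⟩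
          q * D                     ≤⟨ <-sqrt⇒≤3 0<M Q< ⟩
          3 * (M * M)               ≡⟨ *-assoc 3 M M ⟨
          3 * M * M                 ∎))

        2d'J≤D : 2 * (d' * J) ≤ D
        2d'J≤D = begin
          2 * (d' * J)              ≤⟨ *-monoʳ-≤ 2 (*-mono-≤ (n≤1+n d') (≤-trans (≤-reflexive (sym (+-suc (M ∸ μ) d'))) (+-mono-≤ (m∸n≤m M μ) d≤M))) ⟩
          2 * (d * (M + M))         ≡⟨ solve 2 (λ d M → con 2 :* (d :* (M :+ M)) := con 4 :* d :* M) refl d M ⟩
          4 * d * M                 ≤⟨ <⇒≤ 4dM<D ⟩
          D                         ∎

        d'J≤D : d' * J ≤ D
        d'J≤D = ≤-trans (m≤m+n (d' * J) (1 * (d' * J))) 2d'J≤D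

        -- This is what the assumption `large` is for: it makes d' J at most D / 2, so the constant
        -- part of the bound stays at least as large as the part that grows.
        D≤2B₀ : D ≤ 2 * B₀
        D≤2B₀ = +-cancelʳ-≤ (2 * (d' * J)) _ _ (begin
          D + 2 * (d' * J)          ≤⟨ +-monoʳ-≤ D 2d'J≤D ⟩
          D + D                     ≡⟨ solve 1 (λ D → D :+ D := con 2 :* D) refl D ⟩
          2 * D                     ≡⟨ cong (2 *_) (m∸n+n≡m d'J≤D) ⟨
          2 * (B₀ + d' * J)         ≡⟨ *-distribˡ-+ 2 B₀ (d' * J) ⟩
          2 * B₀ + 2 * (d' * J)     ∎)

        σM≤qJ₁ : σ * M ≤ q * J₁
        σM≤qJ₁ = +-cancelʳ-≤ q _ _ (≤-trans (+-monoʳ-≤ (σ * M) (≤-trans (m≤m*n q d) (m≤n+m (q * d) ρ))) (≤-reflexive (sym qJ₁)))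

        -- From q J ≥ q J₁ ≥ σ M one gets q J J₁ ≥ σ² M² / q, and with σ = q - 1 this falls short of
        -- σ M² by less than M². The slopes of conditions and unknowns agree up to this loss.
        qJJ₁ : σ * (M * M) ≤ q * (J * J₁) + M * M
        qJJ₁ = *-cancelˡ-≤ q (begin
          q * (σ * (M * M))                       ≡⟨ cong (_* (σ * (M * M))) q≡1+σ ⟩
          suc σ * (σ * (M * M))                   ≡⟨ solve 2 (λ σ M → (con 1 :+ σ) :* (σ :* (M :* M)) := (σ :* M) :* (σ :* M) :+ σ :* (M :* M)) refl σ M ⟩
          (σ * M) * (σ * M) + σ * (M * M)         ≤⟨ +-mono-≤ (*-mono-≤ σM≤qJ₁ σM≤qJ₁) (*-monoˡ-≤ (M * M) (≤-trans (n≤1+n σ) (≤-reflexive (sym q≡1+σ)))) ⟩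
          (q * J₁) * (q * J₁) + q * (M * M)       ≤⟨ +-monoˡ-≤ (q * (M * M)) (*-monoˡ-≤ (q * J₁) (*-monoʳ-≤ q (n≤1+n J₁))) ⟩
          (q * J) * (q * J₁) + q * (M * M)        ≡⟨ solve 4 (λ q J K M → (q :* J) :* (q :* K) :+ q :* (M :* M) := q :* (q :* (J :* K) :+ M :* M)) refl q J J₁ M ⟩
          q * (q * (J * J₁) + M * M)              ∎)

      lower-≤D : ∀ l → l < J → B₀ + d' * l ≤ D
      lower-≤D l l<J = ≤-trans (+-monoʳ-≤ B₀ (*-monoʳ-≤ d' (<⇒≤ l<J))) (≤-reflexive (m∸n+n≡m d'J≤D))

      -- After doubling, both sides split into a multiple of 2 B₀ and a multiple of d'. The d'-parts
      -- differ by at most d' M²; one more M² provides strictness. The deficit d M² ≤ d Q = q d D is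
      -- at most q d times 2 B₀, which is the surplus built into q J.
      lower-parameters : σ * sum< M (λ m → B₀ + d' * m) < q * sum< J (λ l → B₀ + d' * l)
      lower-parameters = *-cancelˡ-< 2 _ _ (begin-strict
        2 * (σ * sum< M (λ m → B₀ + d' * m))      ≡⟨ solve 2 (λ σ s → con 2 :* (σ :* s) := σ :* (con 2 :* s)) refl σ (sum< M (λ m → B₀ + d' * m)) ⟩
        σ * (2 * sum< M (λ m → B₀ + d' * m))      ≤⟨ *-monoʳ-≤ σ (double-sum-≤ B₀ d' M) ⟩
        σ * (M * (2 * B₀ + d' * M))               ≡⟨ solve 4 (λ σ M B d → σ :* (M :* (con 2 :* B :+ d :* M)) := (σ :* M) :* (con 2 :* B) :+ d :* (σ :* (M :* M))) refl σ M B₀ d' ⟩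
        (σ * M) * (2 * B₀) + d' * (σ * (M * M))   ≤⟨ +-monoʳ-≤ ((σ * M) * (2 * B₀)) (*-monoʳ-≤ d' qJJ₁) ⟩
        (σ * M) * (2 * B₀) + d' * (q * (J * J₁) + M * M) <⟨ m<m+n _ (*-mono-< 0<M 0<M) ⟩
        ((σ * M) * (2 * B₀) + d' * (q * (J * J₁) + M * M)) + M * M
          ≡⟨ solve 4 (λ s d K N → (s :+ d :* (K :+ N)) :+ N := (s :+ (con 1 :+ d) :* N) :+ d :* K) refl ((σ * M) * (2 * B₀)) d' (q * (J * J₁)) (M * M) ⟩
        ((σ * M) * (2 * B₀) + d * (M * M)) + d' * (q * (J * J₁))
          ≤⟨ +-monoˡ-≤ _ (+-monoʳ-≤ ((σ * M) * (2 * B₀)) (≤-trans (*-monoʳ-≤ d M²≤Q) (≤-trans (≤-reflexive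
               (solve 3 (λ d q D → d :* (q :* D) := (q :* d) :* D) refl d q D)) (*-mono-≤ (m≤n+m (q * d) ρ) D≤2B₀)))) ⟩
        ((σ * M) * (2 * B₀) + (ρ + q * d) * (2 * B₀)) + d' * (q * (J * J₁))
          ≡⟨ cong (_+ d' * (q * (J * J₁))) (trans (sym (*-distribʳ-+ (2 * B₀) (σ * M) (ρ + q * d))) (cong (_* (2 * B₀)) (sym qJ₁))) ⟩
        (q * J₁ + q) * (2 * B₀) + d' * (q * (J * J₁))
          ≡⟨ solve 4 (λ q K B d → (q :* K :+ q) :* (con 2 :* B) :+ d :* (q :* ((con 1 :+ K) :* K)) := q :* ((con 1 :+ K) :* (con 2 :* B :+ d :* K))) refl q J₁ B₀ d' ⟩
        q * (J * (2 * B₀ + d' * J₁))              ≡⟨ cong (q *_) (double-sum B₀ d' J₁) ⟨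
        q * (2 * sum< J (λ l → B₀ + d' * l))      ≡⟨ solve 2 (λ q s → q :* (con 2 :* s) := con 2 :* (q :* s)) refl q (sum< J (λ l → B₀ + d' * l)) ⟩
        2 * (q * sum< J (λ l → B₀ + d' * l))      ∎)

      -- The bound on the complement reads q M N' ≤ (σ M + 2 q d) Q. Taking it from q M (N + N') = q
      -- M Q leaves M Q ≤ q M N + 2 q d Q.
      lower-conclusion : ∀ {N N'} → N + N' ≡ q * D → M * N' + q * D ≤ (J + d) * (q * D) →
        q * D ≤ q * N + (q * (2 * d)) * (3 * M)
      lower-conclusion {N} {N'} N+N' h = absorb {c = q * (2 * d)} (+-cancelʳ-≤ (σ * M * (q * D)) _ _ (begin
        M * (q * D) + σ * M * (q * D)             ≡⟨ solve 3 (λ M Q σ → M :* Q :+ σ :* M :* Q := (con 1 :+ σ) :* (M :* Q)) refl M (q * D) σ ⟩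
        suc σ * (M * (q * D))                     ≡⟨ cong₂ (λ x y → x * (M * y)) (sym q≡1+σ) (sym N+N') ⟩
        q * (M * (N + N'))                        ≡⟨ solve 4 (λ q M N N' → q :* (M :* (N :+ N')) := M :* (q :* N) :+ q :* (M :* N')) refl q M N N' ⟩
        M * (q * N) + q * (M * N')                ≤⟨ +-monoʳ-≤ (M * (q * N)) (*-monoʳ-≤ q (+-cancelʳ-≤ (q * D) _ _ (≤-trans h (≤-reflexive
          (solve 3 (λ K d Q → ((con 1 :+ K) :+ d) :* Q := (K :+ d) :* Q :+ Q) refl J₁ d (q * D)))))) ⟩
        M * (q * N) + q * ((J₁ + d) * (q * D))    ≡⟨ cong (M * (q * N) +_) (solve 4 (λ q K d Q → q :* ((K :+ d) :* Q) := (q :* K :+ q :* d) :* Q) refl q J₁ d (q * D)) ⟩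
        M * (q * N) + (q * J₁ + q * d) * (q * D)  ≤⟨ +-monoʳ-≤ (M * (q * N)) (*-monoˡ-≤ (q * D) (+-monoˡ-≤ (q * d) qJ₁≤)) ⟩
        M * (q * N) + ((σ * M + q * d) + q * d) * (q * D)
          ≡⟨ solve 4 (λ a s x Q → a :+ ((s :+ x) :+ x) :* Q := (a :+ con 2 :* x :* Q) :+ s :* Q) refl (M * (q * N)) (σ * M) (q * d) (q * D) ⟩
        (M * (q * N) + 2 * (q * d) * (q * D)) + σ * M * (q * D)
          ≡⟨ cong (λ z → (M * (q * N) + z * (q * D)) + σ * M * (q * D)) (solve 2 (λ q d → con 2 :* (q :* d) := q :* (con 2 :* d)) refl q d) ⟩
        (M * (q * N) + q * (2 * d) * (q * D)) + σ * M * (q * D) ∎))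
        where
        qJ₁≤ : q * J₁ ≤ σ * M + q * d
        qJ₁≤ = +-cancelʳ-≤ q _ _ (≤-trans (≤-reflexive qJ₁) (≤-trans (+-monoʳ-≤ (σ * M) (+-monoˡ-≤ (q * d) (<⇒≤ (DM.m%n<n M q))))
          (≤-reflexive (solve 3 (λ s q x → s :+ (q :+ x) := (s :+ x) :+ q) refl (σ * M) q (q * d)))))

-- Level sets of the trace of a polynomial

length-filter-complement : {A : Set} {P : A → Set} (P? : ∀ x → Dec (P x)) (xs : List A) →
  length (filter P? xs) ℕ.+ length (filter (λ x → ¬? (P? x)) xs) ≡ length xs
length-filter-complement P? []       = refl
length-filter-complement P? (x ∷ xs) with P? x
... | yes _ = cong suc (length-filter-complement P? xs)
... | no  _ = trans (ℕₚ.+-suc _ _) (cong suc (length-filter-complement P? xs))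

module TraceCount (F : FiniteField) {p} (pp : Prime p) (char : natMul F p ≡ FiniteField.0# F)
                  {q r'} (K : Subfield F q) (card : length (FiniteField.elements F) ≡ q ℕ.^ suc r') where
  open FiniteField F using (_≟_; elements; elements-unique)
  open FieldPolynomials F
  open SubfieldProperties F
  open FrobeniusPower F pp char K
  open Polynomial 𝕃
  open Stepanov F pp char {q} {r'} K card
  open CommutativeRing 𝕃 using (Carrier; _+_; ring; semiring; *-identityʳ)
  open Subfield K using (In; elems; elems-unique; elems-card)
  open Exp semiring using (_^_; ^-assocʳ)
  open StepanovArithmetic

  frobenius-q : ∀ x y → (x + y) ^ q ≡ x ^ q + y ^ q
  frobenius-q x y = subst (λ n → (x + y) ^ n ≡ x ^ n + y ^ n) (ℕₚ.*-identityʳ q) (frobenius-q^ (idHom 𝕃) 1 x y)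

  -- Raising to the power q moves each term of the trace to the next one, so (Tr y)^q and Tr y
  -- differ by y^Q - y = 0.
  Tr-In : ∀ y → In (Tr y)
  Tr-In y = fixed⇒In K (RingProperties.+-cancelʳ ring y _ _ (trans (telescope (suc r')) (cong (Tr y +_) (fermat-Q y))))
    where
    open CommSemigroupProperties (CommutativeRing.+-commutativeSemigroup 𝕃) using (xy∙z≈xz∙y)
    telescope : ∀ k → Trace.tr q 𝕃 k y ^ q + y ≡ Trace.tr q 𝕃 k y + y ^ (q ℕ.^ k)
    telescope zero    = cong₂ _+_ (fermat K (Subfield.In-0 K)) (sym (*-identityʳ y))
    telescope (suc k) = trans (cong (_+ y) (frobenius-q _ _)) (trans (xy∙z≈xz∙y _ _ _) (cong₂ _+_ (telescope k)
      (trans (^-assocʳ y (q ℕ.^ k) q) (cong (y ^_) (ℕₚ.*-comm (q ℕ.^ k) q)))))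

  module _ {d'} (coprime : Coprime (suc d') q) {f : 𝒫} (len : length f ≡ suc (suc d')) (exf : Exact f (suc d'))
           {M} (M²≤Q : M ℕ.* M ℕ.≤ Q) (Q< : Q ℕ.< suc M ℕ.* suc M) {c} (c∈K : In c) where
    open StepanovBound F pp char {q} {r'} K card {d'} coprime

    P? : ∀ x → Dec (Tr (eval₁ f x) ≡ c)
    P? x = Tr (eval₁ f x) ≟ c

    level co-level : List Carrier
    level    = filter P? elements
    co-level = filter (λ x → ¬? (P? x)) elements

    others : List Carrier
    others = filter (λ x → ¬? (x ≟ c)) elems

    q≡1+others : q ≡ suc (length others)
    q≡1+others = trans (sym elems-card) (↭ₚ.↭-length (remove-↭ _≟_ elems-unique (In⇒∈ K c∈K)))

    error : ℕ
    error = q ℕ.* (2 ℕ.* suc d') ℕ.* (3 ℕ.* M)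

    private instance
      q≢0 : ℕ.NonZero q
      q≢0 = ℕ.>-nonZero (ℕₚ.<-trans (ℕ.s≤s ℕ.z≤n) 1<q)

    0<D : 0 ℕ.< D
    0<D = ℕ.>-nonZero⁻¹ D {{ℕₚ.m^n≢0 q r'}}

    0<M : 0 ℕ.< M
    0<M = positive M Q<
      where
      positive : ∀ M → Q ℕ.< suc M ℕ.* suc M → 0 ℕ.< M
      positive zero    Q<1 = contradiction Q<1 (ℕₚ.<⇒≯ 1<Q)
      positive (suc M) _   = ℕ.s≤s ℕ.z≤n

    level-upper : q ℕ.* length level ℕ.≤ Q ℕ.+ error
    level-upper = upper-conclusion 0<D 0<M M²≤Q Q< d' (length level)
      (stepanov len exf (suc (M DM./ q ℕ.+ suc d')) M D (λ _ → D) (λ _ _ → ℕₚ.≤-refl) (λ _ _ → ℕₚ.m≤m+n D _) (c ∷ [])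
        (upper-parameters 0<D 0<M M²≤Q Q< d') level (Uniqueₚ.filter⁺ P? elements-unique)
        (All.tabulate (λ m → here (proj₂ (∈ₚ.∈-filter⁻ P? {xs = elements} m)))))

    -- If Q ≤ 4 q d M, the error 6 q d M alone exceeds Q. Otherwise Stepanov's bound applies to the
    -- q - 1 other values: every x outside the level takes one of them because the trace lies in K.
    level-lower : Q ℕ.≤ q ℕ.* length level ℕ.+ error
    level-lower = Sum⊎.[ big , small ]′ (toSum (q ℕ.* (4 ℕ.* suc d' ℕ.* M) ℕ.<? Q))
      where
      open +-*-Solver renaming (con to :con)
      small : ¬ (q ℕ.* (4 ℕ.* suc d' ℕ.* M) ℕ.< Q) → Q ℕ.≤ q ℕ.* length level ℕ.+ error
      small ¬l = ℕₚ.≤-trans (ℕₚ.≮⇒≥ ¬l) (ℕₚ.≤-trans (ℕₚ.*-monoʳ-≤ q (ℕₚ.*-monoˡ-≤ M (ℕₚ.*-monoˡ-≤ (suc d') {4} {6} (ℕ.s≤s (ℕ.s≤s (ℕ.s≤s (ℕ.s≤s ℕ.z≤n)))))))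
        (ℕₚ.≤-trans (ℕₚ.≤-reflexive (solve 3 (λ q d M → q :* (:con 6 :* d :* M) := q :* (:con 2 :* d) :* (:con 3 :* M)) refl q (suc d') M)) (ℕₚ.m≤n+m error _)))
      big : q ℕ.* (4 ℕ.* suc d' ℕ.* M) ℕ.< Q → Q ℕ.≤ q ℕ.* length level ℕ.+ error
      big large = lower-conclusion 0<D 0<M M²≤Q Q< d' large q≡1+others 1<q
        (trans (length-filter-complement P? elements) card)
        (stepanov len exf (J 0<D 0<M M²≤Q Q< d' large q≡1+others 1<q) M (B₀ 0<D 0<M M²≤Q Q< d' large q≡1+others 1<q) _
          (lower-≤D 0<D 0<M M²≤Q Q< d' large q≡1+others 1<q) (λ _ _ → ℕₚ.≤-refl) others
          (lower-parameters 0<D 0<M M²≤Q Q< d' large q≡1+others 1<q) co-level (Uniqueₚ.filter⁺ _ elements-unique)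
          (All.tabulate (λ {x} m → ∈ₚ.∈-filter⁺ (λ x → ¬? (x ≟ c)) (In⇒∈ K (Tr-In _)) (proj₂ (∈ₚ.∈-filter⁻ (λ x → ¬? (P? x)) {xs = elements} m)))))

-- Duality for the trace form

unique-⊆-length : {A : Set} {xs ys : List A} → Unique xs → (∀ {x} → x ∈ xs → x ∈ ys) → length xs ℕ.≤ length ys
unique-⊆-length {xs = []}     _       _   = ℕ.z≤n
unique-⊆-length {xs = x ∷ xs} {ys} (d ∷ u) sub with ∈ₚ.∈-∃++ (sub (here refl))
... | as , bs , refl = ℕₚ.≤-trans (ℕ.s≤s (unique-⊆-length u smaller)) (ℕₚ.≤-reflexive (sym (↭ₚ.↭-length (↭ₚ.shift x as bs))))
  where
  smaller : ∀ {y} → y ∈ xs → y ∈ as ++ bs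
  smaller {y} y∈ with ∈ₚ.∈-++⁻ as (sub (there y∈))
  ... | inj₁ m            = ∈ₚ.∈-++⁺ˡ m
  ... | inj₂ (here refl)  = contradiction refl (All.lookup d y∈)
  ... | inj₂ (there m)    = ∈ₚ.∈-++⁺ʳ as m

unique-⊆-⊇ : {A : Set} (_≟_ : ∀ (x y : A) → Dec (x ≡ y)) {xs ys : List A} → Unique xs → length ys ℕ.≤ length xs →
  (∀ {x} → x ∈ xs → x ∈ ys) → ∀ {y} → y ∈ ys → y ∈ xs
unique-⊆-⊇ _≟_ {xs} {ys} u l sub {y} y∈ with Anyₗ.any? (y ≟_) xs
... | yes m = m
... | no ¬m = contradiction l (ℕₚ.<⇒≱ (unique-⊆-length (Allₚ.¬Any⇒All¬ xs ¬m ∷ u) λ { (here refl) → y∈ ; (there m) → sub m }))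

unique-map : {A B : Set} {g : A → B} {xs : List A} → (∀ {x y} → x ∈ xs → y ∈ xs → g x ≡ g y → x ≡ y) →
  Unique xs → Unique (map g xs)
unique-map inj []      = []
unique-map {g = g} {x ∷ xs} inj (d ∷ u) = Allₚ.map⁺ (All.tabulate (λ m e → All.lookup d m (inj (here refl) (there m) e)))
  ∷ unique-map (λ a b → inj (there a) (there b)) u

filter-singleton : {A : Set} {P : A → Set} (P? : ∀ x → Dec (P x)) {xs : List A} {c : A} → Unique xs → c ∈ xs → P c →
  (∀ {x} → x ∈ xs → P x → x ≡ c) → length (filter P? xs) ≡ 1
filter-singleton P? {xs} {c} u c∈ pc only = ↭ₚ.↭-length (unique-↭ {ys = c ∷ []} (Uniqueₚ.filter⁺ P? u) ([] ∷ [])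
  (λ m → let x∈ , px = ∈ₚ.∈-filter⁻ P? {xs = xs} m in here (only x∈ px))
  (λ { (here refl) → ∈ₚ.∈-filter⁺ P? c∈ pc }))

module _ {A B : Set} {R : A → B → Set} (R? : ∀ x y → Dec (R x y)) where
  count : List B → A → ℕ
  count ys x = length (filter (R? x) ys)

  count-swap : ∀ xs ys → sum (map (count ys) xs) ≡ sum (map (λ y → length (filter (λ x → R? x y) xs)) ys)
  count-swap []       ys = sym (zeros ys)
    where
    zeros : ∀ ys → sum (map (λ _ → 0) ys) ≡ 0
    zeros []       = refl
    zeros (y ∷ ys) = zeros ys
  count-swap (x ∷ xs) ys = trans (cong (count ys x ℕ.+_) (count-swap xs ys)) (sym (split ys))
    where
    c : _ → ℕ
    c y = length (filter (λ x → R? x y) xs)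
    split : ∀ ys → sum (map (λ y → length (filter (λ x → R? x y) (x ∷ xs))) ys) ≡ count ys x ℕ.+ sum (map c ys)
    split []       = refl
    split (y ∷ ys) with R? x y
    ... | yes _ = cong suc (trans (cong (c y ℕ.+_) (split ys)) (x∙yz≈y∙xz (c y) (count ys x) _))
      where open CommSemigroupProperties ℕₚ.+-commutativeSemigroup using (x∙yz≈y∙xz)
    ... | no _  = trans (cong (c y ℕ.+_) (split ys)) (x∙yz≈y∙xz (c y) (count ys x) _)
      where open CommSemigroupProperties ℕₚ.+-commutativeSemigroup using (x∙yz≈y∙xz)

  Null? : ∀ ys x → Dec (All (R x) ys)
  Null? ys x = All.all? (R? x) ys

  -- The sum of q · count over xs, with both sides moved so that no subtraction occurs.
  balanced-count : ∀ q ys xs → (∀ {x} → x ∈ xs → ¬ All (R x) ys → q ℕ.* count ys x ≡ length ys) →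
    let n = length (filter (Null? ys) xs) in
    q ℕ.* sum (map (count ys) xs) ℕ.+ n ℕ.* length ys ≡ q ℕ.* (n ℕ.* length ys) ℕ.+ length xs ℕ.* length ys
  balanced-count q ys []       h = refl
  balanced-count q ys (x ∷ xs) h with Null? ys x
  ... | yes null = trans (cong (λ z → q ℕ.* (z ℕ.+ sum (map (count ys) xs)) ℕ.+ (length ys ℕ.+ n ℕ.* length ys)) (cong length (Listₚ.filter-all (R? x) null)))
      (trans (solve 4 (λ q L s t → q :* (L :+ s) :+ (L :+ t) := (q :* L :+ L) :+ (q :* s :+ t)) refl q (length ys) _ (n ℕ.* length ys))
      (trans (cong (q ℕ.* length ys ℕ.+ length ys ℕ.+_) (balanced-count q ys xs (λ m → h (there m))))
      (solve 4 (λ q L t X → (q :* L :+ L) :+ (q :* t :+ X) := q :* (L :+ t) :+ (L :+ X)) refl q (length ys) (n ℕ.* length ys) (length xs ℕ.* length ys))))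
    where
    open +-*-Solver
    n = length (filter (Null? ys) xs)
  ... | no ¬null = trans (solve 4 (λ q c s t → q :* (c :+ s) :+ t := q :* c :+ (q :* s :+ t)) refl q (count ys x) (sum (map (count ys) xs)) (n ℕ.* length ys))
      (trans (cong₂ ℕ._+_ (h (here refl) ¬null) (balanced-count q ys xs (λ m → h (there m))))
      (solve 3 (λ L t X → L :+ (t :+ X) := t :+ (L :+ X)) refl (length ys) (q ℕ.* (n ℕ.* length ys)) (length xs ℕ.* length ys)))
    where
    open +-*-Solver
    n = length (filter (Null? ys) xs)

sum-map-constant : {A : Set} (h : A → ℕ) (c : ℕ) (xs : List A) → (∀ {x} → x ∈ xs → h x ≡ c) → sum (map h xs) ≡ length xs ℕ.* c
sum-map-constant h c []       e = refl
sum-map-constant h c (x ∷ xs) e = cong₂ ℕ._+_ (e (here refl)) (sum-map-constant h c xs (λ m → e (there m)))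

module Equidistribution (F : FiniteField) {q} (K : Subfield F q) where
  open FiniteField F using (_≟_; _⁻¹; inverseʳ)
  open FieldPolynomials F
  open SubfieldProperties F
  open CommutativeRing 𝕃 using (Carrier; _+_; _*_; -_; 0#; *-assoc; *-comm; *-identityʳ; +-identityʳ; -‿inverseʳ)
  open Subfield K using (In; In-*; In--; In-⁻¹; elems; elems-unique; elems-card)

  -- The domain is left abstract because the argument serves both K-subspaces of L and sets of pairs
  -- (α , β).
  module _ {A : Set} (_⊞_ : A → A → A) (_⊡_ : Carrier → A → A) (⊞-injective : ∀ {x y z} → x ⊞ z ≡ y ⊞ z → x ≡ y)
           {Y : List A} (unique : Unique Y) (⊞-closed : ∀ {x y} → x ∈ Y → y ∈ Y → x ⊞ y ∈ Y)
           (⊡-closed : ∀ {a x} → In a → x ∈ Y → a ⊡ x ∈ Y)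
           (ℓ : A → Carrier) (ℓ-In : ∀ x → In (ℓ x)) (ℓ-⊞ : ∀ x y → ℓ (x ⊞ y) ≡ ℓ x + ℓ y) (ℓ-⊡ : ∀ {a} x → In a → ℓ (a ⊡ x) ≡ a * ℓ x)
           {y₀ : A} (y₀∈Y : y₀ ∈ Y) (ℓy₀≢0 : ℓ y₀ ≢ 0#) where
    private
      translate : Carrier → A → A
      translate c y = y ⊞ ((c * (ℓ y₀ ⁻¹)) ⊡ y₀)

      scalar-In : ∀ {c} → In c → In (c * (ℓ y₀ ⁻¹))
      scalar-In i = In-* i (In-⁻¹ (ℓ-In y₀))

      ℓ-translate : ∀ {c} y → In c → ℓ (translate c y) ≡ ℓ y + c
      ℓ-translate {c} y i = trans (ℓ-⊞ y _) (cong (ℓ y +_) (trans (ℓ-⊡ y₀ (scalar-In i)) (trans (*-assoc c _ _)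
        (trans (cong (c *_) (trans (*-comm _ _) (inverseʳ _ ℓy₀≢0))) (*-identityʳ c)))))

      level : Carrier → List A
      level c = filter (λ y → ℓ y ≟ c) Y

      level-≤ : ∀ {b c e} → In e → b + e ≡ c → length (level b) ℕ.≤ length (level c)
      level-≤ {b} {c} {e} i eq = subst (ℕ._≤ length (level c)) (Listₚ.length-map (translate e) (level b))
        (unique-⊆-length (unique-map (λ _ _ → ⊞-injective) (Uniqueₚ.filter⁺ (λ y → ℓ y ≟ b) unique)) into)
        where
        into : ∀ {x} → x ∈ map (translate e) (level b) → x ∈ level c
        into m with ∈ₚ.∈-map⁻ (translate e) m
        ... | y , y∈ , refl with ∈ₚ.∈-filter⁻ (λ y → ℓ y ≟ b) {xs = Y} y∈
        ...   | y∈Y , refl = ∈ₚ.∈-filter⁺ (λ y → ℓ y ≟ c) (⊞-closed y∈Y (⊡-closed (scalar-In i) y₀∈Y)) (trans (ℓ-translate y i) eq)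

    -- Adding a suitable multiple of y₀ is injective and shifts ℓ by any prescribed element of K.
    -- Hence the q levels have equal size, and together they make up Y.
    equidistributed : ∀ c → In c → q ℕ.* length (filter (λ y → ℓ y ≟ c) Y) ≡ length Y
    equidistributed c c∈K = trans (cong (ℕ._* length (level c)) (sym elems-card))
      (trans (sym (sum-map-constant (λ b → length (level b)) (length (level c)) elems
        (λ {b} m → ℕₚ.≤-antisym (level-≤ {e = c + - b} (Subfield.In-+ K c∈K (In-- (∈⇒In K m))) (shift b c)) (level-≤ {e = b + - c} (Subfield.In-+ K (∈⇒In K m) (In-- c∈K)) (shift c b)))))
      (trans (count-swap (λ b y → ℓ y ≟ b) elems Y)
      (trans (sum-map-constant _ 1 Y (λ {y} _ → filter-singleton (λ b → ℓ y ≟ b) elems-unique (In⇒∈ K (ℓ-In y)) refl (λ _ e → sym e)))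
        (ℕₚ.*-identityʳ (length Y)))))
      where
      shift : ∀ b c → b + (c + - b) ≡ c
      shift b c = trans (x∙yz≈y∙xz b c (- b)) (trans (cong (c +_) (-‿inverseʳ b)) (+-identityʳ c))
        where open CommSemigroupProperties (CommutativeRing.+-commutativeSemigroup 𝕃) using (x∙yz≈y∙xz)

module Duality (F : FiniteField) {p} (pp : Prime p) (char : natMul F p ≡ FiniteField.0# F)
               {q r'} (K : Subfield F q) (card : length (FiniteField.elements F) ≡ q ℕ.^ suc r') where
  open FiniteField F using (_≟_; _⁻¹; inverseʳ; elements; elements-unique; elements-complete)
  open FieldPolynomials F
  open SubfieldProperties F
  open FrobeniusPower F pp char K
  open Stepanov F pp char {q} {r'} K card
  open TraceCount F pp char {q} {r'} K card using (Tr-In)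
  open Equidistribution F K
  open CommutativeRing 𝕃 using (Carrier; _+_; _*_; 0#; *-assoc; *-comm; *-identityʳ; zeroˡ; zeroʳ; distribˡ; distribʳ;
    +-identityˡ; +-identityʳ; ring; semiring; commutativeSemiring)
  open Subfield K using (In; In-0)
  open Exp semiring using (_^_; ^-assocʳ)

  Tr-+ : ∀ x y → Tr (x + y) ≡ Tr x + Tr y
  Tr-+ = tr-+ (idHom 𝕃) (suc r')

  Tr-*ˡ : ∀ {c} y → In c → Tr (c * y) ≡ c * Tr y
  Tr-*ˡ {c} y i = homogeneous (suc r')
    where
    fixed : ∀ k → c ^ (q ℕ.^ k) ≡ c
    fixed zero    = *-identityʳ c
    fixed (suc k) = trans (sym (^-assocʳ c q (q ℕ.^ k))) (trans (cong (_^ (q ℕ.^ k)) (fermat K i)) (fixed k))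
    homogeneous : ∀ k → Trace.tr q 𝕃 k (c * y) ≡ c * Trace.tr q 𝕃 k y
    homogeneous zero    = sym (zeroʳ c)
    homogeneous (suc k) = trans (cong₂ _+_ (homogeneous k) (trans (CExp.^-distrib-* commutativeSemiring c y (q ℕ.^ k)) (cong (_* _) (fixed k))))
      (sym (distribˡ c _ _))

  Tr-0 : Tr 0# ≡ 0#
  Tr-0 = RingProperties.+-cancelˡ ring (Tr 0#) _ _ (trans (sym (Tr-+ 0# 0#)) (trans (cong Tr (+-identityˡ 0#)) (sym (+-identityʳ _))))

  -- As a polynomial the trace has degree Q / q, too small to vanish on all Q elements.
  Tr-nontrivial : ∃ λ y → Tr y ≢ 0#
  Tr-nontrivial with Anyₗ.any? (λ y → ¬? (Tr y ≟ 0#)) elements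
  ... | yes m = Anyₗ.satisfied m
  ... | no ¬m = contradiction (ℕₚ.≤-trans (ℕₚ.≤-reflexive (sym card))
      (count-simple-zeros (exact-tr r' (ℕ.s≤s ℕ.z≤n) exact-var) elements elements-unique (All.tabulate (λ {y} y∈ → root y (vanishes y∈)))))
      (ℕₚ.<⇒≱ (ℕₚ.≤-<-trans (ℕₚ.≤-reflexive (ℕₚ.*-identityʳ _)) (ℕₚ.^-monoʳ-< q 1<q (ℕₚ.n<1+n r'))))
    where
    open Polynomial 𝕃
    vanishes : ∀ {y} → y ∈ elements → Tr y ≡ 0#
    vanishes {y} y∈ with Tr y ≟ 0#
    ... | yes z = z
    ... | no nz = contradiction (Anyₗ.map (λ { refl → nz }) y∈) ¬m
    root : ∀ y → Tr y ≡ 0# → eval₁ (trₓ var) y ≡ 0#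
    root y z = trans (tr-homo q (evalHom y) (suc r') var) (trans (Trace.tr-cong q 𝕃 (suc r') (Eval.ev-var (idHom 𝕃) y)) z)

  Tr-nondegenerate : ∀ {v} → v ≢ 0# → ∃ λ α → Tr (α * v) ≢ 0#
  Tr-nondegenerate {v} nz with Tr-nontrivial
  ... | y , ny = y * (v ⁻¹) , λ e → ny (trans (cong Tr (sym (trans (*-assoc y _ v) (trans (cong (y *_) (trans (*-comm _ v) (inverseʳ v nz))) (*-identityʳ y))))) e)

  -- K-subspaces are held as closed lists instead of through bases: an annihilator is then a filter,
  -- and duality becomes a statement about cardinalities.
  record Space : Set where
    field
      members  : List Carrier
      unique   : Unique members
      0∈       : 0# ∈ members
      +-closed : ∀ {x y} → x ∈ members → y ∈ members → x + y ∈ members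
      *-closed : ∀ {c x} → In c → x ∈ members → c * x ∈ members
  open Space

  orthogonal? : ∀ (W : Space) α → Dec (All (λ w → Tr (α * w) ≡ 0#) (members W))
  orthogonal? W = Null? (λ α w → Tr (α * w) ≟ 0#) (members W)

  perp : Space → Space
  perp W = record
    { members  = filter (orthogonal? W) elements
    ; unique   = Uniqueₚ.filter⁺ (orthogonal? W) elements-unique
    ; 0∈       = ∈-perp (All.tabulate (λ {w} _ → trans (cong Tr (zeroˡ w)) Tr-0))
    ; +-closed = λ {x} {y} m n → ∈-perp (All.zipWith (λ {w} (a , b) →
        trans (cong Tr (distribʳ w x y)) (trans (Tr-+ _ _) (trans (cong₂ _+_ a b) (+-identityˡ 0#)))) (perp-∈ m , perp-∈ n))
    ; *-closed = λ {c} {x} i m → ∈-perp (All.map (λ {w} a →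
        trans (cong Tr (*-assoc c x w)) (trans (Tr-*ˡ (x * w) i) (trans (cong (c *_) a) (zeroʳ c)))) (perp-∈ m)) }
    where
    ∈-perp : ∀ {α} → All (λ w → Tr (α * w) ≡ 0#) (members W) → α ∈ filter (orthogonal? W) elements
    ∈-perp {α} a = ∈ₚ.∈-filter⁺ (orthogonal? W) (elements-complete α) a
    perp-∈ : ∀ {α} → α ∈ filter (orthogonal? W) elements → All (λ w → Tr (α * w) ≡ 0#) (members W)
    perp-∈ m = proj₂ (∈ₚ.∈-filter⁻ (orthogonal? W) {xs = elements} m)

  ∈-perp⁺ : ∀ W {α} → All (λ w → Tr (α * w) ≡ 0#) (members W) → α ∈ members (perp W)
  ∈-perp⁺ W {α} a = ∈ₚ.∈-filter⁺ (orthogonal? W) (elements-complete α) a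

  ∈-perp⁻ : ∀ W {α w} → α ∈ members (perp W) → w ∈ members W → Tr (α * w) ≡ 0#
  ∈-perp⁻ W m w∈ = All.lookup (proj₂ (∈ₚ.∈-filter⁻ (orthogonal? W) {xs = elements} m)) w∈

  ∣_∣ : Space → ℕ
  ∣ W ∣ = length (members W)

  whole-space : Space
  whole-space = record { members = elements ; unique = elements-unique ; 0∈ = elements-complete _
                       ; +-closed = λ _ _ → elements-complete _ ; *-closed = λ _ _ → elements-complete _ }

  form-equidistributed : ∀ (W : Space) v {y₀} → y₀ ∈ members W → Tr (y₀ * v) ≢ 0# → ∀ c → In c →
    q ℕ.* length (filter (λ y → Tr (y * v) ≟ c) (members W)) ≡ ∣ W ∣
  form-equidistributed W v y₀∈ nz c i = equidistributed _+_ _*_ (λ {x} {y} {z} → RingProperties.+-cancelʳ ring z x y)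
    (unique W) (+-closed W) (*-closed W) (λ y → Tr (y * v)) (λ y → Tr-In (y * v))
    (λ x y → trans (cong Tr (distribʳ v x y)) (Tr-+ _ _)) (λ {a} x i → trans (cong Tr (*-assoc a x v)) (Tr-*ˡ _ i)) y₀∈ nz c i

  -- The pairs (α , w) with Tr (α w) = 0 are counted in two ways. For fixed w all α qualify if w = 0
  -- and Q / q otherwise; for fixed α all w qualify if α annihilates W and a fraction 1 / q
  -- otherwise. Comparison gives (q - 1) Q on one side and (q - 1) times the product of the sizes on
  -- the other.
  perp-card : ∀ W → ∣ perp W ∣ ℕ.* ∣ W ∣ ≡ Q
  perp-card W = cancel (count-by-element) (count-by-form)
    where
    R? : ∀ (w α : Carrier) → Dec (Tr (α * w) ≡ 0#)
    R? w α = Tr (α * w) ≟ 0#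
    R'? : ∀ (α w : Carrier) → Dec (Tr (α * w) ≡ 0#)
    R'? α w = Tr (α * w) ≟ 0#
    S S' n : ℕ
    S  = sum (map (count R? elements) (members W))
    S' = sum (map (count R'? (members W)) elements)
    n  = ∣ perp W ∣
    null-0 : length (filter (Null? R? elements) (members W)) ≡ 1
    null-0 = filter-singleton (Null? R? elements) (unique W) (0∈ W) (All.tabulate (λ {α} _ → trans (cong Tr (zeroʳ α)) Tr-0)) only
      where
      only : ∀ {w} → w ∈ members W → All (λ α → Tr (α * w) ≡ 0#) elements → w ≡ 0#
      only {w} _ a with w ≟ 0#
      ... | yes z = z
      ... | no nz = contradiction (All.lookup a (elements-complete (proj₁ (Tr-nondegenerate nz)))) (proj₂ (Tr-nondegenerate nz))
    count-by-element : q ℕ.* S ℕ.+ 1 ℕ.* Q ≡ q ℕ.* (1 ℕ.* Q) ℕ.+ ∣ W ∣ ℕ.* Q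
    count-by-element = subst₂ (λ n L → q ℕ.* S ℕ.+ n ℕ.* L ≡ q ℕ.* (n ℕ.* L) ℕ.+ ∣ W ∣ ℕ.* L) null-0 card
      (balanced-count R? q elements (members W) λ {w} _ ¬a → let α , α∈ , nz = find (Allₚ.¬All⇒Any¬ (R? w) elements ¬a) in
        form-equidistributed whole-space w α∈ nz 0# In-0)
    count-by-form : q ℕ.* S ℕ.+ n ℕ.* ∣ W ∣ ≡ q ℕ.* (n ℕ.* ∣ W ∣) ℕ.+ Q ℕ.* ∣ W ∣
    count-by-form = subst₂ (λ s L → q ℕ.* s ℕ.+ n ℕ.* ∣ W ∣ ≡ q ℕ.* (n ℕ.* ∣ W ∣) ℕ.+ L ℕ.* ∣ W ∣) (count-swap R'? elements (members W)) card
      (balanced-count R'? q (members W) elements λ {α} _ ¬a → let w , w∈ , nz = find (Allₚ.¬All⇒Any¬ (R'? α) (members W) ¬a) in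
        trans (cong (λ l → q ℕ.* length l) (Listₚ.filter-≐ (R'? α) (λ w → Tr (w * α) ≟ 0#) ((λ {w} e → trans (cong Tr (*-comm w α)) e) , (λ {w} e → trans (cong Tr (*-comm α w)) e)) (members W)))
          (form-equidistributed W α w∈ (λ e → nz (trans (cong Tr (*-comm α w)) e)) 0# In-0))
    open +-*-Solver
    cancel : q ℕ.* S ℕ.+ 1 ℕ.* Q ≡ q ℕ.* (1 ℕ.* Q) ℕ.+ ∣ W ∣ ℕ.* Q → q ℕ.* S ℕ.+ n ℕ.* ∣ W ∣ ≡ q ℕ.* (n ℕ.* ∣ W ∣) ℕ.+ Q ℕ.* ∣ W ∣ →
      n ℕ.* ∣ W ∣ ≡ Q
    cancel e₁ e₂ = half q 1<q (ℕₚ.+-cancelʳ-≡ (q ℕ.* S ℕ.+ ∣ W ∣ ℕ.* Q) _ _ (trans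
      (solve 5 (λ q nW Q S WQ → (q :* nW :+ Q) :+ (q :* S :+ WQ) := (q :* nW :+ WQ) :+ (q :* S :+ con 1 :* Q)) refl q (n ℕ.* ∣ W ∣) Q S (∣ W ∣ ℕ.* Q))
      (trans (cong₂ ℕ._+_ (trans (cong (q ℕ.* (n ℕ.* ∣ W ∣) ℕ.+_) (ℕₚ.*-comm ∣ W ∣ Q)) (sym e₂)) e₁)
      (solve 5 (λ q nW Q S WQ → (q :* S :+ nW) :+ (q :* (con 1 :* Q) :+ WQ) := (q :* Q :+ nW) :+ (q :* S :+ WQ)) refl q (n ℕ.* ∣ W ∣) Q S (∣ W ∣ ℕ.* Q)))))
      where
      half : ∀ q → 1 ℕ.< q → ∀ {a b} → q ℕ.* a ℕ.+ b ≡ q ℕ.* b ℕ.+ a → a ≡ b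
      half (suc zero) (ℕ.s≤s ())
      half (suc (suc q)) _ {a} {b} e = ℕₚ.*-cancelˡ-≡ a b (suc q) (ℕₚ.+-cancelʳ-≡ (a ℕ.+ b) _ _ (trans
        (solve 3 (λ q a b → (con 1 :+ q) :* a :+ (a :+ b) := (con 2 :+ q) :* a :+ b) refl q a b) (trans e
        (solve 3 (λ q a b → (con 2 :+ q) :* b :+ a := (con 1 :+ q) :* b :+ (a :+ b)) refl q a b))))

  -- W lies in its double annihilator, and applying `perp-card` twice shows that the two have the
  -- same size.
  ∈-perp-perp : ∀ W {x} → x ∈ members (perp (perp W)) → x ∈ members W
  ∈-perp-perp W = unique-⊆-⊇ _≟_ (unique W) (ℕₚ.≤-reflexive same-card) include
    where
    include : ∀ {w} → w ∈ members W → w ∈ members (perp (perp W))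
    include {w} w∈ = ∈-perp⁺ (perp W) (All.tabulate (λ {α} α∈ → trans (cong Tr (*-comm w α)) (∈-perp⁻ W α∈ w∈)))
    instance
      nonempty : ℕ.NonZero ∣ perp W ∣
      nonempty with members (perp W) | 0∈ (perp W)
      ... | _ ∷ _ | _ = _
    same-card : ∣ perp (perp W) ∣ ≡ ∣ W ∣
    same-card = ℕₚ.*-cancelʳ-≡ _ _ ∣ perp W ∣ (trans (perp-card (perp W)) (trans (sym (perp-card W)) (ℕₚ.*-comm ∣ perp W ∣ ∣ W ∣)))

-- Incidences

coprime-^ : ∀ {d p} e → Coprime d p → Coprime d (p ℕ.^ e)
coprime-^     zero    c (_ , k∣1)       = ∣.∣1⇒≡1 k∣1
coprime-^ {p = p} (suc e) c {k} (k∣d , k∣p*p^e) = coprime-^ e c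
  (k∣d , coprime-divisor (λ (j∣k , j∣p) → c (∣.∣-trans j∣k k∣d , j∣p)) k∣p*p^e)

module Span (F : FiniteField) {q} (K : Subfield F q) where
  open FieldPolynomials F using (𝕃)
  open SubfieldProperties F
  open CommutativeRing 𝕃 using (Carrier; _+_; _*_; -_; 0#; 1#; *-assoc; *-identityˡ; zeroˡ; zeroʳ; distribˡ; distribʳ; +-identityˡ; -‿inverseʳ; ring)
  open Subfield K using (In; In-0; In-1; In-+; In-*; In--; elems; elems-unique; elems-card)
  open RingProperties ring using (-‿distribˡ-*; +-cancelˡ)

  lincomb-+ : ∀ {s} (c c' v : Fin s → Carrier) → lincomb F K c v + lincomb F K c' v ≡ lincomb F K (λ i → c i + c' i) v
  lincomb-+ {zero}  c c' v = +-identityˡ 0#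
  lincomb-+ {suc s} c c' v = trans (interchange _ _ _ _) (cong₂ _+_ (sym (distribʳ _ _ _)) (lincomb-+ (λ i → c (Fin.suc i)) (λ i → c' (Fin.suc i)) (λ i → v (Fin.suc i))))
    where open CommSemigroupProperties (CommutativeRing.+-commutativeSemigroup 𝕃) using (interchange)

  lincomb-* : ∀ {s} a (c v : Fin s → Carrier) → a * lincomb F K c v ≡ lincomb F K (λ i → a * c i) v
  lincomb-* {zero}  a c v = zeroʳ a
  lincomb-* {suc s} a c v = trans (distribˡ a _ _) (cong₂ _+_ (sym (*-assoc a _ _)) (lincomb-* a (λ i → c (Fin.suc i)) (λ i → v (Fin.suc i))))

  lincomb-0 : ∀ {s} (v : Fin s → Carrier) → lincomb F K (λ _ → 0#) v ≡ 0#
  lincomb-0 {zero}  v = refl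
  lincomb-0 {suc s} v = trans (cong₂ _+_ (zeroˡ _) (lincomb-0 (λ i → v (Fin.suc i)))) (+-identityˡ 0#)

  -- The list has one entry per coefficient vector, so its length is q^s by construction; linear
  -- independence excludes repetitions and makes this the size of the subspace.
  span : ∀ {s} → (Fin s → Carrier) → List Carrier
  span {zero}  v = 0# ∷ []
  span {suc s} v = map (λ (c , w) → c * v Fin.zero + w) (cartesianProduct elems (span (λ i → v (Fin.suc i))))

  length-span : ∀ {s} (v : Fin s → Carrier) → length (span v) ≡ q ℕ.^ s
  length-span {zero}  v = refl
  length-span {suc s} v = trans (Listₚ.length-map _ (cartesianProduct elems _)) (trans (length-cartesianProductWith _,_ elems _)
    (cong₂ ℕ._*_ elems-card (length-span (λ i → v (Fin.suc i)))))

  ∈-span⁺ : ∀ {s} (v c : Fin s → Carrier) → (∀ i → In (c i)) → lincomb F K c v ∈ span v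
  ∈-span⁺ {zero}  v c i = here refl
  ∈-span⁺ {suc s} v c i = ∈ₚ.∈-map⁺ _ (∈ₚ.∈-cartesianProduct⁺ (In⇒∈ K (i Fin.zero)) (∈-span⁺ (λ j → v (Fin.suc j)) (λ j → c (Fin.suc j)) (λ j → i (Fin.suc j))))

  extend : ∀ {s} → Carrier → (Fin s → Carrier) → Fin (suc s) → Carrier
  extend a c Fin.zero    = a
  extend a c (Fin.suc i) = c i

  extend-In : ∀ {s a} {c : Fin s → Carrier} → In a → (∀ i → In (c i)) → ∀ i → In (extend a c i)
  extend-In h i Fin.zero    = h
  extend-In h i (Fin.suc j) = i j

  ∈-span⁻ : ∀ {s} (v : Fin s → Carrier) {w} → w ∈ span v → Σ (Fin s → Carrier) λ c → (∀ i → In (c i)) × w ≡ lincomb F K c v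
  ∈-span⁻ {zero}  v (here refl) = (λ ()) , (λ ()) , refl
  ∈-span⁻ {suc s} v m with ∈ₚ.∈-map⁻ _ m
  ... | (a , w) , aw∈ , refl with ∈ₚ.∈-cartesianProduct⁻ elems (span (λ i → v (Fin.suc i))) aw∈
  ...   | a∈ , w∈ with ∈-span⁻ (λ i → v (Fin.suc i)) w∈
  ...     | c , c∈ , refl = extend a c , extend-In (∈⇒In K a∈) c∈ , refl

  span-unique : ∀ {s} (v : Fin s → Carrier) → KLinIndep F K v → Unique (span v)
  span-unique {zero}  v ind = [] ∷ []
  span-unique {suc s} v ind = unique-map injective (Uniqueₚ.cartesianProduct⁺ elems-unique (span-unique v' ind'))
    where
    v' : Fin s → Carrier
    v' i = v (Fin.suc i)
    ind' : KLinIndep F K v'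
    ind' c c∈ e i = ind (extend 0# c) (extend-In In-0 c∈) (trans (cong₂ _+_ (zeroˡ _) e) (+-identityˡ 0#)) (Fin.suc i)
    injective : ∀ {x y} → x ∈ cartesianProduct elems (span v') → y ∈ cartesianProduct elems (span v') →
      proj₁ x * v Fin.zero + proj₂ x ≡ proj₁ y * v Fin.zero + proj₂ y → x ≡ y
    injective {a , w} {b , z} x∈ y∈ e
      with ∈ₚ.∈-cartesianProduct⁻ elems (span v') x∈ | ∈ₚ.∈-cartesianProduct⁻ elems (span v') y∈
    ... | a∈ , w∈ | b∈ , z∈ with ∈-span⁻ v' w∈ | ∈-span⁻ v' z∈
    ... | c , c∈ , refl | c' , c'∈ , refl = cong₂ _,_ a≡b (+-cancelˡ (a * v Fin.zero) _ _ (trans e (cong (λ t → t * v Fin.zero + lincomb F K c' v') (sym a≡b))))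
      where
      minus : ∀ x → (- 1#) * x ≡ - x
      minus x = trans (sym (-‿distribˡ-* 1# x)) (cong -_ (*-identityˡ x))
      γ : Fin (suc s) → Carrier
      γ i = extend a c i + (- 1#) * extend b c' i
      γ-In : ∀ i → In (γ i)
      γ-In i = In-+ (extend-In (∈⇒In K a∈) c∈ i) (In-* (In-- In-1) (extend-In (∈⇒In K b∈) c'∈ i))
      γ-zero : lincomb F K γ v ≡ 0#
      γ-zero = trans (sym (trans (cong (lincomb F K (extend a c) v +_) (lincomb-* (- 1#) (extend b c') v)) (lincomb-+ (extend a c) (λ i → (- 1#) * extend b c' i) v)))
        (trans (cong₂ _+_ e (minus _)) (-‿inverseʳ _))
      a≡b : a ≡ b
      a≡b = x-y≡0⇒x≡y (trans (cong (a +_) (sym (minus b))) (ind γ γ-In γ-zero Fin.zero))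

filter-length-≐ : {A : Set} {P P' : A → Set} (P? : ∀ x → Dec (P x)) (P'? : ∀ x → Dec (P' x)) → (∀ {x} → P x → P' x) → (∀ {x} → P' x → P x) →
  ∀ xs → length (filter P? xs) ≡ length (filter P'? xs)
filter-length-≐ P? P'? f g xs = cong length (Listₚ.filter-≐ P? P'? (f , g) xs)

neg-square : ∀ n → (ℤ.- ℤ.+ n) ℤ.* (ℤ.- ℤ.+ n) ≡ ℤ.+ (n ℕ.* n)
neg-square zero    = refl
neg-square (suc n) = refl

square-difference : ∀ {X Z W} → X ℕ.≤ Z ℕ.+ W → Z ℕ.≤ X ℕ.+ W → (ℤ.+ X ℤ.- ℤ.+ Z) ℤ.* (ℤ.+ X ℤ.- ℤ.+ Z) ℤ.≤ ℤ.+ (W ℕ.* W)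
square-difference {X} {Z} {W} h₁ h₂ rewrite ℤₚ.m-n≡m⊖n X Z with ℕₚ.≤-total Z X
... | inj₁ Z≤X rewrite ℤₚ.⊖-≥ Z≤X | sym (ℤₚ.pos-* (X ℕ.∸ Z) (X ℕ.∸ Z)) = ℤ.+≤+ (ℕₚ.*-mono-≤ small small)
  where small = ℕₚ.m≤n+o⇒m∸n≤o X Z h₁
... | inj₂ X≤Z rewrite ℤₚ.⊖-≤ X≤Z | neg-square (Z ℕ.∸ X) = ℤ.+≤+ (ℕₚ.*-mono-≤ small small)
  where small = ℕₚ.m≤n+o⇒m∸n≤o Z X h₂

-- Averaging over the pairs

module FinalArithmetic where
  open import Data.Nat using (_+_; _*_; _≤_; _<_; z≤n; s≤s)
  open ℕₚ
  open ≤-Reasoning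
  open +-*-Solver

  sum-bounds : {A : Set} (q Q E : ℕ) (h : A → ℕ) (ys : List A) → (∀ {y} → y ∈ ys → q * h y ≤ Q + E × Q ≤ q * h y + E) →
    q * sum (map h ys) ≤ length ys * (Q + E) × length ys * Q ≤ q * sum (map h ys) + length ys * E
  sum-bounds q Q E h []       b = ≤-trans (≤-reflexive (*-zeroʳ q)) z≤n , z≤n
  sum-bounds q Q E h (y ∷ ys) b with b (here refl) | sum-bounds q Q E h ys (λ m → b (there m))
  ... | u , l | us , ls = ≤-trans (≤-reflexive (*-distribˡ-+ q (h y) _)) (+-mono-≤ u us) , ≤-trans (+-mono-≤ l ls) (≤-reflexive
      (solve 5 (λ q a s E L → (q :* a :+ E) :+ (q :* s :+ L) := q :* (a :+ s) :+ (E :+ L)) refl q (h y) (sum (map h ys)) E (length ys * E)))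

  -- L is the number of pairs (α , β); the zero pair contributes Q and the L' others contribute S'.
  -- In `balance` each of the N incident points meets all L pairs, and each of the Q - N others
  -- meets L / q of them.
  module _ {q Q N L' S' E : ℕ} (balance : q * (Q + S') + N * suc L' ≡ q * (N * suc L') + Q * suc L') where
    private
      L : ℕ
      L = suc L'

    -- Free of subtraction, this says (q - 1) N L ≤ (q - 1) Q + L E.
    rest-upper : q * S' ≤ L' * (Q + E) → q * (N * L) + Q ≤ N * L + q * Q + L * E
    rest-upper h = +-cancelʳ-≤ (Q * L') _ _ (begin
      q * (N * L) + Q + Q * L'            ≡⟨ solve 3 (λ a Q L → (a :+ Q) :+ Q :* L := a :+ Q :* (con 1 :+ L)) refl (q * (N * L)) Q L' ⟩
      q * (N * L) + Q * L                 ≡⟨ balance ⟨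
      q * (Q + S') + N * L                ≡⟨ solve 4 (λ q Q S a → q :* (Q :+ S) :+ a := a :+ q :* Q :+ q :* S) refl q Q S' (N * L) ⟩
      N * L + q * Q + q * S'              ≤⟨ +-monoʳ-≤ (N * L + q * Q) h ⟩
      N * L + q * Q + L' * (Q + E)        ≤⟨ +-monoʳ-≤ (N * L + q * Q) (m≤n+m (L' * (Q + E)) E) ⟩
      N * L + q * Q + (E + L' * (Q + E))  ≡⟨ solve 4 (λ a E L Q → a :+ (E :+ L :* (Q :+ E)) := a :+ (con 1 :+ L) :* E :+ Q :* L) refl (N * L + q * Q) E L' Q ⟩
      N * L + q * Q + L * E + Q * L'      ∎)

    rest-lower : L' * Q ≤ q * S' + L' * E → q * Q + N * L ≤ q * (N * L) + Q + L * E
    rest-lower h = +-cancelʳ-≤ (L' * Q) _ _ (begin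
      q * Q + N * L + L' * Q                ≤⟨ +-monoʳ-≤ (q * Q + N * L) h ⟩
      q * Q + N * L + (q * S' + L' * E)     ≡⟨ solve 5 (λ q Q a S e → q :* Q :+ a :+ (q :* S :+ e) := q :* (Q :+ S) :+ a :+ e) refl q Q (N * L) S' (L' * E) ⟩
      q * (Q + S') + N * L + L' * E         ≡⟨ cong (_+ L' * E) balance ⟩
      q * (N * L) + Q * L + L' * E          ≤⟨ +-monoʳ-≤ (q * (N * L) + Q * L) (m≤n+m (L' * E) E) ⟩
      q * (N * L) + Q * L + (E + L' * E)    ≡⟨ solve 4 (λ a Q L E → a :+ Q :* (con 1 :+ L) :+ (E :+ L :* E) := a :+ Q :+ (con 1 :+ L) :* E :+ L :* Q) refl (q * (N * L)) Q L' E ⟩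
      q * (N * L) + Q + L * E + L' * Q      ∎)

  -- Scaling by Z, where L Z = Q², and dividing by Q (q - 1).
  module _ {q Q N L Z d M : ℕ} (1<q : 1 < q) (0<Q : 0 < Q) (LZ≡Q² : L * Z ≡ Q * Q) where
    private
      E : ℕ
      E = q * (2 * d) * (3 * M)

      -- The hypothesis amounts to (q - 1) x ≤ (q - 1) y + 6 q d M L, and q ≤ 2 (q - 1) doubles the
      -- 6 to 12.
      scaled : ∀ q → 1 < q → ∀ {x y} → q * x + y ≤ x + q * y + L * (q * (2 * d) * (3 * M)) → x ≤ y + L * (12 * d * M)
      scaled (suc zero)    (s≤s ())
      scaled (suc (suc σ)) _ {x} {y} h = *-cancelˡ-≤ (suc σ) (+-cancelʳ-≤ (x + y) _ _ (begin
        suc σ * x + (x + y)                                ≡⟨ solve 3 (λ σ x y → (con 1 :+ σ) :* x :+ (x :+ y) := (con 2 :+ σ) :* x :+ y) refl σ x y ⟩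
        suc (suc σ) * x + y                                ≤⟨ h ⟩
        x + suc (suc σ) * y + L * (suc (suc σ) * (2 * d) * (3 * M))
          ≤⟨ +-monoʳ-≤ (x + suc (suc σ) * y) (*-monoʳ-≤ L (*-monoˡ-≤ (3 * M) (*-monoˡ-≤ (2 * d) (≤-trans (m≤m+n (2 + σ) σ)
               (≤-reflexive (solve 1 (λ σ → con 2 :+ σ :+ σ := con 2 :* (con 1 :+ σ)) refl σ)))))) ⟩
        x + suc (suc σ) * y + L * (2 * suc σ * (2 * d) * (3 * M))
          ≡⟨ solve 6 (λ x y σ L d M → x :+ (con 2 :+ σ) :* y :+ L :* (con 2 :* (con 1 :+ σ) :* (con 2 :* d) :* (con 3 :* M)) :=
               (con 1 :+ σ) :* (y :+ L :* (con 12 :* d :* M)) :+ (x :+ y)) refl x y σ L d M ⟩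
        suc σ * (y + L * (12 * d * M)) + (x + y)           ∎))

      instance
        Q≢0 : ℕ.NonZero Q
        Q≢0 = ℕ.>-nonZero 0<Q

      NLZ : ∀ N → N * L * Z ≡ Q * (Q * N)
      NLZ N = trans (*-assoc N L Z) (trans (cong (N *_) LZ≡Q²) (solve 2 (λ N Q → N :* (Q :* Q) := Q :* (Q :* N)) refl N Q))

      LZ : ∀ x → L * x * Z ≡ Q * (x * Q)
      LZ x = trans (solve 3 (λ L x Z → L :* x :* Z := x :* (L :* Z)) refl L x Z) (trans (cong (x *_) LZ≡Q²)
        (solve 2 (λ x Q → x :* (Q :* Q) := Q :* (x :* Q)) refl x Q))

    conclude-upper : q * (N * L) + Q ≤ N * L + q * Q + L * E → Q * N ≤ Z + 12 * d * M * Q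
    conclude-upper h = *-cancelˡ-≤ Q (begin
      Q * (Q * N)                           ≡⟨ NLZ N ⟨
      N * L * Z                             ≤⟨ *-monoˡ-≤ Z (scaled q 1<q h) ⟩
      (Q + L * (12 * d * M)) * Z            ≡⟨ *-distribʳ-+ Z Q _ ⟩
      Q * Z + L * (12 * d * M) * Z          ≡⟨ cong (Q * Z +_) (LZ (12 * d * M)) ⟩
      Q * Z + Q * (12 * d * M * Q)          ≡⟨ *-distribˡ-+ Q Z _ ⟨
      Q * (Z + 12 * d * M * Q)              ∎)

    conclude-lower : q * Q + N * L ≤ q * (N * L) + Q + L * E → Z ≤ Q * N + 12 * d * M * Q
    conclude-lower h = *-cancelˡ-≤ Q (begin
      Q * Z                                 ≤⟨ *-monoˡ-≤ Z (scaled q 1<q (≤-trans h (≤-reflexive (cong (_+ L * E) (+-comm (q * (N * L)) Q))))) ⟩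
      (N * L + L * (12 * d * M)) * Z        ≡⟨ *-distribʳ-+ Z (N * L) _ ⟩
      N * L * Z + L * (12 * d * M) * Z      ≡⟨ cong₂ _+_ (NLZ N) (LZ (12 * d * M)) ⟩
      Q * (Q * N) + Q * (12 * d * M * Q)    ≡⟨ *-distribˡ-+ Q (Q * N) _ ⟨
      Q * (Q * N + 12 * d * M * Q)          ∎)

module Incidence (F : FiniteField) {p} (pp : Prime p) (char : natMul F p ≡ FiniteField.0# F)
                 {q r'} (K : Subfield F q) (card : length (FiniteField.elements F) ≡ q ℕ.^ suc r')
                 {d''} (coprime-p : Coprime (suc (suc d'')) p) (f : Poly F (suc (suc d'')))
                 {s m} (A : AffineSubspace F K s) (B : AffineSubspace F K m) where
  open FiniteField F using (_≟_; elements; elements-unique; elements-complete)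
  open FieldPolynomials F
  open SubfieldProperties F
  open Stepanov F pp char {q} {r'} K card
  open TraceCount F pp char {q} {r'} K card
  open Duality F pp char {q} {r'} K card
  open Span F K
  open Equidistribution F K
  open CommutativeRing 𝕃 using (Carrier; _+_; _*_; -_; 0#; *-assoc; *-comm; *-identityʳ; zeroˡ; zeroʳ; distribˡ; distribʳ;
    +-identityˡ; +-identityʳ; -‿inverseˡ; -‿inverseʳ; +-assoc; ring; commutativeSemiring)
  open Subfield K using (In; In-0; In-+; In-*)
  open Polynomial 𝕃 using (𝒫; coef)
  open Space
  open FinalArithmetic

  private
    d : ℕ
    d = suc (suc d'')

    module A = AffineSubspace A
    module B = AffineSubspace B

    coprime-q : Coprime d q
    coprime-q with order-prime-power K pp char
    ... | e , refl = coprime-^ e coprime-p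

    a₀ b₀ : Carrier
    a₀ = A.base
    b₀ = B.base

    fv : Carrier → Carrier
    fv = Poly.eval f

    spanSpace : ∀ {s} (v : Fin s → Carrier) → KLinIndep F K v → Space
    spanSpace v ind = record
      { members = span v
      ; unique = span-unique v ind
      ; 0∈ = subst (_∈ span v) (lincomb-0 v) (∈-span⁺ v (λ _ → 0#) (λ _ → In-0))
      ; +-closed = λ x∈ y∈ → sum-closed (∈-span⁻ v x∈) (∈-span⁻ v y∈)
      ; *-closed = λ i x∈ → scale-closed i (∈-span⁻ v x∈) }
      where
      InSpan : Carrier → Set
      InSpan x = Σ _ λ c → (∀ i → In (c i)) × x ≡ lincomb F K c v
      sum-closed : ∀ {x y} → InSpan x → InSpan y → x + y ∈ span v
      sum-closed (c , i , refl) (c' , i' , refl) = subst (_∈ span v) (sym (lincomb-+ c c' v)) (∈-span⁺ v _ (λ j → In-+ (i j) (i' j)))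
      scale-closed : ∀ {a x} → In a → InSpan x → a * x ∈ span v
      scale-closed {a} h (c , i , refl) = subst (_∈ span v) (sym (lincomb-* a c v)) (∈-span⁺ v _ (λ j → In-* h (i j)))

    W_A W_B P_A P_B : Space
    W_A = spanSpace A.dirs A.indep
    W_B = spanSpace B.dirs B.indep
    P_A = perp W_A
    P_B = perp W_B

    cancel-base : ∀ {u b} → b + (u + - b) ≡ u
    cancel-base {u} {b} = trans (x∙yz≈y∙xz b u (- b)) (trans (cong (u +_) (-‿inverseʳ b)) (+-identityʳ u))
      where open CommSemigroupProperties (CommutativeRing.+-commutativeSemigroup 𝕃) using (x∙yz≈y∙xz)

    affine⇒span : ∀ {n} (S : AffineSubspace F K n) {u} → AffineSubspace._∈A S u → u + - AffineSubspace.base S ∈ span (AffineSubspace.dirs S)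
    affine⇒span S (c , i , refl) = subst (_∈ span (AffineSubspace.dirs S)) (sym (trans (xy∙z≈y∙xz _ _ _)
      (trans (cong (lincomb F K c (AffineSubspace.dirs S) +_) (-‿inverseʳ _)) (+-identityʳ _)))) (∈-span⁺ (AffineSubspace.dirs S) c i)
      where open CommSemigroupProperties (CommutativeRing.+-commutativeSemigroup 𝕃) using (xy∙z≈y∙xz)

    span⇒affine : ∀ {n} (S : AffineSubspace F K n) {u} → u + - AffineSubspace.base S ∈ span (AffineSubspace.dirs S) → AffineSubspace._∈A S u
    span⇒affine S {u} h with ∈-span⁻ (AffineSubspace.dirs S) h
    ... | c , i , e = c , i , trans (sym cancel-base) (cong (AffineSubspace.base S +_) e)

    Pair : Set
    Pair = Carrier × Carrier

    Y : List Pair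
    Y = cartesianProduct (members P_A) (members P_B)

    Y-unique : Unique Y
    Y-unique = Uniqueₚ.cartesianProduct⁺ (unique P_A) (unique P_B)

    argument : Carrier → Pair → Carrier
    argument u (α , β) = α * (u + - a₀) + β * (fv u + - b₀)

    R? : ∀ u y → Dec (Tr (argument u y) ≡ 0#)
    R? u y = Tr (argument u y) ≟ 0#

    _⊞_ : Pair → Pair → Pair
    (α , β) ⊞ (α' , β') = α + α' , β + β'

    _⊡_ : Carrier → Pair → Pair
    c ⊡ (α , β) = c * α , c * β

    balanced : ∀ u → ¬ All (λ y → Tr (argument u y) ≡ 0#) Y → q ℕ.* count R? Y u ≡ length Y
    balanced u ¬null with find (Allₚ.¬All⇒Any¬ (R? u) Y ¬null)
    ... | y₀ , y₀∈ , nz = equidistributed _⊞_ _⊡_ ⊞-injective Y-unique ⊞-closed ⊡-closed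
        (λ y → Tr (argument u y)) (λ y → Tr-In (argument u y)) form-⊞ form-⊡ y₀∈ nz 0# In-0
      where
      open RingProperties ring using (+-cancelʳ)
      open CommSemigroupProperties (CommutativeRing.+-commutativeSemigroup 𝕃) using (interchange)
      ⊞-injective : ∀ {x y z} → x ⊞ z ≡ y ⊞ z → x ≡ y
      ⊞-injective e = cong₂ _,_ (+-cancelʳ _ _ _ (cong proj₁ e)) (+-cancelʳ _ _ _ (cong proj₂ e))
      ⊞-closed : ∀ {x y} → x ∈ Y → y ∈ Y → x ⊞ y ∈ Y
      ⊞-closed x∈ y∈ with ∈ₚ.∈-cartesianProduct⁻ (members P_A) (members P_B) x∈ | ∈ₚ.∈-cartesianProduct⁻ (members P_A) (members P_B) y∈
      ... | a , b | a' , b' = ∈ₚ.∈-cartesianProduct⁺ (+-closed P_A a a') (+-closed P_B b b')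
      ⊡-closed : ∀ {c x} → In c → x ∈ Y → c ⊡ x ∈ Y
      ⊡-closed i x∈ with ∈ₚ.∈-cartesianProduct⁻ (members P_A) (members P_B) x∈
      ... | a , b = ∈ₚ.∈-cartesianProduct⁺ (*-closed P_A i a) (*-closed P_B i b)
      form-⊞ : ∀ x y → Tr (argument u (x ⊞ y)) ≡ Tr (argument u x) + Tr (argument u y)
      form-⊞ x y = trans (cong Tr (trans (cong₂ _+_ (distribʳ _ _ _) (distribʳ _ _ _)) (interchange _ _ _ _))) (Tr-+ (argument u x) (argument u y))
      form-⊡ : ∀ {c} x → In c → Tr (argument u (c ⊡ x)) ≡ c * Tr (argument u x)
      form-⊡ {c} x i = trans (cong Tr (trans (cong₂ _+_ (*-assoc c _ _) (*-assoc c _ _)) (sym (distribˡ c _ _)))) (Tr-*ˡ (argument u x) i)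

    -- Pairs with β = 0 put u - a₀ into the double annihilator of the directions of A, and pairs
    -- with α = 0 do the same for f u - b₀ and B.
    null⇒incident : ∀ {u} → All (λ y → Tr (argument u y) ≡ 0#) Y → A._∈A u × B._∈A (fv u)
    null⇒incident {u} null =
      span⇒affine A (∈-perp-perp W_A (∈-perp⁺ P_A (All.tabulate (λ {α} α∈ → trans (cong Tr (trans (*-comm (u + - a₀) α)
        (sym (trans (cong (α * (u + - a₀) +_) (zeroˡ _)) (+-identityʳ _))))) (All.lookup null (∈ₚ.∈-cartesianProduct⁺ α∈ (0∈ P_B)))))))
      , span⇒affine B (∈-perp-perp W_B (∈-perp⁺ P_B (All.tabulate (λ {β} β∈ → trans (cong Tr (trans (*-comm (fv u + - b₀) β)
        (sym (trans (cong (_+ β * (fv u + - b₀)) (zeroˡ _)) (+-identityˡ _))))) (All.lookup null (∈ₚ.∈-cartesianProduct⁺ (0∈ P_A) β∈))))))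

    incident⇒null : ∀ {u} → A._∈A u × B._∈A (fv u) → All (λ y → Tr (argument u y) ≡ 0#) Y
    incident⇒null {u} (a , b) = All.tabulate λ {y} y∈ → let α∈ , β∈ = ∈ₚ.∈-cartesianProduct⁻ (members P_A) (members P_B) y∈ in
      trans (Tr-+ _ _) (trans (cong₂ _+_ (∈-perp⁻ W_A α∈ (affine⇒span A a)) (∈-perp⁻ W_B β∈ (affine⇒span B b))) (+-identityˡ 0#))

    null-count : ∀ {N} → IsIncidence F K f A B N → length (filter (Null? R? Y) elements) ≡ N
    null-count (xs , u , spec , refl) = ↭ₚ.↭-length (unique-↭ (Uniqueₚ.filter⁺ (Null? R? Y) elements-unique) u
      (λ m → Equivalence.from (spec _) (null⇒incident (proj₂ (∈ₚ.∈-filter⁻ (Null? R? Y) {xs = elements} m))))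
      (λ {x} m → ∈ₚ.∈-filter⁺ (Null? R? Y) (elements-complete x) (incident⇒null (Equivalence.to (spec x) m))))

    T : Pair → ℕ
    T y = length (filter (λ u → R? u y) elements)

    -- The polynomial α X + β f. Because d ≥ 2, the term α X does not reach the leading coefficient,
    -- so the degree is d whenever β is nonzero, for every α.
    twisted : Carrier → Carrier → 𝒫
    twisted α β = β * Poly.coeff f Fin.zero ∷ β * Poly.coeff f (Fin.suc Fin.zero) + α ∷
                  tabulate (λ i → β * Poly.coeff f (Fin.suc (Fin.suc i)))

    eval-tabulate : ∀ {n} (c : Fin n → Carrier) x → eval₁ (tabulate c) x ≡ ∑ F (λ i → c i * pow F x (Fin.toℕ i))
    eval-tabulate {zero}  c x = refl
    eval-tabulate {suc n} c x = cong₂ _+_ (sym (*-identityʳ _)) (trans (cong (x *_) (eval-tabulate (λ i → c (Fin.suc i)) x)) (pull (λ i → c (Fin.suc i)) {Fin.toℕ}))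
      where
      open CommSemigroupProperties (CommutativeRing.*-commutativeSemigroup 𝕃) using (x∙yz≈y∙xz)
      pull : ∀ {n} (c : Fin n → Carrier) {e : Fin n → ℕ} → x * ∑ F (λ i → c i * pow F x (e i)) ≡ ∑ F (λ i → c i * (x * pow F x (e i)))
      pull {zero}  c = zeroʳ x
      pull {suc n} c {e} = trans (distribˡ x _ _) (cong₂ _+_ (x∙yz≈y∙xz x _ _) (pull (λ i → c (Fin.suc i)) {λ i → e (Fin.suc i)}))

    eval-tabulate-* : ∀ {n} β (c : Fin n → Carrier) x → eval₁ (tabulate (λ i → β * c i)) x ≡ β * eval₁ (tabulate c) x
    eval-tabulate-* {zero}  β c x = sym (zeroʳ β)
    eval-tabulate-* {suc n} β c x = trans (cong (β * c Fin.zero +_) (trans (cong (x *_) (eval-tabulate-* β (λ i → c (Fin.suc i)) x)) (x∙yz≈y∙xz x β _)))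
      (sym (distribˡ β _ _))
      where open CommSemigroupProperties (CommutativeRing.*-commutativeSemigroup 𝕃) using (x∙yz≈y∙xz)

    eval-twisted : ∀ α β u → eval₁ (twisted α β) u ≡ α * u + β * fv u
    eval-twisted α β u = trans (cong (λ z → β * c₀ + u * ((β * c₁ + α) + u * z)) (eval-tabulate-* β (λ i → Poly.coeff f (Fin.suc (Fin.suc i))) u))
      (trans (solve 6 (λ β c₀ u c₁ α z → β :* c₀ :+ u :* ((β :* c₁ :+ α) :+ u :* (β :* z)) := α :* u :+ β :* (c₀ :+ u :* (c₁ :+ u :* z))) refl β c₀ u c₁ α _)
        (cong (λ z → α * u + β * z) (eval-tabulate (Poly.coeff f) u)))
      where
      open NatSolver commutativeSemiring using (solve; _:+_; _:*_; _:=_)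
      c₀ = Poly.coeff f Fin.zero
      c₁ = Poly.coeff f (Fin.suc Fin.zero)

    coef-tabulate : ∀ {n} (c : Fin (suc n) → Carrier) → coef (tabulate c) n ≡ c (Fin.fromℕ n)
    coef-tabulate {zero}  c = refl
    coef-tabulate {suc n} c = coef-tabulate (λ i → c (Fin.suc i))

    length-twisted : ∀ α β → length (twisted α β) ≡ suc d
    length-twisted α β = cong (λ n → suc (suc n)) (Listₚ.length-tabulate (λ i → β * Poly.coeff f (Fin.suc (Fin.suc i))))

    exact-twisted : ∀ {α β} → β ≢ 0# → Exact (twisted α β) d
    exact-twisted {α} {β} nz = exact
      (λ i d<i → Bivariate.coef-above F (twisted α β) i (ℕₚ.≤-trans (ℕₚ.≤-reflexive (length-twisted α β)) d<i))
      (λ e → *-nonzero nz (Poly.leading f) (trans (sym (coef-tabulate (λ i → β * Poly.coeff f (Fin.suc (Fin.suc i))))) e))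

    -- Moving the base points to the other side turns the zeros of the affine form into a level set
    -- of Tr (α u + β f u), at the value of the form in a₀ and b₀.
    T≡ : ∀ α β → T (α , β) ≡ length (filter (λ u → Tr (α * u + β * fv u) ≟ Tr (α * a₀ + β * b₀)) elements)
    T≡ α β = filter-length-≐ (λ u → R? u (α , β)) _ (λ {u} e → trans (sym (split u)) (trans (cong (_+ Tr (α * a₀ + β * b₀)) e) (+-identityˡ _)))
        (λ {u} e → RingProperties.+-cancelʳ ring (Tr (α * a₀ + β * b₀)) _ _ (trans (split u) (trans e (sym (+-identityˡ _))))) elements
      where
      split : ∀ u → Tr (argument u (α , β)) + Tr (α * a₀ + β * b₀) ≡ Tr (α * u + β * fv u)
      split u = trans (sym (Tr-+ _ _)) (cong Tr (trans (interchange _ _ _ _) (cong₂ _+_ (merge α u a₀) (merge β (fv u) b₀))))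
        where
        open CommSemigroupProperties (CommutativeRing.+-commutativeSemigroup 𝕃) using (interchange)
        merge : ∀ α u a → α * (u + - a) + α * a ≡ α * u
        merge α u a = trans (sym (distribˡ α _ _)) (cong (α *_) (trans (+-assoc u _ a) (trans (cong (u +_) (-‿inverseˡ a)) (+-identityʳ u))))

    module _ {M} (M²≤Q : M ℕ.* M ℕ.≤ Q) (Q< : Q ℕ.< suc M ℕ.* suc M) where
      E : ℕ
      E = q ℕ.* (2 ℕ.* d) ℕ.* (3 ℕ.* M)

      T-bounds : ∀ {y} → y ≢ (0# , 0#) → q ℕ.* T y ℕ.≤ Q ℕ.+ E × Q ℕ.≤ q ℕ.* T y ℕ.+ E
      T-bounds {α , β} ne with β ≟ 0#
      ... | no nz = subst (λ t → q ℕ.* t ℕ.≤ Q ℕ.+ E × Q ℕ.≤ q ℕ.* t ℕ.+ E) (sym (trans (T≡ α β) (filter-length-≐ _ _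
            (λ {u} e → trans (cong Tr (eval-twisted α β u)) e) (λ {u} e → trans (cong Tr (sym (eval-twisted α β u))) e) elements)))
          ( level-upper {suc d''} coprime-q {twisted α β} (length-twisted α β) (exact-twisted nz) {M} M²≤Q Q< (Tr-In (α * a₀ + β * b₀))
          , level-lower {suc d''} coprime-q {twisted α β} (length-twisted α β) (exact-twisted nz) {M} M²≤Q Q< (Tr-In (α * a₀ + β * b₀)))
      ... | yes refl with α ≟ 0#
      ...   | yes refl = contradiction refl ne
      ...   | no nz = ℕₚ.≤-trans (ℕₚ.≤-reflexive exactly) (ℕₚ.m≤m+n Q E) , ℕₚ.≤-trans (ℕₚ.≤-reflexive (sym exactly)) (ℕₚ.m≤m+n _ E)
        where
        exactly : q ℕ.* T (α , 0#) ≡ Q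
        exactly = trans (cong (q ℕ.*_) (trans (T≡ α 0#) (filter-length-≐ _ _
            (λ {u} e → trans (cong Tr (same u)) e) (λ {u} e → trans (cong Tr (sym (same u))) e) elements)))
          (trans (form-equidistributed whole-space α (elements-complete _) (proj₂ (Tr-nondegenerate nz)) _ (Tr-In (α * a₀ + 0# * b₀))) card)
          where
          same : ∀ u → u * α ≡ α * u + 0# * fv u
          same u = trans (*-comm u α) (sym (trans (cong (α * u +_) (zeroˡ _)) (+-identityʳ _)))

      T-0 : T (0# , 0#) ≡ Q
      T-0 = trans (cong length (Listₚ.filter-all (λ u → R? u (0# , 0#)) {xs = elements} (All.tabulate (λ {u} _ →
        trans (cong Tr (trans (cong₂ _+_ (zeroˡ _) (zeroˡ _)) (+-identityˡ 0#))) Tr-0)))) card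

      _≟ᴾ_ : ∀ (x y : Pair) → Dec (x ≡ y)
      _≟ᴾ_ = Productₚ.≡-dec _≟_ _≟_

      rest : List Pair
      rest = filter (λ y → ¬? (y ≟ᴾ (0# , 0#))) Y

      Y↭ : Y ↭ (0# , 0#) ∷ rest
      Y↭ = remove-↭ _≟ᴾ_ Y-unique (∈ₚ.∈-cartesianProduct⁺ (0∈ P_A) (0∈ P_B))

      balance : ∀ {N} → IsIncidence F K f A B N →
        q ℕ.* (Q ℕ.+ sum (map T rest)) ℕ.+ N ℕ.* suc (length rest) ≡ q ℕ.* (N ℕ.* suc (length rest)) ℕ.+ Q ℕ.* suc (length rest)
      balance {N} inc = subst₂ (λ S L → q ℕ.* S ℕ.+ N ℕ.* L ≡ q ℕ.* (N ℕ.* L) ℕ.+ Q ℕ.* L)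
        (trans (count-swap R? elements Y) (trans (sum-↭ (↭ₚ.map⁺ T Y↭)) (cong (ℕ._+ sum (map T rest)) T-0)))
        (↭ₚ.↭-length Y↭)
        (subst₂ (λ n X → q ℕ.* sum (map (count R? Y) elements) ℕ.+ n ℕ.* length Y ≡ q ℕ.* (n ℕ.* length Y) ℕ.+ X ℕ.* length Y)
          (null-count inc) card (balanced-count R? q Y elements (λ {u} _ ¬null → balanced u ¬null)))

      rest-bounds : q ℕ.* sum (map T rest) ℕ.≤ length rest ℕ.* (Q ℕ.+ E) × length rest ℕ.* Q ℕ.≤ q ℕ.* sum (map T rest) ℕ.+ length rest ℕ.* E
      rest-bounds = sum-bounds q Q E T rest (λ m → T-bounds (proj₂ (∈ₚ.∈-filter⁻ (λ y → ¬? (y ≟ᴾ (0# , 0#))) {xs = Y} m)))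

      -- The number of pairs is the product of the sizes of the two annihilators, and each
      -- annihilator times its subspace has Q elements in all.
      size : suc (length rest) ℕ.* q ℕ.^ (s ℕ.+ m) ≡ Q ℕ.* Q
      size = trans (cong₂ ℕ._*_ (trans (sym (↭ₚ.↭-length Y↭)) (length-cartesianProductWith _,_ (members P_A) (members P_B)))
          (trans (ℕₚ.^-distribˡ-+-* q s m) (sym (cong₂ ℕ._*_ (length-span A.dirs) (length-span B.dirs)))))
        (trans (interchange (length (members P_A)) (length (members P_B)) (length (members W_A)) (length (members W_B))) (cong₂ ℕ._*_ (perp-card W_A) (perp-card W_B)))
        where open CommSemigroupProperties ℕₚ.*-commutativeSemigroup using (interchange)

      0<Q : 0 ℕ.< Q
      0<Q = ℕₚ.<-trans (ℕ.s≤s ℕ.z≤n) 1<Q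

      incidence-bounds : ∀ {N} → IsIncidence F K f A B N →
        Q ℕ.* N ℕ.≤ q ℕ.^ (s ℕ.+ m) ℕ.+ 12 ℕ.* d ℕ.* M ℕ.* Q × q ℕ.^ (s ℕ.+ m) ℕ.≤ Q ℕ.* N ℕ.+ 12 ℕ.* d ℕ.* M ℕ.* Q
      incidence-bounds {N} inc =
          conclude-upper {L = suc (length rest)} {d = d} {M} 1<q 0<Q size (rest-upper {q} {Q} {N} {length rest} {sum (map T rest)} {E} (balance inc) (proj₁ rest-bounds))
        , conclude-lower {L = suc (length rest)} {d = d} {M} 1<q 0<Q size (rest-lower {q} {Q} {N} {length rest} {sum (map T rest)} {E} (balance inc) (proj₂ rest-bounds))

  -- The asymptotic formula is multiplied by Q and squared, which clears q^(-r) and q^(r/2). The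
  -- error 12 d M Q then becomes (12 d)² M² Q², at most (12 d)² Q³ since M² ≤ Q.
  incidence-error : ∀ {N} → IsIncidence F K f A B N →
    let δ = ℤ.+ Q ℤ.* ℤ.+ N ℤ.- ℤ.+ (q ℕ.^ (s ℕ.+ m)) in
    δ ℤ.* δ ℤ.≤ ℤ.+ ((12 ℕ.* d) ℕ.* (12 ℕ.* d) ℕ.* q ℕ.^ (3 ℕ.* suc r'))
  incidence-error {N} inc with StepanovArithmetic.integer-sqrt Q
  ... | M , M²≤Q , Q< = ℤₚ.≤-trans
      (subst (λ z → (z ℤ.- ℤ.+ (q ℕ.^ (s ℕ.+ m))) ℤ.* (z ℤ.- ℤ.+ (q ℕ.^ (s ℕ.+ m))) ℤ.≤ ℤ.+ (12 ℕ.* d ℕ.* M ℕ.* Q ℕ.* (12 ℕ.* d ℕ.* M ℕ.* Q)))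
        (ℤₚ.pos-* Q N) (square-difference (proj₁ (incidence-bounds {M} M²≤Q Q< inc)) (proj₂ (incidence-bounds {M} M²≤Q Q< inc))))
      (ℤ.+≤+ (ℕₚ.≤-trans (ℕₚ.≤-reflexive (solve 3 (λ c M Q → c :* M :* Q :* (c :* M :* Q) := c :* c :* (M :* M :* (Q :* Q))) refl (12 ℕ.* d) M Q))
        (ℕₚ.*-monoʳ-≤ (12 ℕ.* d ℕ.* (12 ℕ.* d)) (ℕₚ.≤-trans (ℕₚ.*-monoˡ-≤ (Q ℕ.* Q) M²≤Q) (ℕₚ.≤-reflexive cube)))))
    where
    open +-*-Solver
    cube : Q ℕ.* (Q ℕ.* Q) ≡ q ℕ.^ (3 ℕ.* suc r')
    cube = trans (cong (λ z → Q ℕ.* (Q ℕ.* z)) (sym (ℕₚ.*-identityʳ Q))) (trans (ℕₚ.^-*-assoc q (suc r') 3) (cong (q ℕ.^_) (ℕₚ.*-comm (suc r') 3)))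

open import Data.Nat using (_^_; _≤_; _<_; _+_; _*_)
open import Data.Integer using (+_)

theorem15 : Σ ℕ λ C →
    (F : FiniteField) (p q r : ℕ) → Prime p → natMul F p ≡ FiniteField.0# F →
    (K : Subfield F q) → 1 < r → length (FiniteField.elements F) ≡ q ^ r →
    (d : ℕ) → 2 ≤ d → Coprime d p → (f : Poly F d) →
    (s m : ℕ) (A : AffineSubspace F K s) (B : AffineSubspace F K m) →
    (N : ℕ) → IsIncidence F K f A B N →
    let D = ((+ (q ^ r)) ℤ.* (+ N)) ℤ.- (+ (q ^ (s + m))) in
    D ℤ.* D ℤ.≤ + ((C * d) * (C * d) * q ^ (3 * r))
theorem15 = 12 , λ { F p q (suc r') pp char K _ card (suc (suc d'')) (ℕ.s≤s (ℕ.s≤s _)) coprime f s m A B N inc →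
  Incidence.incidence-error F pp char {q} {r'} K card coprime f A B inc }
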